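{- The Smale horseshoe $\Lambda$ is a computable (recursive) closed subset in $I=[0,1]\times[0,1]$.
   Context: Smale horseshoe: let $I=[0,1]^2$, and let $\mu>1$ and $0<\lambda<1$ be real numbers. The horseshoe map $f$ is defined over $I$, is a bijection onto its image in $\mathbb{R}^2$, and performs a linear vertical expansion of $I$ by the factor $\mu$ and a linear horizontal contraction of $I$ by the factor $\lambda$, followed by a folding. In the standard precise form: there are two disjoint horizontal strips $H_i=[0,1]\times[c_i,c_i+\mu^{ -1}]\subset I$ ($i=1,2$) and two disjoint vertical strips $V_i=[d_i,d_i+\lambda]\times[0,1]\subset I$ ($i=1,2$), and $f:I\to\mathbb{R}^2$ is a continuous injective map such that $f(I)\cap I=V_1\cup V_2$, $f^{ -1}(I)=H_1\cup H_2$, $f(H_i)=V_i$, with $f(x,y)=(d_1+\lambda x,\ \mu(y-c_1))$ on $H_1$ and $f(x,y)=(d_2+\lambda(1-x),\ 1-\mu(y-c_2))$ on $H_2$. The Smale horseshoe is the set $\Lambda=\bigcap_{j=-\infty}^{+\infty}f^j(I)$ (with all iterates intersected with $I$), i.e. the set of points $p\in I$ for which there is a bi-infinite sequence $(p_j)_{j\in\mathbb{Z}}$ in $I$ with $p_0=p$ and $f(p_j)=p_{j+1}$ for all $j\in\mathbb{Z}$. It is invariant: $f(\Lambda)=\Lambda$. Computability: a sequence of rational numbers is computable if it can be written as $(-1)^{a(k)}\frac{b(k)}{c(k)+1}$ with computable functions $a,b,c:\mathbb{N}\to\mathbb{N}$; a sequence in $\mathbb{Q}^n$ is computable if its component sequences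 are. An open set $E\subseteq\mathbb{R}^n$ is r.e. open if there are computable sequences $\{a_k\}$, $\{r_k\}$, $a_k\in\mathbb{Q}^n$, $r_k\in\mathbb{Q}$, such that $E=\bigcup_{k=0}^{\infty}B(a_k,r_k)$, where $B(a,r)=\{x\in\mathbb{R}^n:|x-a|<r\}$. A closed set $A\subseteq\mathbb{R}^n$ is r.e. closed if there is a computable sequence $\{b_k\}$, $b_k\in\mathbb{Q}^n$, such that $\{b_k\}$ is dense in $A$; it is co-r.e. closed if its complement $A^c$ is r.e. open; it is computable (or recursive) if it is both r.e. closed and co-r.e. closed. Here $n=2$.
   Formalization: μ, λ, c_i, d_i are assumed to be computable reals (otherwise false); the dense sequence making Λ r.e. closed consists of uniformly computable real points of Λ, and of rational points when the parameters are rational, since for irrational ones Λ may contain no rational point. -}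

module Defs where

open import Level using (0ℓ)
open import Data.Nat as ℕ using (ℕ; zero; suc)
import Data.Nat.Properties as ℕ
open import Data.Integer as ℤ using (ℤ; +_; 0ℤ; -1ℤ)
open import Data.Rational as ℚ using (ℚ; 0ℚ; 1ℚ; ½; ∣_∣)
import Data.Rational.Properties as ℚ
open import Data.Rational.Solver using (module +-*-Solver)
open import Data.Fin using (Fin)
open import Data.Vec using (Vec; []; _∷_; head; lookup)
open import Data.Vec.Relation.Binary.Pointwise.Inductive using (Pointwise)
open import Data.Product using (Σ; ∃; ∃-syntax; _×_; _,_; proj₁; proj₂)
open import Data.Product.Relation.Binary.Pointwise.NonDependent
  using () renaming (Pointwise to ×-Pointwise)
open import Function using (_∘_; _on_)
open import Function.Definitions using (Congruent; Injective)
open import Relation.Binary using (Rel)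
open import Relation.Binary.PropositionalEquality
  using (_≡_; refl; sym; trans; cong; subst; subst₂)
open import Relation.Unary using (Pred; _∈_; _⊆_; _∩_; _∪_; _≐_; _⊥_; ∁; _⟨×⟩_)

------------------------------------------------------------------------
-- Computable functions: the partial recursive functions of Kleene

data Code : ℕ → Set where
  zeroᶜ : Code 0
  sucᶜ  : Code 1
  projᶜ : ∀ {n} → Fin n → Code n
  compᶜ : ∀ {m n} → Code m → Vec (Code n) m → Code n
  recᶜ  : ∀ {n} → Code n → Code (suc (suc n)) → Code (suc n)
  minᶜ  : ∀ {n} → Code (suc n) → Code n

infix 4 _[_]⇓_

data _[_]⇓_ : ∀ {n} → Code n → Vec ℕ n → ℕ → Set where
  zero⇓ : zeroᶜ [ [] ]⇓ 0
  suc⇓  : ∀ {x} → sucᶜ [ x ∷ [] ]⇓ suc x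
  proj⇓ : ∀ {n} {i : Fin n} {xs} → projᶜ i [ xs ]⇓ lookup xs i
  comp⇓ : ∀ {m n} {g : Code m} {hs : Vec (Code n) m} {xs ys z} →
          Pointwise (λ h y → h [ xs ]⇓ y) hs ys → g [ ys ]⇓ z →
          compᶜ g hs [ xs ]⇓ z
  rec⇓₀ : ∀ {n} {g : Code n} {h xs z} →
          g [ xs ]⇓ z → recᶜ g h [ 0 ∷ xs ]⇓ z
  rec⇓₊ : ∀ {n} {g : Code n} {h k xs y z} →
          recᶜ g h [ k ∷ xs ]⇓ y → h [ k ∷ y ∷ xs ]⇓ z →
          recᶜ g h [ suc k ∷ xs ]⇓ z
  min⇓  : ∀ {n} {g : Code (suc n)} {xs k} →
          g [ k ∷ xs ]⇓ 0 →
          (∀ {m} → m ℕ.< k → ∃[ y ] g [ m ∷ xs ]⇓ suc y) →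
          minᶜ g [ xs ]⇓ k

Computable : ∀ {n} → (Vec ℕ n → ℕ) → Set
Computable f = ∃[ e ] ∀ xs → e [ xs ]⇓ f xs

record Computableℚ {n : ℕ} (q : Vec ℕ n → ℚ) : Set where
  field
    a b c        : Vec ℕ n → ℕ
    a-computable : Computable a
    b-computable : Computable b
    c-computable : Computable c
    q≡           : ∀ xs → q xs ≡ (-1ℤ ℤ.^ a xs ℤ.* + b xs) ℚ./ suc (c xs)

ComputableSeqℚ : (ℕ → ℚ) → Set
ComputableSeqℚ q = Computableℚ {1} (q ∘ head)

ComputableDoubleSeqℚ : (ℕ → ℕ → ℚ) → Set
ComputableDoubleSeqℚ q = Computableℚ {2} (λ { (k ∷ j ∷ []) → q k j })

------------------------------------------------------------------------
-- Real numbers as Cauchy sequences of rationals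

Cauchy : (ℕ → ℚ) → Set
Cauchy s = ∀ {ε} → 0ℚ ℚ.< ε →
  ∃[ N ] ∀ {m n} → N ℕ.≤ m → N ℕ.≤ n → ∣ s m ℚ.- s n ∣ ℚ.< ε

record ℝ : Set where
  constructor real
  field
    seq    : ℕ → ℚ
    cauchy : Cauchy seq
open ℝ public

infix 4 _≈_ _≤_ _<_

_≈_ _≤_ _<_ : Rel ℝ 0ℓ
x ≈ y = ∀ {ε} → 0ℚ ℚ.< ε →
  ∃[ N ] ∀ {n} → N ℕ.≤ n → ∣ seq x n ℚ.- seq y n ∣ ℚ.< ε
x ≤ y = ∀ {ε} → 0ℚ ℚ.< ε →
  ∃[ N ] ∀ {n} → N ℕ.≤ n → seq x n ℚ.< seq y n ℚ.+ ε
x < y = ∃[ ε ] 0ℚ ℚ.< ε ×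
  ∃[ N ] ∀ {n} → N ℕ.≤ n → seq x n ℚ.+ ε ℚ.< seq y n

private
  open +-*-Solver using (solve; _:+_; _:*_; _:-_; :-_; _:=_)

  half-pos : ∀ {ε} → 0ℚ ℚ.< ε → 0ℚ ℚ.< ε ℚ.* ½
  half-pos {ε} 0<ε = subst (ℚ._< ε ℚ.* ½) (ℚ.*-zeroˡ ½) (ℚ.*-monoˡ-<-pos ½ 0<ε)

  half+half : ∀ ε → ε ℚ.* ½ ℚ.+ ε ℚ.* ½ ≡ ε
  half+half ε = trans (sym (ℚ.*-distribˡ-+ ε ½ ½)) (ℚ.*-identityʳ ε)

  +-cauchy : ∀ {s t} → Cauchy s → Cauchy t → Cauchy (λ n → s n ℚ.+ t n)
  +-cauchy {s} {t} cs ct {ε} 0<ε with cs (half-pos 0<ε) | ct (half-pos 0<ε)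
  ... | M , hs | N , ht = M ℕ.⊔ N , λ {m} {n} p q → begin-strict
    ∣ (s m ℚ.+ t m) ℚ.- (s n ℚ.+ t n) ∣
      ≡⟨ cong ∣_∣ (solve 4 (λ a b c d → (a :+ b) :- (c :+ d) := (a :- c) :+ (b :- d))
                     refl (s m) (t m) (s n) (t n)) ⟩
    ∣ (s m ℚ.- s n) ℚ.+ (t m ℚ.- t n) ∣
      ≤⟨ ℚ.∣p+q∣≤∣p∣+∣q∣ (s m ℚ.- s n) (t m ℚ.- t n) ⟩
    ∣ s m ℚ.- s n ∣ ℚ.+ ∣ t m ℚ.- t n ∣
      <⟨ ℚ.+-mono-< (hs (ℕ.m⊔n≤o⇒m≤o M N p) (ℕ.m⊔n≤o⇒m≤o M N q))
                    (ht (ℕ.m⊔n≤o⇒n≤o M N p) (ℕ.m⊔n≤o⇒n≤o M N q)) ⟩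
    ε ℚ.* ½ ℚ.+ ε ℚ.* ½ ≡⟨ half+half ε ⟩
    ε ∎
    where open ℚ.≤-Reasoning

  neg-cauchy : ∀ {s} → Cauchy s → Cauchy (λ n → ℚ.- s n)
  neg-cauchy {s} cs {ε} 0<ε with cs 0<ε
  ... | N , hs = N , λ {m} {n} p q → subst (ℚ._< ε) (sym (eq m n)) (hs p q)
    where
    eq : ∀ m n → ∣ (ℚ.- s m) ℚ.- (ℚ.- s n) ∣ ≡ ∣ s m ℚ.- s n ∣
    eq m n = trans
      (cong ∣_∣ (solve 2 (λ a b → (:- a) :- (:- b) := :- (a :- b)) refl (s m) (s n)))
      (ℚ.∣-p∣≡∣p∣ (s m ℚ.- s n))

  eventually-bounded : ∀ {s} → Cauchy s →
    ∃[ B ] ℚ.Positive B × ∃[ N ] ∀ {n} → N ℕ.≤ n → ∣ s n ∣ ℚ.≤ B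
  eventually-bounded {s} cs with cs (ℚ.positive⁻¹ 1ℚ)
  ... | N , h = 1ℚ ℚ.+ ∣ s N ∣
              , ℚ.pos+nonNeg⇒pos 1ℚ ∣ s N ∣ {{ℚ.∣-∣-nonNeg (s N)}}
              , N , λ {n} p → begin
    ∣ s n ∣ ≡⟨ cong ∣_∣ (solve 2 (λ a b → a := (a :- b) :+ b) refl (s n) (s N)) ⟩
    ∣ (s n ℚ.- s N) ℚ.+ s N ∣ ≤⟨ ℚ.∣p+q∣≤∣p∣+∣q∣ (s n ℚ.- s N) (s N) ⟩
    ∣ s n ℚ.- s N ∣ ℚ.+ ∣ s N ∣ ≤⟨ ℚ.+-monoˡ-≤ ∣ s N ∣ (ℚ.<⇒≤ (h p ℕ.≤-refl)) ⟩
    1ℚ ℚ.+ ∣ s N ∣ ∎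
    where open ℚ.≤-Reasoning

  scaled-cauchy : ∀ {s} B .{{_ : ℚ.Positive B}} → Cauchy s → ∀ {ε} → 0ℚ ℚ.< ε →
    ∃[ N ] ∀ {m n} → N ℕ.≤ m → N ℕ.≤ n → B ℚ.* ∣ s m ℚ.- s n ∣ ℚ.< ε
  scaled-cauchy {s} B cs {ε} 0<ε with cs 0<δ
    where
    instance
      B≢0 : ℚ.NonZero B
      B≢0 = ℚ.pos⇒nonZero B
    0<δ : 0ℚ ℚ.< ℚ.1/ B ℚ.* ε
    0<δ = subst (ℚ._< ℚ.1/ B ℚ.* ε) (ℚ.*-zeroʳ (ℚ.1/ B))
            (ℚ.*-monoʳ-<-pos (ℚ.1/ B) {{ℚ.1/pos⇒pos B}} 0<ε)
  ... | N , h = N , λ p q → subst (_ ℚ.<_) B*δ≡ε (ℚ.*-monoʳ-<-pos B (h p q))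
    where
    instance
      B≢0 : ℚ.NonZero B
      B≢0 = ℚ.pos⇒nonZero B
    B*δ≡ε : B ℚ.* (ℚ.1/ B ℚ.* ε) ≡ ε
    B*δ≡ε = trans (sym (ℚ.*-assoc B (ℚ.1/ B) ε))
              (trans (cong (ℚ._* ε) (ℚ.*-inverseʳ B)) (ℚ.*-identityˡ ε))

  *-split : ∀ a b c d → a ℚ.* b ℚ.- c ℚ.* d ≡ a ℚ.* (b ℚ.- d) ℚ.+ d ℚ.* (a ℚ.- c)
  *-split = solve 4 (λ a b c d → a :* b :- c :* d := a :* (b :- d) :+ d :* (a :- c)) refl

  ∣*∣-bound : ∀ u v C → ∣ u ∣ ℚ.≤ C → ∣ u ℚ.* v ∣ ℚ.≤ C ℚ.* ∣ v ∣
  ∣*∣-bound u v C u≤C = subst (ℚ._≤ C ℚ.* ∣ v ∣) (sym (ℚ.∣p*q∣≡∣p∣*∣q∣ u v))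
    (ℚ.*-monoʳ-≤-nonNeg ∣ v ∣ {{ℚ.∣-∣-nonNeg v}} u≤C)

  *-close : ∀ a b c d A B → ∣ a ∣ ℚ.≤ A → ∣ d ∣ ℚ.≤ B →
    ∣ a ℚ.* b ℚ.- c ℚ.* d ∣ ℚ.≤ A ℚ.* ∣ b ℚ.- d ∣ ℚ.+ B ℚ.* ∣ a ℚ.- c ∣
  *-close a b c d A B a≤A d≤B = ℚ.≤-trans
    (ℚ.≤-reflexive (cong ∣_∣ (*-split a b c d)))
    (ℚ.≤-trans (ℚ.∣p+q∣≤∣p∣+∣q∣ (a ℚ.* (b ℚ.- d)) (d ℚ.* (a ℚ.- c)))
      (ℚ.+-mono-≤ (∣*∣-bound a (b ℚ.- d) A a≤A) (∣*∣-bound d (a ℚ.- c) B d≤B)))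

  *-cauchy : ∀ {s t} → Cauchy s → Cauchy t → Cauchy (λ n → s n ℚ.* t n)
  *-cauchy {s} {t} cs ct {ε} 0<ε =
    let A , A>0 , K , bs = eventually-bounded {s} cs
        B , B>0 , L , bt = eventually-bounded {t} ct
        M , ht = scaled-cauchy {t} A {{A>0}} ct (half-pos 0<ε)
        N , hs = scaled-cauchy {s} B {{B>0}} cs (half-pos 0<ε)
        left : ∀ {o} → (K ℕ.⊔ L) ℕ.⊔ (M ℕ.⊔ N) ℕ.≤ o → K ℕ.⊔ L ℕ.≤ o
        left = ℕ.m⊔n≤o⇒m≤o (K ℕ.⊔ L) (M ℕ.⊔ N)
        right : ∀ {o} → (K ℕ.⊔ L) ℕ.⊔ (M ℕ.⊔ N) ℕ.≤ o → M ℕ.⊔ N ℕ.≤ o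
        right = ℕ.m⊔n≤o⇒n≤o (K ℕ.⊔ L) (M ℕ.⊔ N)
    in (K ℕ.⊔ L) ℕ.⊔ (M ℕ.⊔ N) , λ {m} {n} p q →
      subst (∣ s m ℚ.* t m ℚ.- s n ℚ.* t n ∣ ℚ.<_) (half+half ε)
        (ℚ.≤-<-trans
          (*-close (s m) (t m) (s n) (t n) A B
            (bs (ℕ.m⊔n≤o⇒m≤o K L (left p))) (bt (ℕ.m⊔n≤o⇒n≤o K L (left q))))
          (ℚ.+-mono-<
            (ht (ℕ.m⊔n≤o⇒m≤o M N (right p)) (ℕ.m⊔n≤o⇒m≤o M N (right q)))
            (hs (ℕ.m⊔n≤o⇒n≤o M N (right p)) (ℕ.m⊔n≤o⇒n≤o M N (right q)))))

  const-cauchy : ∀ q → Cauchy (λ _ → q)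
  const-cauchy q {ε} 0<ε =
    0 , λ _ _ → subst (ℚ._< ε) (cong ∣_∣ (sym (ℚ.+-inverseʳ q))) 0<ε

infixl 6 _+_ _-_
infixl 7 _*_
infix  8 -_

fromℚ : ℚ → ℝ
fromℚ q = real (λ _ → q) (const-cauchy q)

0ℝ 1ℝ : ℝ
0ℝ = fromℚ 0ℚ
1ℝ = fromℚ 1ℚ

_+_ _*_ : ℝ → ℝ → ℝ
x + y = real (λ n → seq x n ℚ.+ seq y n) (+-cauchy {seq x} {seq y} (cauchy x) (cauchy y))
x * y = real (λ n → seq x n ℚ.* seq y n) (*-cauchy {seq x} {seq y} (cauchy x) (cauchy y))

-_ : ℝ → ℝ
- x = real (λ n → ℚ.- seq x n) (neg-cauchy {seq x} (cauchy x))

_-_ : ℝ → ℝ → ℝ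
x - y = x + (- y)

Interval : ℝ → ℝ → Pred ℝ 0ℓ
Interval a b x = a ≤ x × x ≤ b

2^-_ : ℕ → ℚ
2^- j = (+ 1 ℚ./ (2 ℕ.^ j)) {{ℕ.m^n≢0 2 j}}

-- |x - q| ≤ 2⁻ʲ
Approximates : ℕ → ℚ → ℝ → Set
Approximates j q x = x ∈ Interval (fromℚ (q ℚ.- 2^- j)) (fromℚ (q ℚ.+ 2^- j))

ComputableReal : ℝ → Set
ComputableReal x =
  ∃[ q ] ComputableSeqℚ q × (∀ j → Approximates j (q j) x)

-- Uniform in k, hence stronger than computability of each term.
ComputableSeqℝ : (ℕ → ℝ) → Set
ComputableSeqℝ x =
  ∃[ q ] ComputableDoubleSeqℚ q × (∀ k j → Approximates j (q k j) (x k))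

Rational : ℝ → Set
Rational x = ∃[ q ] x ≈ fromℚ q

------------------------------------------------------------------------
-- The plane

ℚ² ℝ² : Set
ℚ² = ℚ × ℚ
ℝ² = ℝ × ℝ

infix 4 _≈₂_

_≈₂_ : Rel ℝ² 0ℓ
_≈₂_ = ×-Pointwise _≈_ _≈_

fromℚ² : ℚ² → ℝ²
fromℚ² (a , b) = fromℚ a , fromℚ b

-- The Euclidean |p - a| < r with both sides squared; empty for r ≤ 0.
Ball : ℝ² → ℝ → Pred ℝ² 0ℓ
Ball (a₁ , a₂) r (x , y) =
  0ℝ < r × (x - a₁) * (x - a₁) + (y - a₂) * (y - a₂) < r * r

Open Closed : Pred ℝ² 0ℓ → Set
Open E   = ∀ {p} → p ∈ E → ∃[ r ] 0ℝ < r × Ball p r ⊆ E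
Closed A = Open (∁ A)

_DenseIn_ : (ℕ → ℝ²) → Pred ℝ² 0ℓ → Set
b DenseIn A =
  (∀ k → b k ∈ A) × (∀ {p} → p ∈ A → ∀ {ε} → 0ℝ < ε → ∃[ k ] b k ∈ Ball p ε)

ComputableSeqℚ² : (ℕ → ℚ²) → Set
ComputableSeqℚ² b = ComputableSeqℚ (proj₁ ∘ b) × ComputableSeqℚ (proj₂ ∘ b)

ComputableSeqℝ² : (ℕ → ℝ²) → Set
ComputableSeqℝ² b = ComputableSeqℝ (proj₁ ∘ b) × ComputableSeqℝ (proj₂ ∘ b)

REOpen : Pred ℝ² 0ℓ → Set
REOpen E = Σ (ℕ → ℚ²) λ a → Σ (ℕ → ℚ) λ r →
  ComputableSeqℚ² a × ComputableSeqℚ r ×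
  E ≐ (λ p → ∃[ k ] p ∈ Ball (fromℚ² (a k)) (fromℚ (r k)))

CoREClosed : Pred ℝ² 0ℓ → Set
CoREClosed A = REOpen (∁ A)

REClosedℚ : Pred ℝ² 0ℓ → Set
REClosedℚ A = ∃[ b ] ComputableSeqℚ² b × (fromℚ² ∘ b) DenseIn A

-- A closed set need not contain any rational point ({√2} × {0}, or a
-- horseshoe with irrational parameters), so in general the points of the
-- dense sequence have to be computable reals rather than rationals.
REClosed : Pred ℝ² 0ℓ → Set
REClosed A = ∃[ b ] ComputableSeqℝ² b × b DenseIn A

record ComputableClosedℚ (A : Pred ℝ² 0ℓ) : Set where
  field
    closed     : Closed A
    reClosed   : REClosedℚ A
    coREClosed : CoREClosed A

record ComputableClosed (A : Pred ℝ² 0ℓ) : Set where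
  field
    closed     : Closed A
    reClosed   : REClosed A
    coREClosed : CoREClosed A

------------------------------------------------------------------------
-- The horseshoe map

I : Pred ℝ² 0ℓ
I = Interval 0ℝ 1ℝ ⟨×⟩ Interval 0ℝ 1ℝ

_≈ᴵ_ : Rel (∃ I) 0ℓ
_≈ᴵ_ = _≈₂_ on proj₁

Continuous : (∃ I → ℝ²) → Set
Continuous f = ∀ p {ε} → 0ℝ < ε →
  ∃[ δ ] 0ℝ < δ × (∀ q → proj₁ q ∈ Ball (proj₁ p) δ → f q ∈ Ball (f p) ε)

Image : (∃ I → ℝ²) → Pred ℝ² 0ℓ → Pred ℝ² 0ℓ
Image f P q = ∃[ p ] proj₁ p ∈ P × f p ≈₂ q

Preimage : (∃ I → ℝ²) → Pred ℝ² 0ℓ → Pred ℝ² 0ℓ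
Preimage f P p = Σ (p ∈ I) λ p∈I → f (p , p∈I) ∈ P

record Parameters : Set where
  field
    μ μ⁻¹ ƛ     : ℝ
    c₁ c₂ d₁ d₂ : ℝ
    1<μ         : 1ℝ < μ
    μ*μ⁻¹≈1     : μ * μ⁻¹ ≈ 1ℝ
    0<ƛ         : 0ℝ < ƛ
    ƛ<1         : ƛ < 1ℝ

  H₁ H₂ V₁ V₂ : Pred ℝ² 0ℓ
  H₁ = Interval 0ℝ 1ℝ ⟨×⟩ Interval c₁ (c₁ + μ⁻¹)
  H₂ = Interval 0ℝ 1ℝ ⟨×⟩ Interval c₂ (c₂ + μ⁻¹)
  V₁ = Interval d₁ (d₁ + ƛ) ⟨×⟩ Interval 0ℝ 1ℝ
  V₂ = Interval d₂ (d₂ + ƛ) ⟨×⟩ Interval 0ℝ 1ℝ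

-- The set Λ need not be computable without this: for instance, if d₁ < d₂
-- then the least abscissa of a point of Λ is the solution of x = d₁ + ƛ x.
record ComputableParameters (P : Parameters) : Set where
  open Parameters P
  field
    μ-computable  : ComputableReal μ
    ƛ-computable  : ComputableReal ƛ
    c₁-computable : ComputableReal c₁
    c₂-computable : ComputableReal c₂
    d₁-computable : ComputableReal d₁
    d₂-computable : ComputableReal d₂

record RationalParameters (P : Parameters) : Set where
  open Parameters P
  field
    μ-rational  : Rational μ
    ƛ-rational  : Rational ƛ
    c₁-rational : Rational c₁
    c₂-rational : Rational c₂
    d₁-rational : Rational d₁
    d₂-rational : Rational d₂

record Horseshoe : Set where
  field
    parameters : Parameters

  open Parameters parameters public

  field
    H₁⊆I  : H₁ ⊆ I
    H₂⊆I  : H₂ ⊆ I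
    V₁⊆I  : V₁ ⊆ I
    V₂⊆I  : V₂ ⊆ I
    H₁⊥H₂ : H₁ ⊥ H₂
    V₁⊥V₂ : V₁ ⊥ V₂

    f            : ∃ I → ℝ²
    f-cong       : Congruent _≈ᴵ_ _≈₂_ f
    f-injective  : Injective _≈ᴵ_ _≈₂_ f
    f-continuous : Continuous f

    f[I]∩I  : Image f I ∩ I ≐ V₁ ∪ V₂
    f⁻¹[I]  : Preimage f I ≐ H₁ ∪ H₂
    f[H₁]   : Image f H₁ ≐ V₁
    f[H₂]   : Image f H₂ ≐ V₂
    f-on-H₁ : ∀ {x y} (h : (x , y) ∈ H₁) →
              f ((x , y) , H₁⊆I {x , y} h) ≈₂ (d₁ + ƛ * x , μ * (y - c₁))
    f-on-H₂ : ∀ {x y} (h : (x , y) ∈ H₂) →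
              f ((x , y) , H₂⊆I {x , y} h) ≈₂ (d₂ + ƛ * (1ℝ - x) , 1ℝ - μ * (y - c₂))

  Λ : Pred ℝ² 0ℓ
  Λ q = q ∈ I × Σ (ℤ → ∃ I) λ p →
    proj₁ (p 0ℤ) ≈₂ q × (∀ j → f (p j) ≈₂ proj₁ (p (ℤ.suc j)))

{-# OPTIONS --safe #-}

-- On the strips the map contracts x and expands y affinely, so a point (x, y)
-- lies on a full orbit in the square exactly when x has an infinite past and y
-- an infinite future: Λ = X × Y, where X and Y are the attractors of the
-- iterated function systems {d₁ + ƛ x, d₂ + ƛ (1 - x)} and
-- {c₁ + μ⁻¹ y, c₂ + μ⁻¹ (1 - y)} on the unit interval. The strips are disjoint,
-- so both ratios are at most ½. The images of the fixed point of the first map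
-- under all words of length n therefore form a 2⁻ⁿ-net of the attractor made of
-- points of the attractor, uniformly computable from the parameters and rational
-- if these are. This is a computable dense sequence, and the distance from a
-- rational q to the net, less a multiple of 2⁻ⁿ, is the radius of a ball around
-- q that misses the attractor. These balls exhaust the complement because the
-- attractor is closed: its closure is covered by its own two images, and the
-- attractor contains every subset of the unit interval with that property.

module Submission where

open import Defs
open import Level using (0ℓ)
open import Algebra.Bundles using (CommutativeRing)
import Algebra.Solver.Ring as RingSolver
open import Algebra.Solver.Ring.AlmostCommutativeRing
  using (_-Raw-AlmostCommutative⟶_; fromCommutativeRing; module AlmostCommutativeRing)
open import Algebra.Structures using (IsCommutativeRing)
open import Axiom.ExcludedMiddle using (ExcludedMiddle)
open import Data.Bool using (Bool; true; false; if_then_else_)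
open import Data.Empty using (⊥; ⊥-elim)
open import Data.Fin using (Fin; zero; suc)
open import Data.Integer as ℤ using (ℤ; +_; -[1+_]; 0ℤ; -1ℤ)
import Data.Integer.Properties as ℤ
open import Data.Maybe using (Maybe; just; nothing)
open import Data.Nat as ℕ using (ℕ; zero; suc)
import Data.Nat.Properties as ℕ
open import Data.Product using (Σ; ∃; ∃-syntax; _×_; _,_; proj₁; proj₂)
open import Data.Rational as ℚ using (ℚ; 0ℚ; 1ℚ; ½; ∣_∣)
import Data.Rational.Properties as ℚ
open import Data.Rational.Solver using (module +-*-Solver)
import Data.Rational.Unnormalised as ℚᵘ
import Data.Rational.Unnormalised.Properties as ℚᵘ
open import Data.Sum using (_⊎_; inj₁; inj₂)
open import Data.Vec using (Vec; []; _∷_; head; tail; lookup; map)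
open import Data.Vec.Relation.Binary.Pointwise.Inductive using (Pointwise; []; _∷_)
open import Data.Vec.Relation.Unary.All using (All; []; _∷_)
open import Function using (_∘_; _$_)
open import Relation.Binary using (Rel)
open import Relation.Binary.PropositionalEquality
  using (_≡_; refl; sym; trans; cong; cong₂; subst; subst₂; module ≡-Reasoning)
open import Relation.Nullary using (¬_; Dec; yes; no)
open import Relation.Unary using (Pred; _∈_; _⊆_; ∁)

open +-*-Solver using (solve; _:+_; _:*_; _:-_; :-_; _:=_; con)

-- The ratio bound ½ is what keeps the construction effective and uniform: nets and error estimates
-- become powers of 2 that depend on no parameter, so precisions are fixed shifts such as 4 + j. It
-- also forces μ ≥ 2, whence every approximation of μ with error at most 1 is at least 1 and can be
-- inverted without a search. The parameters are known only through rational approximations, and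
-- comparing reals is not computable. Hence whatever a `Code` computes is built from approximations
-- by field operations, absolute values and minima, and margins of a few 2⁻ⁿ take the place of exact
-- comparisons. Excluded middle never chooses a `Code`: it serves the order of the reals and the
-- verification, where it tells which factor of the product a point misses and which image a limit
-- point adheres to. Choosing digits one at a time in this way replaces a compactness argument for
-- closedness. The geometry is done over an abstract archimedean field, because terms over Cauchy
-- sequences unfold into their convergence proofs.

private variable
  arity arity′ : ℕ

-- Computable functions on natural numbers

computable-cong : {f g : Vec ℕ arity → ℕ} → (∀ xs → f xs ≡ g xs) → Computable f → Computable g
computable-cong f≗g (e , e⇓) = e , λ xs → subst (e [ xs ]⇓_) (f≗g xs) (e⇓ xs)

computable-lookup : (i : Fin arity) → Computable (λ xs → lookup xs i)
computable-lookup i = projᶜ i , λ _ → proj⇓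

computable-∘ : {g : Vec ℕ arity′ → ℕ} {fs : Vec (Vec ℕ arity → ℕ) arity′} →
  Computable g → All Computable fs → Computable (λ xs → g (map (_$ xs) fs))
computable-∘ {arity = n} (e , e⇓) cs = compᶜ e (codes cs) , λ xs → comp⇓ (codes⇓ cs xs) (e⇓ _)
  where
  codes : ∀ {m} {fs : Vec (Vec ℕ n → ℕ) m} → All Computable fs → Vec (Code n) m
  codes []             = []
  codes ((e , _) ∷ cs) = e ∷ codes cs
  codes⇓ : ∀ {m} {fs : Vec (Vec ℕ n → ℕ) m} (cs : All Computable fs) xs →
    Pointwise (λ h y → h [ xs ]⇓ y) (codes cs) (map (_$ xs) fs)
  codes⇓ []              xs = []
  codes⇓ ((_ , e⇓) ∷ cs) xs = e⇓ xs ∷ codes⇓ cs xs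

-- The function is prescribed and only its recursion equations are checked, so every function below
-- keeps its natural definition and meets `recᶜ` up to pointwise equality.
computable-rec : {f : Vec ℕ (suc arity) → ℕ} {g : Vec ℕ arity → ℕ} {h : Vec ℕ (suc (suc arity)) → ℕ} →
  Computable g → Computable h →
  (∀ xs → g xs ≡ f (0 ∷ xs)) → (∀ k xs → h (k ∷ f (k ∷ xs) ∷ xs) ≡ f (suc k ∷ xs)) →
  Computable f
computable-rec {f = f} (d , d⇓) (e , e⇓) f₀ f₊ = recᶜ d e , λ { (k ∷ xs) → rec⇓ k xs }
  where
  rec⇓ : ∀ k xs → recᶜ d e [ k ∷ xs ]⇓ f (k ∷ xs)
  rec⇓ zero    xs = subst (_ [ _ ]⇓_) (f₀ xs) (rec⇓₀ (d⇓ xs))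
  rec⇓ (suc k) xs = subst (_ [ _ ]⇓_) (f₊ k xs) (rec⇓₊ (rec⇓ k xs) (e⇓ _))

Computable₁ : (ℕ → ℕ) → Set
Computable₁ f = Computable {1} (f ∘ head)

Computable₂ : (ℕ → ℕ → ℕ) → Set
Computable₂ f = Computable {2} (λ xs → f (head xs) (head (tail xs)))

computable-∘₁ : (f : ℕ → ℕ) {g : Vec ℕ arity → ℕ} →
  Computable₁ f → Computable g → Computable (f ∘ g)
computable-∘₁ f cf cg = computable-∘ cf (cg ∷ [])

computable-∘₂ : (f : ℕ → ℕ → ℕ) {g h : Vec ℕ arity → ℕ} →
  Computable₂ f → Computable g → Computable h → Computable (λ xs → f (g xs) (h xs))
computable-∘₂ f cf cg ch = computable-∘ cf (cg ∷ ch ∷ [])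

pattern #0 = zero
pattern #1 = suc #0
pattern #2 = suc #1
pattern #3 = suc #2
pattern #4 = suc #3

computable-suc : {f : Vec ℕ arity → ℕ} → Computable f → Computable (suc ∘ f)
computable-suc = computable-∘₁ suc (sucᶜ , λ { (_ ∷ []) → suc⇓ })

computable-const : ∀ c → Computable {arity} (λ _ → c)
computable-const zero    = computable-∘ {g = λ _ → 0} {fs = []} (zeroᶜ , λ { [] → zero⇓ }) []
computable-const (suc c) = computable-suc (computable-const c)

computable-head : Computable {suc arity} head
computable-head = computable-cong (λ { (_ ∷ _) → refl }) (computable-lookup #0)

computable-+ : Computable₂ ℕ._+_
computable-+ = computable-rec computable-head (computable-suc (computable-lookup #1))
  (λ _ → refl) (λ _ _ → refl)

computable-* : Computable₂ ℕ._*_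
computable-* = computable-rec (computable-const 0)
  (computable-∘₂ ℕ._+_ computable-+ (computable-lookup #2) (computable-lookup #1))
  (λ _ → refl) (λ { _ (_ ∷ _) → refl })

computable-pred : Computable₁ ℕ.pred
computable-pred = computable-rec (computable-const 0) (computable-lookup #0)
  (λ _ → refl) (λ _ _ → refl)

computable-∸ : Computable₂ ℕ._∸_
computable-∸ = computable-cong (λ { (_ ∷ _ ∷ []) → refl })
  (computable-∘ {fs = (λ xs → lookup xs #1) ∷ (λ xs → lookup xs #0) ∷ []} flipped
    (computable-lookup #1 ∷ computable-lookup #0 ∷ []))
  where
  -- `recᶜ` recurses on the first argument, but the equation m ∸ (k + 1) = pred (m ∸ k) recurses on
  -- the second.
  flipped : Computable₂ (λ k m → m ℕ.∸ k)
  flipped = computable-rec computable-head (computable-∘₁ ℕ.pred computable-pred (computable-lookup #1))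
    (λ _ → refl) (λ { k (m ∷ []) → ℕ.pred[m∸n]≡m∸[1+n] m k })

computable-2^ : Computable₁ (2 ℕ.^_)
computable-2^ = computable-rec (computable-const 1)
  (computable-∘₂ ℕ._*_ computable-* (computable-const 2) (computable-lookup #1))
  (λ _ → refl) (λ _ _ → refl)

toBool : ℕ → Bool
toBool zero    = false
toBool (suc _) = true

-- Primitive recursion whose step discards the previous value is a case distinction on zero.
computable-if : {c f g : Vec ℕ arity → ℕ} → Computable c → Computable f → Computable g →
  Computable (λ xs → if toBool (c xs) then f xs else g xs)
computable-if cc cf cg = computable-∘ if₃ (cc ∷ cf ∷ cg ∷ [])
  where
  if₃ : Computable {3} (λ xs → if toBool (lookup xs #0) then lookup xs #1 else lookup xs #2)
  if₃ = computable-rec (computable-lookup #1) (computable-lookup #2)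
    (λ { (_ ∷ _ ∷ []) → refl }) (λ _ _ → refl)

-- Written as recursions on successors, the shape that `computable-rec` accepts: the half grows
-- exactly when an odd number is passed.
bit half : ℕ → ℕ
bit zero     = 0
bit (suc k)  = 1 ℕ.∸ bit k
half zero    = 0
half (suc k) = half k ℕ.+ bit k

shift : ℕ → ℕ → ℕ
shift zero    k = k
shift (suc i) k = half (shift i k)

computable-bit : Computable₁ bit
computable-bit = computable-rec (computable-const 0)
  (computable-∘₂ ℕ._∸_ computable-∸ (computable-const 1) (computable-lookup #1))
  (λ _ → refl) (λ _ _ → refl)

computable-half : Computable₁ half
computable-half = computable-rec (computable-const 0)
  (computable-∘₂ ℕ._+_ computable-+ (computable-lookup #1)
    (computable-∘₁ bit computable-bit (computable-lookup #0)))
  (λ _ → refl) (λ _ _ → refl)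

computable-shift : Computable₂ shift
computable-shift = computable-rec computable-head
  (computable-∘₁ half computable-half (computable-lookup #1))
  (λ _ → refl) (λ _ _ → refl)

bit-2* : ∀ k → bit (k ℕ.+ k) ≡ 0
bit-2* zero    = refl
bit-2* (suc k) rewrite ℕ.+-suc k k | bit-2* k = refl

half-2* : ∀ k → half (k ℕ.+ k) ≡ k
half-2* zero    = refl
half-2* (suc k) rewrite ℕ.+-suc k k | half-2* k | bit-2* k | ℕ.+-identityʳ k = ℕ.+-comm k 1

double : Bool → ℕ → ℕ
double false k = k ℕ.+ k
double true  k = suc (k ℕ.+ k)

toBool-bit-double : ∀ b k → toBool (bit (double b k)) ≡ b
toBool-bit-double false k rewrite bit-2* k = refl
toBool-bit-double true  k rewrite bit-2* k = refl

half-double : ∀ b k → half (double b k) ≡ k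
half-double false k = half-2* k
half-double true  k rewrite half-2* k | bit-2* k = ℕ.+-identityʳ k

-- A pairing function: ⟨ a , b ⟩ lies between the squares of a + b and a + b + 1.

sqrt : ℕ → ℕ
sqrt zero    = 0
-- The truncated difference is nonzero exactly if (s + 1)² > k + 1, and then the root stays s.
sqrt (suc k) = if toBool (suc (sqrt k) ℕ.* suc (sqrt k) ℕ.∸ suc k) then sqrt k else suc (sqrt k)

computable-sqrt : Computable₁ sqrt
computable-sqrt = computable-rec (computable-const 0)
  (computable-if
    (computable-∘₂ ℕ._∸_ computable-∸ (computable-∘₂ ℕ._*_ computable-* s+1 s+1)
      (computable-suc (computable-lookup #0)))
    (computable-lookup #1) s+1)
  (λ _ → refl) (λ _ _ → refl)
  where s+1 = computable-suc (computable-lookup {2} #1)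

IsSqrt : ℕ → ℕ → Set
IsSqrt k s = s ℕ.* s ℕ.≤ k × k ℕ.< suc s ℕ.* suc s

sqrt-isSqrt : ∀ k → IsSqrt k (sqrt k)
sqrt-isSqrt zero = ℕ.z≤n , ℕ.s≤s ℕ.z≤n
sqrt-isSqrt (suc k) with sqrt-isSqrt k
... | lo , hi with suc (sqrt k) ℕ.* suc (sqrt k) ℕ.∸ suc k in eq
... | zero  = ℕ.m∸n≡0⇒m≤n eq
            , ℕ.≤-<-trans hi (ℕ.*-mono-< (ℕ.n<1+n (suc (sqrt k))) (ℕ.n<1+n (suc (sqrt k))))
... | suc _ = ℕ.m≤n⇒m≤1+n lo , ℕ.m∸n≢0⇒n<m (λ e → ℕ.1+n≢0 (trans (sym eq) e))

isSqrt-≤ : ∀ {k s t} → IsSqrt k s → IsSqrt k t → s ℕ.≤ t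
isSqrt-≤ {s = s} {t} (lo , _) (_ , hi) = ℕ.≮⇒≥ λ t<s →
  ℕ.<⇒≱ (ℕ.≤-<-trans lo hi) (ℕ.*-mono-≤ t<s t<s)

abstract
  -- Kept abstract: from here on pairs are handled through the projection laws alone, and square
  -- roots never unfold.
  ⟨_,_⟩ : ℕ → ℕ → ℕ
  ⟨ a , b ⟩ = (a ℕ.+ b) ℕ.* (a ℕ.+ b) ℕ.+ a

  π₁ π₂ : ℕ → ℕ
  π₁ k = k ℕ.∸ sqrt k ℕ.* sqrt k
  π₂ k = sqrt k ℕ.∸ π₁ k

  computable-⟨,⟩ : Computable₂ ⟨_,_⟩
  computable-⟨,⟩ = computable-∘₂ ℕ._+_ computable-+ (computable-∘₂ ℕ._*_ computable-* a+b a+b) computable-head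
    where
    a+b : Computable₂ ℕ._+_
    a+b = computable-+

  computable-π₁ : {f : Vec ℕ arity → ℕ} → Computable f → Computable (π₁ ∘ f)
  computable-π₁ {f = f} cf = computable-∘₂ ℕ._∸_ computable-∸ cf (computable-∘₂ ℕ._*_ computable-* s s)
    where
    s : Computable (sqrt ∘ f)
    s = computable-∘₁ sqrt computable-sqrt cf

  computable-π₂ : {f : Vec ℕ arity → ℕ} → Computable f → Computable (π₂ ∘ f)
  computable-π₂ cf = computable-∘₂ ℕ._∸_ computable-∸ (computable-∘₁ sqrt computable-sqrt cf) (computable-π₁ cf)

  sqrt-⟨,⟩ : ∀ a b → sqrt ⟨ a , b ⟩ ≡ a ℕ.+ b
  sqrt-⟨,⟩ a b = ℕ.≤-antisym (isSqrt-≤ (sqrt-isSqrt _) spec) (isSqrt-≤ spec (sqrt-isSqrt _))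
    where
    s : ℕ
    s = a ℕ.+ b
    spec : IsSqrt ⟨ a , b ⟩ s
    spec = ℕ.m≤m+n (s ℕ.* s) a
         , ℕ.s≤s (ℕ.≤-trans (ℕ.≤-reflexive (ℕ.+-comm (s ℕ.* s) a))
             (ℕ.+-mono-≤ (ℕ.m≤m+n a b)
               (ℕ.≤-trans (ℕ.m≤n+m (s ℕ.* s) s) (ℕ.≤-reflexive (sym (ℕ.*-suc s s))))))

  π₁-⟨,⟩ : ∀ a b → π₁ ⟨ a , b ⟩ ≡ a
  π₁-⟨,⟩ a b rewrite sqrt-⟨,⟩ a b = ℕ.m+n∸m≡n ((a ℕ.+ b) ℕ.* (a ℕ.+ b)) a

  π₂-⟨,⟩ : ∀ a b → π₂ ⟨ a , b ⟩ ≡ b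
  π₂-⟨,⟩ a b rewrite π₁-⟨,⟩ a b | sqrt-⟨,⟩ a b = ℕ.m+n∸m≡n a b

-- Computable functions with rational values

abstract
  ι : ℤ → ℚ
  ι z = z ℚ./ 1

  private
    -- Rationals in lowest terms are compared through unnormalised fractions, whose equality is
    -- cross multiplication; this reduces the laws of `ι` to identities of integers.
    ι-unique : ∀ z {p : ℚ} → ℚ.toℚᵘ p ℚᵘ.≃ ℚᵘ.mkℚᵘ z 0 → p ≡ ι z
    ι-unique z h = ℚ.toℚᵘ-injective (ℚᵘ.≃-trans h (ℚᵘ.≃-sym (ℚ.toℚᵘ-fromℚᵘ (ℚᵘ.mkℚᵘ z 0))))

    toℚᵘ-ι : ∀ z → ℚ.toℚᵘ (ι z) ℚᵘ.≃ ℚᵘ.mkℚᵘ z 0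
    toℚᵘ-ι z = ℚ.toℚᵘ-fromℚᵘ (ℚᵘ.mkℚᵘ z 0)

  ι-+ : ∀ y z → ι y ℚ.+ ι z ≡ ι (y ℤ.+ z)
  ι-+ y z = ι-unique (y ℤ.+ z) (ℚᵘ.≃-trans (ℚ.toℚᵘ-homo-+ (ι y) (ι z))
    (ℚᵘ.≃-trans (ℚᵘ.+-cong (toℚᵘ-ι y) (toℚᵘ-ι z))
      (ℚᵘ.*≡* (cong (ℤ._* + 1) (cong₂ ℤ._+_ (ℤ.*-identityʳ y) (ℤ.*-identityʳ z))))))

  ι-* : ∀ y z → ι y ℚ.* ι z ≡ ι (y ℤ.* z)
  ι-* y z = ι-unique (y ℤ.* z) (ℚᵘ.≃-trans (ℚ.toℚᵘ-homo-* (ι y) (ι z))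
    (ℚᵘ.≃-trans (ℚᵘ.*-cong (toℚᵘ-ι y) (toℚᵘ-ι z)) (ℚᵘ.*≡* refl)))

  ι-neg : ∀ z → ℚ.- ι z ≡ ι (ℤ.- z)
  ι-neg z = ι-unique (ℤ.- z) (ℚᵘ.≃-trans (ℚ.toℚᵘ-homo‿- (ι z))
    (ℚᵘ.≃-trans (ℚᵘ.-‿cong (toℚᵘ-ι z)) (ℚᵘ.*≡* refl)))

  ι-0 : ι (+ 0) ≡ 0ℚ
  ι-0 = refl

  ι-1 : ι (+ 1) ≡ 1ℚ
  ι-1 = refl

  ι-positive : ∀ w → ℚ.Positive (ι (+ suc w))
  ι-positive w = ℚ.normalize-pos (suc w) 1

  ι-nonNegative : ∀ k → 0ℚ ℚ.≤ ι (+ k)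
  ι-nonNegative k = ℚ.nonNegative⁻¹ (ι (+ k)) {{ℚ.normalize-nonNeg k 1}}

  /-*-ι : ∀ z w → (z ℚ./ suc w) ℚ.* ι (+ suc w) ≡ ι z
  /-*-ι z w = ι-unique z (ℚᵘ.≃-trans (ℚ.toℚᵘ-homo-* (z ℚ./ suc w) (ι (+ suc w)))
    (ℚᵘ.≃-trans (ℚᵘ.*-cong (ℚ.toℚᵘ-fromℚᵘ (ℚᵘ.mkℚᵘ z w)) (toℚᵘ-ι (+ suc w)))
      (ℚᵘ.*≡* (trans (ℤ.*-identityʳ _) (cong (z ℤ.*_) (cong (+_) (cong suc (sym (ℕ.*-identityʳ w)))))))))

ιⁿ : ℕ → ℚ
ιⁿ k = ι (+ k)

ιⁿ-+ : ∀ j k → ιⁿ (j ℕ.+ k) ≡ ιⁿ j ℚ.+ ιⁿ k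
ιⁿ-+ j k = sym (ι-+ (+ j) (+ k))

ιⁿ-* : ∀ j k → ιⁿ (j ℕ.* k) ≡ ιⁿ j ℚ.* ιⁿ k
ιⁿ-* j k = trans (cong ι (ℤ.pos-* j k)) (sym (ι-* (+ j) (+ k)))

ι-⊖ : ∀ j k → ι (j ℤ.⊖ k) ≡ ιⁿ j ℚ.- ιⁿ k
ι-⊖ j k = trans (cong ι (sym (ℤ.m-n≡m⊖n j k)))
  (trans (sym (ι-+ (+ j) (ℤ.- (+ k)))) (cong (ιⁿ j ℚ.+_) (sym (ι-neg (+ k)))))

ιⁿ-identity : ∀ k → ιⁿ k ≡ ιⁿ k ℚ.- ιⁿ 0
ιⁿ-identity k = sym (trans (cong (λ z → ιⁿ k ℚ.- z) ι-0) (ℚ.+-identityʳ (ιⁿ k)))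

*-cancelʳ-pos : ∀ {p q} r .{{_ : ℚ.Positive r}} → p ℚ.* r ≡ q ℚ.* r → p ≡ q
*-cancelʳ-pos r e = ℚ.≤-antisym
  (ℚ.*-cancelʳ-≤-pos r (ℚ.≤-reflexive e)) (ℚ.*-cancelʳ-≤-pos r (ℚ.≤-reflexive (sym e)))

-- q = (u - v) / (w + 1)
IsFraction : ℚ → ℕ → ℕ → ℕ → Set
IsFraction q u v w = q ℚ.* ιⁿ (suc w) ≡ ιⁿ u ℚ.- ιⁿ v

fraction-≡ : ∀ {q u v w} → IsFraction q u v w → q ≡ (u ℤ.⊖ v) ℚ./ suc w
fraction-≡ {u = u} {v} {w} e = *-cancelʳ-pos (ιⁿ (suc w)) {{ι-positive w}}
  (trans e (trans (sym (ι-⊖ u v)) (sym (/-*-ι (u ℤ.⊖ v) w))))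

fraction-/ : ∀ {q} z u v w → z ≡ u ℤ.⊖ v → q ≡ z ℚ./ suc w → IsFraction q u v w
fraction-/ _ u v w refl refl = trans (/-*-ι (u ℤ.⊖ v) w) (ι-⊖ u v)

abstract
  -- Total on the natural numbers, so that enumerating codes enumerates the rationals without a
  -- validity test.
  decode : ℕ → ℚ
  decode e = (π₁ e ℤ.⊖ π₁ (π₂ e)) ℚ./ suc (π₂ (π₂ e))

  decode-isFraction : ∀ e → IsFraction (decode e) (π₁ e) (π₁ (π₂ e)) (π₂ (π₂ e))
  decode-isFraction e = fraction-/ _ (π₁ e) (π₁ (π₂ e)) (π₂ (π₂ e)) refl refl

decode-fraction : ∀ {q u v w} → IsFraction q u v w → decode ⟨ u , ⟨ v , w ⟩ ⟩ ≡ q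
decode-fraction {q} {u} {v} {w} e = trans (fraction-≡ d) (sym (fraction-≡ e))
  where
  d : IsFraction (decode ⟨ u , ⟨ v , w ⟩ ⟩) u v w
  d with decode-isFraction ⟨ u , ⟨ v , w ⟩ ⟩
  ... | h rewrite π₁-⟨,⟩ u ⟨ v , w ⟩ | π₂-⟨,⟩ u ⟨ v , w ⟩ | π₁-⟨,⟩ v w | π₂-⟨,⟩ v w = h

-- Supplies codes for fixed rationals and for the witnesses of the covering; no `Code` ever has to
-- compute it.
encode : ℚ → ℕ
encode q@(ℚ.mkℚ (+ u)    w _) = ⟨ u , ⟨ 0 , w ⟩ ⟩
encode q@(ℚ.mkℚ -[1+ v ] w _) = ⟨ 0 , ⟨ suc v , w ⟩ ⟩

decode-encode : ∀ q → decode (encode q) ≡ q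
decode-encode q@(ℚ.mkℚ (+ u) w _) = decode-fraction {q}
  (fraction-/ (+ u) u 0 w refl (sym (ℚ.↥p/↧p≡p q)))
decode-encode q@(ℚ.mkℚ -[1+ v ] w _) = decode-fraction {q}
  (fraction-/ -[1+ v ] 0 (suc v) w refl (sym (ℚ.↥p/↧p≡p q)))

-- Compared with the sign exponent of `Computableℚ`, a numerator split as a difference makes sums
-- and products polynomial in the components, with no case distinction on signs.
record Fractional {n} (q : Vec ℕ n → ℚ) : Set where
  field
    plus minus denom : Vec ℕ n → ℕ
    plus-computable  : Computable plus
    minus-computable : Computable minus
    denom-computable : Computable denom
    isFraction : ∀ xs → IsFraction (q xs) (plus xs) (minus xs) (denom xs)
open Fractional

_+ᶜ_ : {f g : Vec ℕ arity → ℕ} → Computable f → Computable g → Computable (λ xs → f xs ℕ.+ g xs)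
_+ᶜ_ = computable-∘₂ ℕ._+_ computable-+

_*ᶜ_ : {f g : Vec ℕ arity → ℕ} → Computable f → Computable g → Computable (λ xs → f xs ℕ.* g xs)
_*ᶜ_ = computable-∘₂ ℕ._*_ computable-*

_∸ᶜ_ : {f g : Vec ℕ arity → ℕ} → Computable f → Computable g → Computable (λ xs → f xs ℕ.∸ g xs)
_∸ᶜ_ = computable-∘₂ ℕ._∸_ computable-∸

infixl 6 _+ᶜ_ _∸ᶜ_ _+ᶠ_ _-ᶠ_
infixl 7 _*ᶜ_ _*ᶠ_

fractional-cong : {p q : Vec ℕ arity → ℚ} → (∀ xs → p xs ≡ q xs) → Fractional p → Fractional q
fractional-cong p≗q F = record
  { plus = plus F ; minus = minus F ; denom = denom F
  ; plus-computable = plus-computable F ; minus-computable = minus-computable F ; denom-computable = denom-computable F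
  ; isFraction = λ xs → subst (λ r → IsFraction r (plus F xs) (minus F xs) (denom F xs)) (p≗q xs) (isFraction F xs) }

fractional-∘ : {q : Vec ℕ arity′ → ℚ} {fs : Vec (Vec ℕ arity → ℕ) arity′} →
  Fractional q → All Computable fs → Fractional (λ xs → q (map (_$ xs) fs))
fractional-∘ {fs = fs} F cs = record
  { plus = λ xs → plus F (map (_$ xs) fs) ; minus = λ xs → minus F (map (_$ xs) fs) ; denom = λ xs → denom F (map (_$ xs) fs)
  ; plus-computable = computable-∘ {g = plus F} (plus-computable F) cs
  ; minus-computable = computable-∘ {g = minus F} (minus-computable F) cs
  ; denom-computable = computable-∘ {g = denom F} (denom-computable F) cs
  ; isFraction = λ xs → isFraction F (map (_$ xs) fs) }

fractional-decode : {f : Vec ℕ arity → ℕ} → Computable f → Fractional (decode ∘ f)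
fractional-decode {f = f} cf = record
  { plus = π₁ ∘ f ; minus = π₁ ∘ π₂ ∘ f ; denom = π₂ ∘ π₂ ∘ f
  ; plus-computable = computable-π₁ cf
  ; minus-computable = computable-π₁ (computable-π₂ cf)
  ; denom-computable = computable-π₂ (computable-π₂ cf)
  ; isFraction = decode-isFraction ∘ f }

fractional-const : ∀ q → Fractional {arity} (λ _ → q)
fractional-const q = fractional-cong (λ _ → decode-encode q)
  (fractional-decode (computable-const (encode q)))

_+ᶠ_ : {p q : Vec ℕ arity → ℚ} → Fractional p → Fractional q → Fractional (λ xs → p xs ℚ.+ q xs)
_+ᶠ_ {p = p} {q} F G = record
  { plus = λ xs → plus F xs ℕ.* suc (denom G xs) ℕ.+ plus G xs ℕ.* suc (denom F xs)
  ; minus = λ xs → minus F xs ℕ.* suc (denom G xs) ℕ.+ minus G xs ℕ.* suc (denom F xs)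
  ; denom = λ xs → denom G xs ℕ.+ denom F xs ℕ.* suc (denom G xs)
  ; plus-computable = plus-computable F *ᶜ computable-suc (denom-computable G)
                +ᶜ plus-computable G *ᶜ computable-suc (denom-computable F)
  ; minus-computable = minus-computable F *ᶜ computable-suc (denom-computable G)
                +ᶜ minus-computable G *ᶜ computable-suc (denom-computable F)
  ; denom-computable = denom-computable G +ᶜ denom-computable F *ᶜ computable-suc (denom-computable G)
  ; isFraction = λ xs → fraction-+ (p xs) (q xs) (plus F xs) (minus F xs) (denom F xs) (plus G xs) (minus G xs) (denom G xs)
                          (isFraction F xs) (isFraction G xs) }
  where
  fraction-+ : ∀ p q u v w u' v' w' → IsFraction p u v w → IsFraction q u' v' w' →
    IsFraction (p ℚ.+ q) (u ℕ.* suc w' ℕ.+ u' ℕ.* suc w) (v ℕ.* suc w' ℕ.+ v' ℕ.* suc w) (w' ℕ.+ w ℕ.* suc w')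
  fraction-+ p q u v w u' v' w' e e'
    rewrite ιⁿ-* (suc w) (suc w') | ιⁿ-+ (u ℕ.* suc w') (u' ℕ.* suc w)
          | ιⁿ-+ (v ℕ.* suc w') (v' ℕ.* suc w) | ιⁿ-* u (suc w') | ιⁿ-* u' (suc w)
          | ιⁿ-* v (suc w') | ιⁿ-* v' (suc w) = begin
    (p ℚ.+ q) ℚ.* (s ℚ.* t)
      ≡⟨ solve 4 (λ p q s t → (p :+ q) :* (s :* t) := (p :* s) :* t :+ (q :* t) :* s) refl p q s t ⟩
    (p ℚ.* s) ℚ.* t ℚ.+ (q ℚ.* t) ℚ.* s
      ≡⟨ cong₂ (λ a b → a ℚ.* t ℚ.+ b ℚ.* s) e e' ⟩
    (ιⁿ u ℚ.- ιⁿ v) ℚ.* t ℚ.+ (ιⁿ u' ℚ.- ιⁿ v') ℚ.* s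
      ≡⟨ solve 6 (λ s t u v u' v' → (u :- v) :* t :+ (u' :- v') :* s := (u :* t :+ u' :* s) :- (v :* t :+ v' :* s))
           refl s t (ιⁿ u) (ιⁿ v) (ιⁿ u') (ιⁿ v') ⟩
    (ιⁿ u ℚ.* t ℚ.+ ιⁿ u' ℚ.* s) ℚ.- (ιⁿ v ℚ.* t ℚ.+ ιⁿ v' ℚ.* s) ∎
    where
    open ≡-Reasoning
    s = ιⁿ (suc w)
    t = ιⁿ (suc w')

_*ᶠ_ : {p q : Vec ℕ arity → ℚ} → Fractional p → Fractional q → Fractional (λ xs → p xs ℚ.* q xs)
_*ᶠ_ {p = p} {q} F G = record
  { plus = λ xs → plus F xs ℕ.* plus G xs ℕ.+ minus F xs ℕ.* minus G xs
  ; minus = λ xs → plus F xs ℕ.* minus G xs ℕ.+ minus F xs ℕ.* plus G xs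
  ; denom = λ xs → denom G xs ℕ.+ denom F xs ℕ.* suc (denom G xs)
  ; plus-computable = plus-computable F *ᶜ plus-computable G +ᶜ minus-computable F *ᶜ minus-computable G
  ; minus-computable = plus-computable F *ᶜ minus-computable G +ᶜ minus-computable F *ᶜ plus-computable G
  ; denom-computable = denom-computable G +ᶜ denom-computable F *ᶜ computable-suc (denom-computable G)
  ; isFraction = λ xs → fraction-* (p xs) (q xs) (plus F xs) (minus F xs) (denom F xs) (plus G xs) (minus G xs) (denom G xs)
                          (isFraction F xs) (isFraction G xs) }
  where
  fraction-* : ∀ p q u v w u' v' w' → IsFraction p u v w → IsFraction q u' v' w' →
    IsFraction (p ℚ.* q) (u ℕ.* u' ℕ.+ v ℕ.* v') (u ℕ.* v' ℕ.+ v ℕ.* u') (w' ℕ.+ w ℕ.* suc w')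
  fraction-* p q u v w u' v' w' e e'
    rewrite ιⁿ-* (suc w) (suc w') | ιⁿ-+ (u ℕ.* u') (v ℕ.* v') | ιⁿ-+ (u ℕ.* v') (v ℕ.* u')
          | ιⁿ-* u u' | ιⁿ-* v v' | ιⁿ-* u v' | ιⁿ-* v u' = begin
    (p ℚ.* q) ℚ.* (s ℚ.* t)
      ≡⟨ solve 4 (λ p q s t → (p :* q) :* (s :* t) := (p :* s) :* (q :* t)) refl p q s t ⟩
    (p ℚ.* s) ℚ.* (q ℚ.* t)
      ≡⟨ cong₂ ℚ._*_ e e' ⟩
    (ιⁿ u ℚ.- ιⁿ v) ℚ.* (ιⁿ u' ℚ.- ιⁿ v')
      ≡⟨ solve 4 (λ u v u' v' → (u :- v) :* (u' :- v') := (u :* u' :+ v :* v') :- (u :* v' :+ v :* u'))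
           refl (ιⁿ u) (ιⁿ v) (ιⁿ u') (ιⁿ v') ⟩
    (ιⁿ u ℚ.* ιⁿ u' ℚ.+ ιⁿ v ℚ.* ιⁿ v') ℚ.- (ιⁿ u ℚ.* ιⁿ v' ℚ.+ ιⁿ v ℚ.* ιⁿ u') ∎
    where
    open ≡-Reasoning
    s = ιⁿ (suc w)
    t = ιⁿ (suc w')

-ᶠ_ : {q : Vec ℕ arity → ℚ} → Fractional q → Fractional (λ xs → ℚ.- q xs)
-ᶠ_ {q = q} F = record
  { plus = minus F ; minus = plus F ; denom = denom F
  ; plus-computable = minus-computable F ; minus-computable = plus-computable F ; denom-computable = denom-computable F
  ; isFraction = λ xs → begin
      ℚ.- q xs ℚ.* ιⁿ (suc (denom F xs))   ≡⟨ ℚ.neg-distribˡ-* (q xs) _ ⟨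
      ℚ.- (q xs ℚ.* ιⁿ (suc (denom F xs))) ≡⟨ cong ℚ.-_ (isFraction F xs) ⟩
      ℚ.- (ιⁿ (plus F xs) ℚ.- ιⁿ (minus F xs)) ≡⟨ solve 2 (λ a b → :- (a :- b) := b :- a) refl (ιⁿ (plus F xs)) (ιⁿ (minus F xs)) ⟩
      ιⁿ (minus F xs) ℚ.- ιⁿ (plus F xs) ∎ }
  where open ≡-Reasoning

_-ᶠ_ : {p q : Vec ℕ arity → ℚ} → Fractional p → Fractional q → Fractional (λ xs → p xs ℚ.- q xs)
F -ᶠ G = F +ᶠ (-ᶠ G)

-- At least one of the two truncated differences vanishes, and the other is the absolute value.
ι-∣⊖∣ : ∀ u v → ∣ ιⁿ u ℚ.- ιⁿ v ∣ ≡ ιⁿ (u ℕ.∸ v ℕ.+ (v ℕ.∸ u))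
ι-∣⊖∣ u v with ℕ.≤-total u v
... | inj₁ u≤v = begin
  ∣ ιⁿ u ℚ.- ιⁿ v ∣          ≡⟨ cong ∣_∣ (ι-⊖ u v) ⟨
  ∣ ι (u ℤ.⊖ v) ∣            ≡⟨ cong (∣_∣ ∘ ι) (ℤ.⊖-≤ u≤v) ⟩
  ∣ ι (ℤ.- + (v ℕ.∸ u)) ∣    ≡⟨ cong ∣_∣ (ι-neg (+ (v ℕ.∸ u))) ⟨
  ∣ ℚ.- ιⁿ (v ℕ.∸ u) ∣       ≡⟨ ℚ.∣-p∣≡∣p∣ (ιⁿ (v ℕ.∸ u)) ⟩
  ∣ ιⁿ (v ℕ.∸ u) ∣           ≡⟨ ℚ.0≤p⇒∣p∣≡p (ι-nonNegative (v ℕ.∸ u)) ⟩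
  ιⁿ (v ℕ.∸ u)               ≡⟨ cong (λ k → ιⁿ (k ℕ.+ (v ℕ.∸ u))) (ℕ.m≤n⇒m∸n≡0 u≤v) ⟨
  ιⁿ (u ℕ.∸ v ℕ.+ (v ℕ.∸ u)) ∎
  where open ≡-Reasoning
... | inj₂ v≤u = begin
  ∣ ιⁿ u ℚ.- ιⁿ v ∣          ≡⟨ cong ∣_∣ (ι-⊖ u v) ⟨
  ∣ ι (u ℤ.⊖ v) ∣            ≡⟨ cong (∣_∣ ∘ ι) (ℤ.⊖-≥ v≤u) ⟩
  ∣ ιⁿ (u ℕ.∸ v) ∣           ≡⟨ ℚ.0≤p⇒∣p∣≡p (ι-nonNegative (u ℕ.∸ v)) ⟩
  ιⁿ (u ℕ.∸ v)               ≡⟨ cong ιⁿ (trans (cong (u ℕ.∸ v ℕ.+_) (ℕ.m≤n⇒m∸n≡0 v≤u)) (ℕ.+-identityʳ _)) ⟨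
  ιⁿ (u ℕ.∸ v ℕ.+ (v ℕ.∸ u)) ∎
  where open ≡-Reasoning

∣_∣ᶠ : {q : Vec ℕ arity → ℚ} → Fractional q → Fractional (λ xs → ∣ q xs ∣)
∣_∣ᶠ {q = q} F = record
  { plus = λ xs → plus F xs ℕ.∸ minus F xs ℕ.+ (minus F xs ℕ.∸ plus F xs) ; minus = λ _ → 0 ; denom = denom F
  ; plus-computable = plus-computable F ∸ᶜ minus-computable F +ᶜ (minus-computable F ∸ᶜ plus-computable F)
  ; minus-computable = computable-const 0
  ; denom-computable = denom-computable F
  ; isFraction = λ xs → let s = ιⁿ (suc (denom F xs)) in begin
      ∣ q xs ∣ ℚ.* s       ≡⟨ cong (∣ q xs ∣ ℚ.*_) (ℚ.0≤p⇒∣p∣≡p (ι-nonNegative (suc (denom F xs)))) ⟨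
      ∣ q xs ∣ ℚ.* ∣ s ∣   ≡⟨ ℚ.∣p*q∣≡∣p∣*∣q∣ (q xs) s ⟨
      ∣ q xs ℚ.* s ∣       ≡⟨ cong ∣_∣ (isFraction F xs) ⟩
      ∣ ιⁿ (plus F xs) ℚ.- ιⁿ (minus F xs) ∣ ≡⟨ ι-∣⊖∣ (plus F xs) (minus F xs) ⟩
      ιⁿ (plus F xs ℕ.∸ minus F xs ℕ.+ (minus F xs ℕ.∸ plus F xs)) ≡⟨ ιⁿ-identity _ ⟩
      ιⁿ (plus F xs ℕ.∸ minus F xs ℕ.+ (minus F xs ℕ.∸ plus F xs)) ℚ.- ιⁿ 0 ∎ }
  where open ≡-Reasoning

p≤q⇒∣p-q∣≡q-p : ∀ {p q} → p ℚ.≤ q → ∣ p ℚ.- q ∣ ≡ q ℚ.- p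
p≤q⇒∣p-q∣≡q-p {p} {q} p≤q = begin
  ∣ p ℚ.- q ∣         ≡⟨ ℚ.∣-p∣≡∣p∣ (p ℚ.- q) ⟨
  ∣ ℚ.- (p ℚ.- q) ∣   ≡⟨ cong ∣_∣ (solve 2 (λ p q → :- (p :- q) := q :- p) refl p q) ⟩
  ∣ q ℚ.- p ∣         ≡⟨ ℚ.0≤p⇒∣p∣≡p (subst (ℚ._≤ q ℚ.- p) (ℚ.+-inverseʳ p) (ℚ.+-monoˡ-≤ (ℚ.- p) p≤q)) ⟩
  q ℚ.- p ∎
  where open ≡-Reasoning

*½+*½ : ∀ p → p ℚ.* ½ ℚ.+ p ℚ.* ½ ≡ p
*½+*½ p = trans (sym (ℚ.*-distribˡ-+ p ½ ½)) (ℚ.*-identityʳ p)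

-- Reduces the minimum to operations already available on `Fractional`, so that no order test on
-- fractions has to be programmed.
⊓-∣-∣ : ∀ p q → (p ℚ.+ q ℚ.- ∣ p ℚ.- q ∣) ℚ.* ½ ≡ p ℚ.⊓ q
⊓-∣-∣ p q with ℚ.≤-total p q
... | inj₁ p≤q = begin
  (p ℚ.+ q ℚ.- ∣ p ℚ.- q ∣) ℚ.* ½ ≡⟨ cong (λ r → (p ℚ.+ q ℚ.- r) ℚ.* ½) (p≤q⇒∣p-q∣≡q-p p≤q) ⟩
  (p ℚ.+ q ℚ.- (q ℚ.- p)) ℚ.* ½   ≡⟨ solve 3 (λ p q h → (p :+ q :- (q :- p)) :* h := p :* h :+ p :* h) refl p q ½ ⟩
  p ℚ.* ½ ℚ.+ p ℚ.* ½             ≡⟨ *½+*½ p ⟩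
  p                               ≡⟨ ℚ.p≤q⇒p⊓q≡p p≤q ⟨
  p ℚ.⊓ q ∎
  where open ≡-Reasoning
... | inj₂ q≤p = begin
  (p ℚ.+ q ℚ.- ∣ p ℚ.- q ∣) ℚ.* ½ ≡⟨ cong (λ r → (p ℚ.+ q ℚ.- r) ℚ.* ½) (ℚ.0≤p⇒∣p∣≡p (subst (ℚ._≤ p ℚ.- q) (ℚ.+-inverseʳ q) (ℚ.+-monoˡ-≤ (ℚ.- q) q≤p))) ⟩
  (p ℚ.+ q ℚ.- (p ℚ.- q)) ℚ.* ½   ≡⟨ solve 3 (λ p q h → (p :+ q :- (p :- q)) :* h := q :* h :+ q :* h) refl p q ½ ⟩
  q ℚ.* ½ ℚ.+ q ℚ.* ½             ≡⟨ *½+*½ q ⟩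
  q                               ≡⟨ ℚ.p≥q⇒p⊓q≡q q≤p ⟨
  p ℚ.⊓ q ∎
  where open ≡-Reasoning

⊔-⊓ : ∀ p q → ℚ.- (ℚ.- p ℚ.⊓ ℚ.- q) ≡ p ℚ.⊔ q
⊔-⊓ p q = trans (cong ℚ.-_ (sym (ℚ.antimono-≤-distrib-⊔ ℚ.neg-antimono-≤ p q)))
  (solve 1 (λ p → :- (:- p) := p) refl (p ℚ.⊔ q))

_⊓ᶠ_ : {p q : Vec ℕ arity → ℚ} → Fractional p → Fractional q → Fractional (λ xs → p xs ℚ.⊓ q xs)
_⊓ᶠ_ {p = p} {q} F G = fractional-cong (λ xs → ⊓-∣-∣ (p xs) (q xs))
  ((F +ᶠ G -ᶠ ∣ F -ᶠ G ∣ᶠ) *ᶠ fractional-const ½)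

_⊔ᶠ_ : {p q : Vec ℕ arity → ℚ} → Fractional p → Fractional q → Fractional (λ xs → p xs ℚ.⊔ q xs)
_⊔ᶠ_ {p = p} {q} F G = fractional-cong (λ xs → ⊔-⊓ (p xs) (q xs)) (-ᶠ ((-ᶠ F) ⊓ᶠ (-ᶠ G)))

fractional-inverse : {p q : Vec ℕ arity → ℚ} → (∀ xs → p xs ℚ.* q xs ≡ 1ℚ) → (∀ xs → 0ℚ ℚ.< q xs) →
  Fractional q → Fractional p
fractional-inverse {p = p} {q} pq≡1 0<q F = record
  -- The inverse of (u - v) / (w + 1) is (w + 1) / (u - v); denominators are stored less one, hence
  -- `pred`.
  { plus = suc ∘ denom F ; minus = λ _ → 0 ; denom = λ xs → ℕ.pred (plus F xs ℕ.∸ minus F xs)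
  ; plus-computable = computable-suc (denom-computable F)
  ; minus-computable = computable-const 0
  ; denom-computable = computable-∘₁ ℕ.pred computable-pred (plus-computable F ∸ᶜ minus-computable F)
  ; isFraction = λ xs → fraction-inverse (p xs) (q xs) (plus F xs) (minus F xs) (denom F xs)
                          (pq≡1 xs) (0<q xs) (isFraction F xs) }
  where
  fraction-inverse : ∀ p q u v w → p ℚ.* q ≡ 1ℚ → 0ℚ ℚ.< q → IsFraction q u v w →
    IsFraction p (suc w) 0 (ℕ.pred (u ℕ.∸ v))
  fraction-inverse p q u v w pq≡1 0<q e with ℕ.≤-<-connex u v
  ... | inj₁ u≤v = ⊥-elim (ℚ.<-irrefl refl (ℚ.<-≤-trans 0<q (ℚ.*-cancelʳ-≤-pos (ιⁿ (suc w)) {{ι-positive w}} (begin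
      q ℚ.* ιⁿ (suc w)       ≡⟨ e ⟩
      ιⁿ u ℚ.- ιⁿ v          ≡⟨ ι-⊖ u v ⟨
      ι (u ℤ.⊖ v)            ≡⟨ cong ι (ℤ.⊖-≤ u≤v) ⟩
      ι (ℤ.- + (v ℕ.∸ u))    ≡⟨ ι-neg (+ (v ℕ.∸ u)) ⟨
      ℚ.- ιⁿ (v ℕ.∸ u)       ≤⟨ ℚ.neg-antimono-≤ (ι-nonNegative (v ℕ.∸ u)) ⟩
      0ℚ                     ≡⟨ ℚ.*-zeroˡ (ιⁿ (suc w)) ⟨
      0ℚ ℚ.* ιⁿ (suc w)      ∎))))
    where open ℚ.≤-Reasoning
  ... | inj₂ v<u = begin
    p ℚ.* ιⁿ (suc (ℕ.pred (u ℕ.∸ v))) ≡⟨ cong (λ k → p ℚ.* ιⁿ k) (ℕ.suc-pred (u ℕ.∸ v) {{ℕ.>-nonZero (ℕ.m<n⇒0<n∸m v<u)}}) ⟩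
    p ℚ.* ιⁿ (u ℕ.∸ v)                ≡⟨ cong (λ z → p ℚ.* ι z) (ℤ.⊖-≥ (ℕ.<⇒≤ v<u)) ⟨
    p ℚ.* ι (u ℤ.⊖ v)                 ≡⟨ cong (p ℚ.*_) (trans (ι-⊖ u v) (sym e)) ⟩
    p ℚ.* (q ℚ.* ιⁿ (suc w))          ≡⟨ ℚ.*-assoc p q _ ⟨
    (p ℚ.* q) ℚ.* ιⁿ (suc w)          ≡⟨ cong (ℚ._* ιⁿ (suc w)) pq≡1 ⟩
    1ℚ ℚ.* ιⁿ (suc w)                 ≡⟨ ℚ.*-identityˡ _ ⟩
    ιⁿ (suc w)                        ≡⟨ ιⁿ-identity _ ⟩
    ιⁿ (suc w) ℚ.- ιⁿ 0 ∎
    where open ≡-Reasoning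

fractional-if : {c : Vec ℕ arity → ℕ} {p q : Vec ℕ arity → ℚ} → Computable c → Fractional p → Fractional q →
  Fractional (λ xs → if toBool (c xs) then p xs else q xs)
fractional-if {c = c} {p} {q} cc F G = record
  { plus = λ xs → if toBool (c xs) then plus F xs else plus G xs
  ; minus = λ xs → if toBool (c xs) then minus F xs else minus G xs
  ; denom = λ xs → if toBool (c xs) then denom F xs else denom G xs
  ; plus-computable = computable-if cc (plus-computable F) (plus-computable G)
  ; minus-computable = computable-if cc (minus-computable F) (minus-computable G)
  ; denom-computable = computable-if cc (denom-computable F) (denom-computable G)
  ; isFraction = λ xs → fraction-if (toBool (c xs)) xs }
  where
  fraction-if : ∀ b xs → IsFraction (if b then p xs else q xs)
    (if b then plus F xs else plus G xs) (if b then minus F xs else minus G xs) (if b then denom F xs else denom G xs)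
  fraction-if true  = isFraction F
  fraction-if false = isFraction G

-- Primitive recursion on codes: the components of the values cannot be
-- computed separately.
fractional-rec : {q : Vec ℕ (suc arity) → ℚ} {g : Vec ℕ arity → ℚ} {h : ℕ → ℚ → Vec ℕ arity → ℚ} →
  Fractional g → Fractional {suc (suc arity)} (λ xs → h (head xs) (decode (head (tail xs))) (tail (tail xs))) →
  (∀ xs → g xs ≡ q (0 ∷ xs)) → (∀ k xs → h k (q (k ∷ xs)) xs ≡ q (suc k ∷ xs)) →
  Fractional q
fractional-rec {arity = n} {q} {g} {h} G H q₀ q₊ =
  fractional-cong (λ { (k ∷ xs) → decode-code k xs }) (fractional-decode code-computable)
  where
  encoded : ∀ {m} {p : Vec ℕ m → ℚ} → Fractional p → Vec ℕ m → ℕ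
  encoded F xs = ⟨ plus F xs , ⟨ minus F xs , denom F xs ⟩ ⟩
  encoded-computable : ∀ {m} {p : Vec ℕ m → ℚ} (F : Fractional p) → Computable (encoded F)
  encoded-computable F = computable-∘₂ ⟨_,_⟩ computable-⟨,⟩ (plus-computable F)
    (computable-∘₂ ⟨_,_⟩ computable-⟨,⟩ (minus-computable F) (denom-computable F))
  code : ℕ → Vec ℕ n → ℕ
  code zero    xs = encoded G xs
  code (suc k) xs = encoded H (k ∷ code k xs ∷ xs)
  code-computable : Computable (λ xs → code (head xs) (tail xs))
  code-computable = computable-rec (encoded-computable G) (encoded-computable H)
    (λ _ → refl) (λ _ _ → refl)
  decode-code : ∀ k xs → decode (code k xs) ≡ q (k ∷ xs)
  decode-code zero    xs = trans (decode-fraction (isFraction G xs)) (q₀ xs)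
  decode-code (suc k) xs = trans (decode-fraction (isFraction H (k ∷ code k xs ∷ xs)))
    (trans (cong (λ r → h k r xs) (decode-code k xs)) (q₊ k xs))

sign-bit : ∀ a → bit a ≡ 0 × -1ℤ ℤ.^ a ≡ + 1 ⊎ bit a ≡ 1 × -1ℤ ℤ.^ a ≡ -1ℤ
sign-bit zero = inj₁ (refl , refl)
sign-bit (suc a) with sign-bit a
... | inj₁ (b , s) rewrite b | s = inj₂ (refl , refl)
... | inj₂ (b , s) rewrite b | s = inj₁ (refl , refl)

computableℚ⇒fractional : {q : Vec ℕ arity → ℚ} → Computableℚ q → Fractional q
computableℚ⇒fractional {q = q} C = record
  { plus = λ xs → if toBool (bit (a xs)) then 0 else b xs
  ; minus = λ xs → if toBool (bit (a xs)) then b xs else 0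
  ; denom = c
  ; plus-computable = computable-if bit-a (computable-const 0) b-computable
  ; minus-computable = computable-if bit-a b-computable (computable-const 0)
  ; denom-computable = c-computable
  ; isFraction = λ xs → fraction-/ _ _ _ (c xs) (signed (a xs) (b xs)) (q≡ xs) }
  where
  open Computableℚ C
  bit-a = computable-∘₁ bit computable-bit a-computable
  signed : ∀ a b → -1ℤ ℤ.^ a ℤ.* + b ≡
    (if toBool (bit a) then 0 else b) ℤ.⊖ (if toBool (bit a) then b else 0)
  signed a b with sign-bit a
  ... | inj₁ (eb , es) rewrite eb | es = trans (ℤ.*-identityˡ (+ b)) (sym (ℤ.⊖-≥ {b} ℕ.z≤n))
  ... | inj₂ (eb , es) rewrite eb | es = trans (ℤ.-1*i≡-i (+ b)) (sym (ℤ.⊖-≤ {0} {b} ℕ.z≤n))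

fractional⇒computableℚ : {q : Vec ℕ arity → ℚ} → Fractional q → Computableℚ q
fractional⇒computableℚ {q = q} F = record
  -- The value 0 receives the sign -1, which is correct because `b` is 0 there.
  { a = λ xs → if toBool (plus F xs ℕ.∸ minus F xs) then 0 else 1
  ; b = λ xs → plus F xs ℕ.∸ minus F xs ℕ.+ (minus F xs ℕ.∸ plus F xs)
  ; c = denom F
  ; a-computable = computable-if u∸v (computable-const 0) (computable-const 1)
  ; b-computable = u∸v +ᶜ (minus-computable F ∸ᶜ plus-computable F)
  ; c-computable = denom-computable F
  ; q≡ = λ xs → trans (fraction-≡ (isFraction F xs)) (cong (ℚ._/ suc (denom F xs)) (signed (plus F xs) (minus F xs))) }
  where
  u∸v = plus-computable F ∸ᶜ minus-computable F
  signed : ∀ u v → u ℤ.⊖ v ≡ -1ℤ ℤ.^ (if toBool (u ℕ.∸ v) then 0 else 1) ℤ.* + (u ℕ.∸ v ℕ.+ (v ℕ.∸ u))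
  signed u v with u ℕ.∸ v in eq
  ... | zero  = trans (ℤ.⊖-≤ {u} {v} (ℕ.m∸n≡0⇒m≤n eq)) (sym (ℤ.-1*i≡-i _))
  ... | suc t with ℕ.<⇒≤ (ℕ.m∸n≢0⇒n<m {u} {v} (λ e → ℕ.1+n≢0 (trans (sym eq) e)))
  ...   | v≤u rewrite ℕ.m≤n⇒m∸n≡0 v≤u | ℕ.+-identityʳ t =
    trans (ℤ.⊖-≥ v≤u) (trans (cong +_ eq) (sym (ℤ.*-identityˡ (+ suc t))))

2^-j*2^j : ∀ j → 2^- j ℚ.* ιⁿ (2 ℕ.^ j) ≡ 1ℚ
2^-j*2^j j with 2 ℕ.^ j | ℕ.m^n≢0 2 j
... | suc w | _ = trans (/-*-ι (+ 1) w) ι-1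

fractional-2^- : {f : Vec ℕ arity → ℕ} → Computable f → Fractional (λ xs → 2^- f xs)
fractional-2^- {f = f} cf = record
  { plus = λ _ → 1 ; minus = λ _ → 0 ; denom = λ xs → ℕ.pred (2 ℕ.^ f xs)
  ; plus-computable = computable-const 1
  ; minus-computable = computable-const 0
  ; denom-computable = computable-∘₁ ℕ.pred computable-pred (computable-∘₁ (2 ℕ.^_) computable-2^ cf)
  ; isFraction = λ xs → trans
      (cong (λ k → 2^- f xs ℚ.* ιⁿ k) (ℕ.suc-pred (2 ℕ.^ f xs) {{ℕ.m^n≢0 2 (f xs)}}))
      (trans (2^-j*2^j (f xs)) (trans (sym ι-1) (ιⁿ-identity 1))) }

-- The real numbers as an ordered field

0<1 : 0ℚ ℚ.< 1ℚ
0<1 = ℚ.positive⁻¹ 1ℚ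

*-pos : ∀ {p q} → 0ℚ ℚ.< p → 0ℚ ℚ.< q → 0ℚ ℚ.< p ℚ.* q
*-pos {p} {q} 0<p 0<q = ℚ.positive⁻¹ (p ℚ.* q)
  {{ℚ.pos*pos⇒pos p {{ℚ.positive 0<p}} q {{ℚ.positive 0<q}}}}

half-pos : ∀ {p} → 0ℚ ℚ.< p → 0ℚ ℚ.< p ℚ.* ½
half-pos 0<p = *-pos 0<p (ℚ.positive⁻¹ ½)

inverse : ∀ p → 0ℚ ℚ.< p → ∃[ q ] 0ℚ ℚ.< q × p ℚ.* q ≡ 1ℚ
inverse p 0<p = ℚ.1/ p , ℚ.positive⁻¹ (ℚ.1/ p) {{ℚ.1/pos⇒pos p}} , ℚ.*-inverseʳ p
  where instance
    p-pos : ℚ.Positive p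
    p-pos = ℚ.positive 0<p
    p-nonZero : ℚ.NonZero p
    p-nonZero = ℚ.pos⇒nonZero p

p≤∣p∣ : ∀ p → p ℚ.≤ ∣ p ∣
p≤∣p∣ p with ℚ.≤-total 0ℚ p
... | inj₁ 0≤p = ℚ.≤-reflexive (sym (ℚ.0≤p⇒∣p∣≡p 0≤p))
... | inj₂ p≤0 = ℚ.≤-trans p≤0 (ℚ.0≤∣p∣ p)

∣-∣-swap : ∀ p q → ∣ p ℚ.- q ∣ ≡ ∣ q ℚ.- p ∣
∣-∣-swap p q = trans (sym (ℚ.∣-p∣≡∣p∣ (p ℚ.- q)))
  (cong ∣_∣ (solve 2 (λ p q → :- (p :- q) := q :- p) refl p q))

p-0≡p : ∀ p → p ℚ.- 0ℚ ≡ p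
p-0≡p p = trans (cong (p ℚ.+_) -0≡0) (ℚ.+-identityʳ p)
  where
  -0≡0 : ℚ.- 0ℚ ≡ 0ℚ
  -0≡0 = refl

∣p-q∣<ε⇒p<q+ε : ∀ {p q ε} → ∣ p ℚ.- q ∣ ℚ.< ε → p ℚ.< q ℚ.+ ε
∣p-q∣<ε⇒p<q+ε {p} {q} {ε} h = begin-strict
  p                     ≡⟨ solve 2 (λ p q → p := q :+ (p :- q)) refl p q ⟩
  q ℚ.+ (p ℚ.- q)       ≤⟨ ℚ.+-monoʳ-≤ q (p≤∣p∣ (p ℚ.- q)) ⟩
  q ℚ.+ ∣ p ℚ.- q ∣     <⟨ ℚ.+-monoʳ-< q h ⟩
  q ℚ.+ ε ∎
  where open ℚ.≤-Reasoning

p<q+ε⇒p-q<ε : ∀ {p q ε} → p ℚ.< q ℚ.+ ε → p ℚ.- q ℚ.< ε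
p<q+ε⇒p-q<ε {p} {q} {ε} h = begin-strict
  p ℚ.- q         <⟨ ℚ.+-monoˡ-< (ℚ.- q) h ⟩
  q ℚ.+ ε ℚ.- q   ≡⟨ solve 2 (λ q ε → q :+ ε :- q := ε) refl q ε ⟩
  ε ∎
  where open ℚ.≤-Reasoning

∣p-q∣<ε : ∀ {p q ε} → p ℚ.< q ℚ.+ ε → q ℚ.< p ℚ.+ ε → ∣ p ℚ.- q ∣ ℚ.< ε
∣p-q∣<ε {p} {q} {ε} p<q+ε q<p+ε with ℚ.≤-total p q
... | inj₁ p≤q = subst (ℚ._< ε) (sym (p≤q⇒∣p-q∣≡q-p p≤q)) (p<q+ε⇒p-q<ε q<p+ε)
... | inj₂ q≤p = subst (ℚ._< ε) (sym (trans (∣-∣-swap p q) (p≤q⇒∣p-q∣≡q-p q≤p))) (p<q+ε⇒p-q<ε p<q+ε)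

k<2^k : ∀ k → k ℕ.< 2 ℕ.^ k
k<2^k zero    = ℕ.s≤s ℕ.z≤n
k<2^k (suc k) = ℕ.+-mono-≤ {1} {2 ℕ.^ k} {suc k} (ℕ.m^n>0 2 k)
  (ℕ.≤-trans (k<2^k k) (ℕ.≤-reflexive (sym (ℕ.+-identityʳ _))))

ιⁿ-mono : ∀ {j k} → j ℕ.≤ k → ιⁿ j ℚ.≤ ιⁿ k
ιⁿ-mono {j} {k} j≤k = begin
  ιⁿ j                      ≡⟨ ℚ.+-identityʳ (ιⁿ j) ⟨
  ιⁿ j ℚ.+ 0ℚ               ≤⟨ ℚ.+-monoʳ-≤ (ιⁿ j) (ι-nonNegative (k ℕ.∸ j)) ⟩
  ιⁿ j ℚ.+ ιⁿ (k ℕ.∸ j)     ≡⟨ ιⁿ-+ j (k ℕ.∸ j) ⟨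
  ιⁿ (j ℕ.+ (k ℕ.∸ j))      ≡⟨ cong ιⁿ (ℕ.m+[n∸m]≡n j≤k) ⟩
  ιⁿ k ∎
  where open ℚ.≤-Reasoning

2^-pos : ∀ j → 0ℚ ℚ.< 2^- j
2^-pos j = ℚ.*-cancelʳ-<-nonNeg (ιⁿ (2 ℕ.^ j)) {{ℚ.nonNegative (ι-nonNegative (2 ℕ.^ j))}}
  (subst₂ ℚ._<_ (sym (ℚ.*-zeroˡ (ιⁿ (2 ℕ.^ j)))) (sym (2^-j*2^j j)) 0<1)

ιⁿ-2^-pos : ∀ j → ℚ.Positive (ιⁿ (2 ℕ.^ j))
ιⁿ-2^-pos j with 2 ℕ.^ j | ℕ.m^n≢0 2 j
... | suc w | _ = ι-positive w

2^-suc : ∀ j → 2^- suc j ℚ.+ 2^- suc j ≡ 2^- j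
2^-suc j = *-cancelʳ-pos s {{ιⁿ-2^-pos j}} (begin
  (a ℚ.+ a) ℚ.* s          ≡⟨ solve 2 (λ a s → (a :+ a) :* s := a :* (s :+ s)) refl a s ⟩
  a ℚ.* (s ℚ.+ s)          ≡⟨ cong (a ℚ.*_) (ιⁿ-+ (2 ℕ.^ j) (2 ℕ.^ j)) ⟨
  a ℚ.* ιⁿ (2 ℕ.^ j ℕ.+ 2 ℕ.^ j) ≡⟨ cong (λ k → a ℚ.* ιⁿ (2 ℕ.^ j ℕ.+ k)) (ℕ.+-identityʳ (2 ℕ.^ j)) ⟨
  a ℚ.* ιⁿ (2 ℕ.^ suc j)   ≡⟨ 2^-j*2^j (suc j) ⟩
  1ℚ                       ≡⟨ 2^-j*2^j j ⟨
  2^- j ℚ.* s ∎)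
  where
  open ≡-Reasoning
  a = 2^- suc j
  s = ιⁿ (2 ℕ.^ j)

2^-0 : 2^- 0 ≡ 1ℚ
2^-0 = refl

2^-archimedean : ∀ {ε} → 0ℚ ℚ.< ε → ∃[ j ] 2^- j ℚ.< ε
2^-archimedean {ε@(ℚ.mkℚ (+ zero) w _)} 0<ε = ⊥-elim (ℚ.<-irrefl (sym (ℚ.↥p≡0⇒p≡0 ε refl)) 0<ε)
2^-archimedean {ε@(ℚ.mkℚ -[1+ a ] w _)} 0<ε = ⊥-elim (ℚ.<-irrefl refl (ℚ.<-trans 0<ε (ℚ.negative⁻¹ ε)))
-- For ε = (a + 1) / (w + 1) the exponent w + 1 suffices, since w + 1 < 2^(w + 1) and 1 ≤ a + 1.
2^-archimedean {ε@(ℚ.mkℚ (+ suc a) w _)} 0<ε = suc w , ℚ.*-cancelʳ-<-nonNeg t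
  {{ℚ.nonNegative (ι-nonNegative (suc w))}} (begin-strict
    2^- suc w ℚ.* t                     <⟨ ℚ.*-monoʳ-<-pos (2^- suc w) {{ℚ.positive (2^-pos (suc w))}} t<2^ ⟩
    2^- suc w ℚ.* ιⁿ (2 ℕ.^ suc w)      ≡⟨ 2^-j*2^j (suc w) ⟩
    1ℚ                                  ≡⟨ ι-1 ⟨
    ιⁿ 1                                ≤⟨ ιⁿ-mono (ℕ.s≤s ℕ.z≤n) ⟩
    ιⁿ (suc a)                          ≡⟨ /-*-ι (+ suc a) w ⟨
    (+ suc a ℚ./ suc w) ℚ.* t           ≡⟨ cong (ℚ._* t) (ℚ.↥p/↧p≡p ε) ⟩
    ε ℚ.* t ∎)
  where
  open ℚ.≤-Reasoning
  t = ιⁿ (suc w)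
  t<2^ : t ℚ.< ιⁿ (2 ℕ.^ suc w)
  t<2^ = begin-strict
    t                     ≡⟨ ℚ.+-identityˡ t ⟨
    0ℚ ℚ.+ t              <⟨ ℚ.+-monoˡ-< t (ℚ.positive⁻¹ (ιⁿ 1) {{ι-positive 0}}) ⟩
    ιⁿ 1 ℚ.+ t            ≡⟨ ιⁿ-+ 1 (suc w) ⟨
    ιⁿ (suc (suc w))      ≤⟨ ιⁿ-mono (k<2^k (suc w)) ⟩
    ιⁿ (2 ℕ.^ suc w) ∎

-- The relations of Defs unfold to types from which the related reals cannot be
-- inferred; wrapping them in records keeps the reals as parameters.

infix 4 _≈ʳ_ _≤ʳ_ _<ʳ_

record _≈ʳ_ (x y : ℝ) : Set where
  constructor wrap
  field unwrap : x ≈ y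
record _≤ʳ_ (x y : ℝ) : Set where
  constructor wrap
  field unwrap : x ≤ y
record _<ʳ_ (x y : ℝ) : Set where
  constructor wrap
  field unwrap : x < y
open _≈ʳ_ public renaming (unwrap to unwrap≈)
open _≤ʳ_ public renaming (unwrap to unwrap≤)
open _<ʳ_ public renaming (unwrap to unwrap<)

∀≡⇒≈ : ∀ {x y} → (∀ n → seq x n ≡ seq y n) → x ≈ʳ y
∀≡⇒≈ {x} {y} h = wrap λ {ε} 0<ε → 0 , λ {n} _ → subst (ℚ._< ε)
  (sym (trans (cong (λ p → ∣ p ℚ.- seq y n ∣) (h n)) (cong ∣_∣ (ℚ.+-inverseʳ (seq y n))))) 0<ε

p<p+ε : ∀ p {ε} → 0ℚ ℚ.< ε → p ℚ.< p ℚ.+ ε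
p<p+ε p {ε} 0<ε = subst (ℚ._< p ℚ.+ ε) (ℚ.+-identityʳ p) (ℚ.+-monoʳ-< p 0<ε)

∀≤⇒≤ : ∀ {x y} → (∀ n → seq x n ℚ.≤ seq y n) → x ≤ʳ y
∀≤⇒≤ {x} {y} h = wrap λ {ε} 0<ε → 0 , λ {n} _ → ℚ.≤-<-trans (h n) (p<p+ε (seq y n) 0<ε)

≤-refl : ∀ {x} → x ≤ʳ x
≤-refl = ∀≤⇒≤ (λ _ → ℚ.≤-refl)

≈⇒≤ : ∀ {x y} → x ≈ʳ y → x ≤ʳ y
≈⇒≤ (wrap h) = wrap λ 0<ε → let N , k = h 0<ε in N , λ N≤n → ∣p-q∣<ε⇒p<q+ε (k N≤n)

≈⇒≥ : ∀ {x y} → x ≈ʳ y → y ≤ʳ x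
≈⇒≥ {x} {y} (wrap h) = wrap λ {ε} 0<ε → let N , k = h 0<ε in N , λ {n} N≤n →
  ∣p-q∣<ε⇒p<q+ε (subst (ℚ._< ε) (∣-∣-swap (seq x n) (seq y n)) (k N≤n))

≤-antisym : ∀ {x y} → x ≤ʳ y → y ≤ʳ x → x ≈ʳ y
≤-antisym (wrap h) (wrap k) = wrap λ 0<ε → let M , h′ = h 0<ε ; N , k′ = k 0<ε in
  M ℕ.⊔ N , λ p → ∣p-q∣<ε (h′ (ℕ.m⊔n≤o⇒m≤o M N p)) (k′ (ℕ.m⊔n≤o⇒n≤o M N p))

≤-trans : ∀ {x y z} → x ≤ʳ y → y ≤ʳ z → x ≤ʳ z
≤-trans {x} {y} {z} (wrap h) (wrap k) = wrap λ {ε} 0<ε →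
  let M , h′ = h (half-pos 0<ε) ; N , k′ = k (half-pos 0<ε) in
  M ℕ.⊔ N , λ {n} p → begin-strict
    seq x n                       <⟨ h′ (ℕ.m⊔n≤o⇒m≤o M N p) ⟩
    seq y n ℚ.+ ε ℚ.* ½           <⟨ ℚ.+-monoˡ-< (ε ℚ.* ½) (k′ (ℕ.m⊔n≤o⇒n≤o M N p)) ⟩
    seq z n ℚ.+ ε ℚ.* ½ ℚ.+ ε ℚ.* ½ ≡⟨ ℚ.+-assoc (seq z n) (ε ℚ.* ½) (ε ℚ.* ½) ⟩
    seq z n ℚ.+ (ε ℚ.* ½ ℚ.+ ε ℚ.* ½) ≡⟨ cong (seq z n ℚ.+_) (*½+*½ ε) ⟩
    seq z n ℚ.+ ε ∎
  where open ℚ.≤-Reasoning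

≈-refl : ∀ {x} → x ≈ʳ x
≈-refl = ∀≡⇒≈ (λ _ → refl)

≈-sym : ∀ {x y} → x ≈ʳ y → y ≈ʳ x
≈-sym h = ≤-antisym (≈⇒≥ h) (≈⇒≤ h)

≈-trans : ∀ {x y z} → x ≈ʳ y → y ≈ʳ z → x ≈ʳ z
≈-trans h k = ≤-antisym (≤-trans (≈⇒≤ h) (≈⇒≤ k)) (≤-trans (≈⇒≥ k) (≈⇒≥ h))

+-mono-≤ : ∀ {x y u v} → x ≤ʳ y → u ≤ʳ v → x + u ≤ʳ y + v
+-mono-≤ {x} {y} {u} {v} (wrap h) (wrap k) = wrap λ {ε} 0<ε →
  let M , h′ = h (half-pos 0<ε) ; N , k′ = k (half-pos 0<ε) in
  M ℕ.⊔ N , λ {n} p → begin-strict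
    seq x n ℚ.+ seq u n           <⟨ ℚ.+-mono-< (h′ (ℕ.m⊔n≤o⇒m≤o M N p)) (k′ (ℕ.m⊔n≤o⇒n≤o M N p)) ⟩
    (seq y n ℚ.+ ε ℚ.* ½) ℚ.+ (seq v n ℚ.+ ε ℚ.* ½)
      ≡⟨ solve 3 (λ y v e → (y :+ e) :+ (v :+ e) := (y :+ v) :+ (e :+ e)) refl (seq y n) (seq v n) (ε ℚ.* ½) ⟩
    seq y n ℚ.+ seq v n ℚ.+ (ε ℚ.* ½ ℚ.+ ε ℚ.* ½) ≡⟨ cong (seq y n ℚ.+ seq v n ℚ.+_) (*½+*½ ε) ⟩
    seq y n ℚ.+ seq v n ℚ.+ ε ∎
  where open ℚ.≤-Reasoning

neg-antimono-≤ : ∀ {x y} → x ≤ʳ y → - y ≤ʳ - x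
neg-antimono-≤ {x} {y} (wrap h) = wrap λ {ε} 0<ε → let N , h′ = h 0<ε in N , λ {n} p → begin-strict
    ℚ.- seq y n                             ≡⟨ solve 3 (λ x y e → :- y := x :+ (:- x :- y)) refl (seq x n) (seq y n) ε ⟩
    seq x n ℚ.+ (ℚ.- seq x n ℚ.- seq y n)   <⟨ ℚ.+-monoˡ-< _ (h′ p) ⟩
    seq y n ℚ.+ ε ℚ.+ (ℚ.- seq x n ℚ.- seq y n) ≡⟨ solve 3 (λ x y e → y :+ e :+ (:- x :- y) := :- x :+ e) refl (seq x n) (seq y n) ε ⟩
    ℚ.- seq x n ℚ.+ ε ∎
  where open ℚ.≤-Reasoning

+-cong : ∀ {x y u v} → x ≈ʳ y → u ≈ʳ v → x + u ≈ʳ y + v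
+-cong h k = ≤-antisym (+-mono-≤ (≈⇒≤ h) (≈⇒≤ k)) (+-mono-≤ (≈⇒≥ h) (≈⇒≥ k))

neg-cong : ∀ {x y} → x ≈ʳ y → - x ≈ʳ - y
neg-cong h = ≤-antisym (neg-antimono-≤ (≈⇒≥ h)) (neg-antimono-≤ (≈⇒≤ h))

eventually-bounded : ∀ x → ∃[ B ] 0ℚ ℚ.< B × ∃[ N ] ∀ {n} → N ℕ.≤ n → ∣ seq x n ∣ ℚ.≤ B
eventually-bounded x with cauchy x 0<1
... | N , h = 1ℚ ℚ.+ ∣ seq x N ∣
  , ℚ.<-≤-trans 0<1 (subst (ℚ._≤ 1ℚ ℚ.+ ∣ seq x N ∣) (ℚ.+-identityʳ 1ℚ) (ℚ.+-monoʳ-≤ 1ℚ (ℚ.0≤∣p∣ (seq x N))))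
  , N , λ {n} p → begin
    ∣ seq x n ∣ ≡⟨ cong ∣_∣ (solve 2 (λ a b → a := (a :- b) :+ b) refl (seq x n) (seq x N)) ⟩
    ∣ (seq x n ℚ.- seq x N) ℚ.+ seq x N ∣   ≤⟨ ℚ.∣p+q∣≤∣p∣+∣q∣ (seq x n ℚ.- seq x N) (seq x N) ⟩
    ∣ seq x n ℚ.- seq x N ∣ ℚ.+ ∣ seq x N ∣ ≤⟨ ℚ.+-monoˡ-≤ ∣ seq x N ∣ (ℚ.<⇒≤ (h p ℕ.≤-refl)) ⟩
    1ℚ ℚ.+ ∣ seq x N ∣ ∎
  where open ℚ.≤-Reasoning

∣p*q∣<ε : ∀ p q {B C ε} → 0ℚ ℚ.< B → B ℚ.* C ≡ 1ℚ → ∣ p ∣ ℚ.≤ B → ∣ q ℚ.- 0ℚ ∣ ℚ.< C ℚ.* ε →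
  ∣ p ℚ.* q ℚ.- 0ℚ ∣ ℚ.< ε
∣p*q∣<ε p q {B} {C} {ε} 0<B BC≡1 p≤B q<Cε = begin-strict
  ∣ p ℚ.* q ℚ.- 0ℚ ∣       ≡⟨ cong ∣_∣ (p-0≡p (p ℚ.* q)) ⟩
  ∣ p ℚ.* q ∣              ≡⟨ ℚ.∣p*q∣≡∣p∣*∣q∣ p q ⟩
  ∣ p ∣ ℚ.* ∣ q ∣          ≤⟨ ℚ.*-monoʳ-≤-nonNeg ∣ q ∣ {{ℚ.∣-∣-nonNeg q}} p≤B ⟩
  B ℚ.* ∣ q ∣              ≡⟨ cong (λ q → B ℚ.* ∣ q ∣) (p-0≡p q) ⟨
  B ℚ.* ∣ q ℚ.- 0ℚ ∣       <⟨ ℚ.*-monoʳ-<-pos B {{ℚ.positive 0<B}} q<Cε ⟩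
  B ℚ.* (C ℚ.* ε)          ≡⟨ ℚ.*-assoc B C ε ⟨
  B ℚ.* C ℚ.* ε            ≡⟨ cong (ℚ._* ε) BC≡1 ⟩
  1ℚ ℚ.* ε                 ≡⟨ ℚ.*-identityˡ ε ⟩
  ε ∎
  where open ℚ.≤-Reasoning

-- A Cauchy sequence is eventually bounded by some B, and bounded times null is null. `C` is 1 / B,
-- which turns the tolerance C ε for y into ε for the product.
*-zeroʳ′ : ∀ {y} x → y ≈ʳ 0ℝ → x * y ≈ʳ 0ℝ
*-zeroʳ′ {y} x (wrap h) = wrap λ 0<ε →
  let B , 0<B , M , bd = eventually-bounded x
      C , 0<C , BC≡1 = inverse B 0<B
      N , k = h (*-pos 0<C 0<ε)
  in M ℕ.⊔ N , λ {n} p →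
    ∣p*q∣<ε (seq x n) (seq y n) 0<B BC≡1 (bd (ℕ.m⊔n≤o⇒m≤o M N p)) (k (ℕ.m⊔n≤o⇒n≤o M N p))

*-comm : ∀ x y → x * y ≈ʳ y * x
*-comm x y = ∀≡⇒≈ {x * y} {y * x} λ n → ℚ.*-comm (seq x n) (seq y n)

-- The splitting x y = x (y - z) + x z leaves only a product with the null sequence y - z to
-- estimate.
*-congʳ : ∀ x {y z} → y ≈ʳ z → x * y ≈ʳ x * z
*-congʳ x {y} {z} h = ≈-trans {x * y} {x * (y - z) + x * z} {x * z}
  (∀≡⇒≈ {x * y} {x * (y - z) + x * z} λ n →
    solve 3 (λ x y z → x :* y := x :* (y :- z) :+ x :* z) refl (seq x n) (seq y n) (seq z n))
  (≈-trans {x * (y - z) + x * z} {0ℝ + x * z} {x * z}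
    (+-cong {x * (y - z)} {0ℝ} {x * z} {x * z} (*-zeroʳ′ {y - z} x y-z≈0) (≈-refl {x * z}))
    (∀≡⇒≈ {0ℝ + x * z} {x * z} λ n → ℚ.+-identityˡ (seq x n ℚ.* seq z n)))
  where
  y-z≈0 : y - z ≈ʳ 0ℝ
  y-z≈0 = ≈-trans {y - z} {z - z} {0ℝ}
    (+-cong {y} {z} { - z} { - z} h (≈-refl { - z}))
    (∀≡⇒≈ {z - z} {0ℝ} λ n → ℚ.+-inverseʳ (seq z n))

*-cong : ∀ {x y u v} → x ≈ʳ y → u ≈ʳ v → x * u ≈ʳ y * v
*-cong {x} {y} {u} {v} h k = ≈-trans {x * u} {x * v} {y * v} (*-congʳ x {u} {v} k)
  (≈-trans {x * v} {v * x} {y * v} (*-comm x v)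
    (≈-trans {v * x} {v * y} {y * v} (*-congʳ v {x} {y} h) (*-comm v y)))

<⇒≱ : ∀ {x y} → x <ʳ y → ¬ y ≤ʳ x
<⇒≱ {x} {y} (wrap (ε , 0<ε , M , h)) (wrap k) with k 0<ε
... | N , k′ = ℚ.<-irrefl refl (ℚ.<-trans (h {M ℕ.⊔ N} (ℕ.m≤m⊔n M N)) (k′ (ℕ.m≤n⊔m M N)))

*-pos-< : ∀ {x y} → 0ℝ <ʳ x → 0ℝ <ʳ y → 0ℝ <ʳ x * y
*-pos-< {x} {y} (wrap (δ , 0<δ , M , h)) (wrap (ε , 0<ε , N , k)) =
  wrap (δ ℚ.* ε , *-pos 0<δ 0<ε , M ℕ.⊔ N , λ {n} p → begin-strict
    0ℚ ℚ.+ δ ℚ.* ε         ≡⟨ ℚ.+-identityˡ _ ⟩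
    δ ℚ.* ε                <⟨ ℚ.*-monoʳ-<-pos δ {{ℚ.positive 0<δ}} (ε<y p) ⟩
    δ ℚ.* seq y n          <⟨ ℚ.*-monoˡ-<-pos (seq y n) {{ℚ.positive (ℚ.<-trans 0<ε (ε<y p))}} (δ<x p) ⟩
    seq x n ℚ.* seq y n ∎)
  where
  open ℚ.≤-Reasoning
  ε<y : ∀ {n} → M ℕ.⊔ N ℕ.≤ n → ε ℚ.< seq y n
  ε<y {n} p = subst (ℚ._< seq y n) (ℚ.+-identityˡ ε) (k (ℕ.m⊔n≤o⇒n≤o M N p))
  δ<x : ∀ {n} → M ℕ.⊔ N ℕ.≤ n → δ ℚ.< seq x n
  δ<x {n} p = subst (ℚ._< seq x n) (ℚ.+-identityˡ δ) (h (ℕ.m⊔n≤o⇒m≤o M N p))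

fromℚ-mono-≤ : ∀ {p q} → p ℚ.≤ q → fromℚ p ≤ʳ fromℚ q
fromℚ-mono-≤ p≤q = ∀≤⇒≤ (λ _ → p≤q)

reciprocal : ∀ {x} → 0ℝ <ʳ x → ∃[ y ] x * y ≈ʳ 1ℝ
reciprocal {x} (wrap (ε , 0<ε , N , h)) = reciprocal′ , wrap λ {η} 0<η → N , λ {n} p →
  subst (ℚ._< η) (sym (trans (cong (λ q → ∣ q ℚ.- 1ℚ ∣) (trans (cong (ℚ._* y′ n) (sym (s≡x p))) (s*y≡1 n)))
    (cong ∣_∣ (ℚ.+-inverseʳ 1ℚ)))) 0<η
  where
  open ℚ.≤-Reasoning
  -- Early terms of `x` may vanish or be negative; the cutoff at ε makes all terms invertible and
  -- changes none from `N` on.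
  s : ℕ → ℚ
  s n = seq x n ℚ.⊔ ε
  0<s : ∀ n → 0ℚ ℚ.< s n
  0<s n = ℚ.<-≤-trans 0<ε (ℚ.p≤q⊔p (seq x n) ε)
  s≡x : ∀ {n} → N ℕ.≤ n → s n ≡ seq x n
  s≡x {n} p = ℚ.p≥q⇒p⊔q≡p (ℚ.<⇒≤ (subst (ℚ._< seq x n) (ℚ.+-identityˡ ε) (h p)))
  y′ : ℕ → ℚ
  y′ n = proj₁ (inverse (s n) (0<s n))
  0<y : ∀ n → 0ℚ ℚ.< y′ n
  0<y n = proj₁ (proj₂ (inverse (s n) (0<s n)))
  s*y≡1 : ∀ n → s n ℚ.* y′ n ≡ 1ℚ
  s*y≡1 n = proj₂ (proj₂ (inverse (s n) (0<s n)))
  e : ℚ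
  e = proj₁ (inverse ε 0<ε)
  0<e : 0ℚ ℚ.< e
  0<e = proj₁ (proj₂ (inverse ε 0<ε))
  ε*e≡1 : ε ℚ.* e ≡ 1ℚ
  ε*e≡1 = proj₂ (proj₂ (inverse ε 0<ε))
  y≤e : ∀ n → y′ n ℚ.≤ e
  y≤e n = begin
    y′ n                   ≡⟨ ℚ.*-identityˡ (y′ n) ⟨
    1ℚ ℚ.* y′ n            ≡⟨ cong (ℚ._* y′ n) ε*e≡1 ⟨
    ε ℚ.* e ℚ.* y′ n       ≤⟨ ℚ.*-monoʳ-≤-nonNeg (y′ n) {{ℚ.pos⇒nonNeg (y′ n) {{ℚ.positive (0<y n)}}}}
                                (ℚ.*-monoʳ-≤-nonNeg e {{ℚ.pos⇒nonNeg e {{ℚ.positive 0<e}}}} (ℚ.p≤q⊔p (seq x n) ε)) ⟩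
    s n ℚ.* e ℚ.* y′ n     ≡⟨ solve 3 (λ s e y → s :* e :* y := s :* y :* e) refl (s n) e (y′ n) ⟩
    s n ℚ.* y′ n ℚ.* e     ≡⟨ cong (ℚ._* e) (s*y≡1 n) ⟩
    1ℚ ℚ.* e               ≡⟨ ℚ.*-identityˡ e ⟩
    e ∎
  diff : ∀ m n → y′ m ℚ.- y′ n ≡ y′ m ℚ.* y′ n ℚ.* (s n ℚ.- s m)
  diff m n = begin-equality
    y′ m ℚ.- y′ n ≡⟨ solve 2 (λ a b → a :- b := a :* con 1ℚ :- b :* con 1ℚ) refl (y′ m) (y′ n) ⟩
    y′ m ℚ.* 1ℚ ℚ.- y′ n ℚ.* 1ℚ ≡⟨ cong₂ (λ p q → y′ m ℚ.* p ℚ.- y′ n ℚ.* q) (s*y≡1 n) (s*y≡1 m) ⟨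
    y′ m ℚ.* (s n ℚ.* y′ n) ℚ.- y′ n ℚ.* (s m ℚ.* y′ m)
      ≡⟨ solve 4 (λ a b s t → a :* (s :* b) :- b :* (t :* a) := a :* b :* (s :- t)) refl (y′ m) (y′ n) (s n) (s m) ⟩
    y′ m ℚ.* y′ n ℚ.* (s n ℚ.- s m) ∎
  cauchy-y : Cauchy y′
  -- Inversion magnifies differences by at most e² = 1 / ε², so the precision η ε² is requested from
  -- `x`.
  cauchy-y {η} 0<η with cauchy x (*-pos 0<η (*-pos 0<ε 0<ε))
  ... | M , k = M ℕ.⊔ N , λ {m} {n} p q → begin-strict
    ∣ y′ m ℚ.- y′ n ∣                        ≡⟨ cong ∣_∣ (diff m n) ⟩
    ∣ y′ m ℚ.* y′ n ℚ.* (s n ℚ.- s m) ∣      ≡⟨ ℚ.∣p*q∣≡∣p∣*∣q∣ (y′ m ℚ.* y′ n) (s n ℚ.- s m) ⟩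
    ∣ y′ m ℚ.* y′ n ∣ ℚ.* ∣ s n ℚ.- s m ∣    ≡⟨ cong₂ ℚ._*_ (ℚ.0≤p⇒∣p∣≡p (ℚ.<⇒≤ (*-pos (0<y m) (0<y n))))
      (cong₂ (λ p q → ∣ p ℚ.- q ∣) (s≡x (ℕ.m⊔n≤o⇒n≤o M N q)) (s≡x (ℕ.m⊔n≤o⇒n≤o M N p))) ⟩
    y′ m ℚ.* y′ n ℚ.* ∣ seq x n ℚ.- seq x m ∣
      ≤⟨ ℚ.*-monoʳ-≤-nonNeg _ {{ℚ.∣-∣-nonNeg (seq x n ℚ.- seq x m)}} (ℚ.≤-trans
           (ℚ.*-monoʳ-≤-nonNeg (y′ n) {{ℚ.pos⇒nonNeg (y′ n) {{ℚ.positive (0<y n)}}}} (y≤e m))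
           (ℚ.*-monoˡ-≤-nonNeg e {{ℚ.pos⇒nonNeg e {{ℚ.positive 0<e}}}} (y≤e n))) ⟩
    e ℚ.* e ℚ.* ∣ seq x n ℚ.- seq x m ∣
      <⟨ ℚ.*-monoʳ-<-pos (e ℚ.* e) {{ℚ.positive (*-pos 0<e 0<e)}} (k (ℕ.m⊔n≤o⇒m≤o M N q) (ℕ.m⊔n≤o⇒m≤o M N p)) ⟩
    e ℚ.* e ℚ.* (η ℚ.* (ε ℚ.* ε))
      ≡⟨ solve 3 (λ e h d → e :* e :* (h :* (d :* d)) := h :* (d :* e) :* (d :* e)) refl e η ε ⟩
    η ℚ.* (ε ℚ.* e) ℚ.* (ε ℚ.* e)            ≡⟨ cong (λ p → η ℚ.* p ℚ.* p) ε*e≡1 ⟩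
    η ℚ.* 1ℚ ℚ.* 1ℚ                          ≡⟨ trans (ℚ.*-identityʳ _) (ℚ.*-identityʳ η) ⟩
    η ∎
  reciprocal′ : ℝ
  reciprocal′ = real y′ cauchy-y

-- Here g is a quarter of ε and h a half: moving both ends by less than g leaves more than half of
-- the gap.
gap : ∀ {p p′ q q′ g ε h} → g ℚ.+ g ≡ h → h ℚ.+ h ≡ ε → q′ ℚ.+ ε ℚ.≤ p′ →
  ∣ q ℚ.- q′ ∣ ℚ.< g → ∣ p′ ℚ.- p ∣ ℚ.< g → q ℚ.+ h ℚ.< p
gap {p} {p′} {q} {q′} {g} refl refl q′+ε≤p′ q~q′ p′~p = begin-strict
  q ℚ.+ (g ℚ.+ g)          <⟨ ℚ.+-monoˡ-< (g ℚ.+ g) (∣p-q∣<ε⇒p<q+ε {q} {q′} {g} q~q′) ⟩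
  q′ ℚ.+ g ℚ.+ (g ℚ.+ g)   ≡⟨ solve 2 (λ q g → q :+ g :+ (g :+ g) := q :+ ((g :+ g) :+ (g :+ g)) :- g) refl q′ g ⟩
  q′ ℚ.+ ((g ℚ.+ g) ℚ.+ (g ℚ.+ g)) ℚ.- g ≤⟨ ℚ.+-monoˡ-≤ (ℚ.- g) q′+ε≤p′ ⟩
  p′ ℚ.- g                 <⟨ ℚ.+-monoˡ-< (ℚ.- g) (∣p-q∣<ε⇒p<q+ε {p′} {p} {g} p′~p) ⟩
  p ℚ.+ g ℚ.- g            ≡⟨ solve 2 (λ p g → p :+ g :- g := p) refl p g ⟩
  p ∎
  where open ℚ.≤-Reasoning

module Classical (em : ExcludedMiddle 0ℓ) where

  ¬∀⇒∃¬ : {A : Set} {B : A → Set} → ¬ (∀ x → B x) → ∃[ x ] ¬ B x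
  ¬∀⇒∃¬ {A} {B} h with em {∃[ x ] ¬ B x}
  ... | yes p = p
  ... | no ¬p = ⊥-elim (h λ x → byContradiction λ ¬b → ¬p (x , ¬b))
    where
    byContradiction : ∀ {x} → ¬ ¬ B x → B x
    byContradiction {x} k with em {B x}
    ... | yes b = b
    ... | no ¬b = ⊥-elim (k ¬b)

  -- A failure of ≤ yields one ε that is violated beyond every index. A single violation past both
  -- Cauchy moduli already persists at all later indices, by `gap`.
  ≰⇒> : ∀ {x y} → ¬ x ≤ʳ y → y <ʳ x
  ≰⇒> {x} {y} x≰y = wrap (h , half-pos 0<ε , P , λ {n} p →
    gap {seq x n} {seq x m} {seq y n} {seq y m} {g} {ε} {h} (*½+*½ h) (*½+*½ ε) (ℚ.≮⇒≥ y+ε≮x)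
      (ky (ℕ.m⊔n≤o⇒n≤o M N p) (ℕ.m⊔n≤o⇒n≤o M N P≤m))
      (kx (ℕ.m⊔n≤o⇒m≤o M N P≤m) (ℕ.m⊔n≤o⇒m≤o M N p)))
    where
    Within : ℚ → ℕ → Set
    Within ε N = ∀ n → N ℕ.≤ n → seq x n ℚ.< seq y n ℚ.+ ε
    fails : ∃[ ε ] ¬ (0ℚ ℚ.< ε → ∃[ N ] Within ε N)
    fails = ¬∀⇒∃¬ {ℚ} {λ ε → 0ℚ ℚ.< ε → ∃[ N ] Within ε N}
      λ k → x≰y (wrap λ {ε} 0<ε → proj₁ (k ε 0<ε) , λ {n} → proj₂ (k ε 0<ε) n)
    ε h g : ℚ
    ε = proj₁ fails
    h = ε ℚ.* ½
    g = h ℚ.* ½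
    never : 0ℚ ℚ.< ε × ¬ (∃[ N ] Within ε N)
    -- An implication is a product over the proofs of its premise, so `¬∀⇒∃¬` also splits a refuted
    -- implication into its premise and the negated conclusion.
    never = ¬∀⇒∃¬ {0ℚ ℚ.< ε} {λ _ → ∃[ N ] Within ε N} (proj₂ fails)
    0<ε : 0ℚ ℚ.< ε
    0<ε = proj₁ never
    cofinal : ∀ N → ∃[ n ] ¬ (N ℕ.≤ n → seq x n ℚ.< seq y n ℚ.+ ε)
    cofinal N = ¬∀⇒∃¬ {ℕ} {λ n → N ℕ.≤ n → seq x n ℚ.< seq y n ℚ.+ ε} λ k → proj₂ never (N , k)
    M N P m : ℕ
    M = proj₁ (cauchy x (half-pos (half-pos 0<ε)))
    kx = proj₂ (cauchy x (half-pos (half-pos 0<ε)))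
    N = proj₁ (cauchy y (half-pos (half-pos 0<ε)))
    ky = proj₂ (cauchy y (half-pos (half-pos 0<ε)))
    P = M ℕ.⊔ N
    m = proj₁ (cofinal P)
    at-m : P ℕ.≤ m × ¬ seq x m ℚ.< seq y m ℚ.+ ε
    at-m = ¬∀⇒∃¬ {P ℕ.≤ m} {λ _ → seq x m ℚ.< seq y m ℚ.+ ε} (proj₂ (cofinal P))
    P≤m : P ℕ.≤ m
    P≤m = proj₁ at-m
    y+ε≮x : ¬ seq x m ℚ.< seq y m ℚ.+ ε
    y+ε≮x = proj₂ at-m

-- Word indices and finite minima

at : ∀ {n} (q : ℕ → ℚ) {f : Vec ℕ n → ℕ} → Fractional {1} (q ∘ head) → Computable f → Fractional (q ∘ f)
at q {f} F cf = fractional-∘ {fs = f ∷ []} F (cf ∷ [])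

double-< : ∀ b {k m} → k ℕ.< m → double b k ℕ.< 2 ℕ.* m
double-< false {k} {m} k<m = ℕ.+-mono-<-≤ k<m (ℕ.≤-trans (ℕ.<⇒≤ k<m) (ℕ.m≤m+n m 0))
double-< true  {k} {m} k<m = ℕ.≤-trans (ℕ.≤-reflexive (cong suc (sym (ℕ.+-suc k k))))
  (ℕ.+-mono-≤ k<m (ℕ.≤-trans k<m (ℕ.m≤m+n m 0)))

minimum : (ℕ → ℚ) → ℕ → ℚ
minimum f zero    = f zero
minimum f (suc k) = minimum f k ℚ.⊓ f (suc k)

minimum-≤ : ∀ f {j k} → j ℕ.≤ k → minimum f k ℚ.≤ f j
minimum-≤ f {zero} {zero} ℕ.z≤n = ℚ.≤-refl
minimum-≤ f {j} {suc k} j≤1+k with ℕ.m≤n⇒m<n∨m≡n j≤1+k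
... | inj₁ (ℕ.s≤s j≤k) = ℚ.≤-trans (ℚ.p⊓q≤p (minimum f k) (f (suc k))) (minimum-≤ f j≤k)
... | inj₂ refl        = ℚ.p⊓q≤q (minimum f k) (f (suc k))

minimum-attained : ∀ f k → ∃[ j ] minimum f k ≡ f j
minimum-attained f zero = zero , refl
minimum-attained f (suc k) with ℚ.⊓-sel (minimum f k) (f (suc k))
... | inj₂ e = suc k , e
... | inj₁ e with minimum-attained f k
...   | j , e′ = j , trans e e′

-- Archimedean ordered fields over the rationals

record ArchimedeanField : Set₁ where
  field
    commutativeRing : CommutativeRing 0ℓ 0ℓ
  open CommutativeRing commutativeRing public
    using (Carrier)
    renaming ( _≈_ to _≃_; _+_ to _⊕_; _*_ to _⊗_; -_ to ⊖_; _-_ to _⊝_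
             ; refl to ≃-refl; sym to ≃-sym; trans to ≃-trans
             ; +-cong to ⊕-cong; *-cong to ⊗-cong; -‿cong to ⊖-cong)
  infix 4 _≼_ _≺_
  field
    _≼_         : Rel Carrier 0ℓ
    ≼-reflexive : ∀ {x y} → x ≃ y → x ≼ y
    ≼-antisym   : ∀ {x y} → x ≼ y → y ≼ x → x ≃ y
    ≼-trans     : ∀ {x y z} → x ≼ y → y ≼ z → x ≼ z
    ≼-total     : ∀ x y → x ≼ y ⊎ y ≼ x
    ⊕-monoˡ-≼   : ∀ {x y} z → x ≼ y → x ⊕ z ≼ y ⊕ z
    ⌜_⌝         : ℚ → Carrier
    ⌜⌝-+        : ∀ p q → ⌜ p ℚ.+ q ⌝ ≃ ⌜ p ⌝ ⊕ ⌜ q ⌝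
    ⌜⌝-*        : ∀ p q → ⌜ p ℚ.* q ⌝ ≃ ⌜ p ⌝ ⊗ ⌜ q ⌝
    ⌜⌝-neg      : ∀ p → ⌜ ℚ.- p ⌝ ≃ ⊖ ⌜ p ⌝
    ⌜0⌝         : ⌜ 0ℚ ⌝ ≃ CommutativeRing.0# commutativeRing
    ⌜1⌝         : ⌜ 1ℚ ⌝ ≃ CommutativeRing.1# commutativeRing
    ⌜⌝-mono     : ∀ {p q} → p ℚ.≤ q → ⌜ p ⌝ ≼ ⌜ q ⌝
    ⌜⌝-cancel   : ∀ {p q} → ⌜ p ⌝ ≼ ⌜ q ⌝ → p ℚ.≤ q
  _≺_ : Rel Carrier 0ℓ
  x ≺ y = ¬ y ≼ x
  field
    ⊗-nonNeg    : ∀ {x y} → ⌜ 0ℚ ⌝ ≼ x → ⌜ 0ℚ ⌝ ≼ y → ⌜ 0ℚ ⌝ ≼ x ⊗ y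
    reciprocalᶠ : ∀ {x} → ⌜ 0ℚ ⌝ ≺ x → ∃[ y ] x ⊗ y ≃ ⌜ 1ℚ ⌝
    archimedean : ∀ {x} → ⌜ 0ℚ ⌝ ≺ x → ∃[ j ] ⌜ 2^- j ⌝ ≼ x
    dense       : ∀ x j → ∃[ q ] x ≼ ⌜ q ⌝ ⊕ ⌜ 2^- j ⌝ × ⌜ q ⌝ ≼ x ⊕ ⌜ 2^- j ⌝

-- Inequalities and error bounds in an archimedean field

module Theory (K : ArchimedeanField) (em : ExcludedMiddle 0ℓ) where
  open ArchimedeanField K

  private
    0ᶠ 1ᶠ : Carrier
    0ᶠ = ⌜ 0ℚ ⌝
    1ᶠ = ⌜ 1ℚ ⌝

    ⌜⌝-homomorphism : AlmostCommutativeRing.rawRing (fromCommutativeRing ℚ.+-*-commutativeRing)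
                        -Raw-AlmostCommutative⟶ fromCommutativeRing commutativeRing
    ⌜⌝-homomorphism = record
      { ⟦_⟧ = ⌜_⌝ ; +-homo = ⌜⌝-+ ; *-homo = ⌜⌝-* ; -‿homo = ⌜⌝-neg ; 0-homo = ⌜0⌝ ; 1-homo = ⌜1⌝ }

    ⌜⌝-≟ : ∀ p q → Maybe (⌜ p ⌝ ≃ ⌜ q ⌝)
    ⌜⌝-≟ p q with p ℚ.≟ q
    ... | yes refl = just ≃-refl
    ... | no _     = nothing

  open RingSolver
    (AlmostCommutativeRing.rawRing (fromCommutativeRing ℚ.+-*-commutativeRing))
    (fromCommutativeRing commutativeRing)
    ⌜⌝-homomorphism
    ⌜⌝-≟
    using ()
    renaming (solve to solveᶠ; _:+_ to _:⊕_; _:*_ to _:⊗_; _:-_ to _:⊝_; :-_ to :⊖_; _:=_ to _:≃_; con to κ)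

  private variable
    x y z u v a b ε : Carrier

  ≃-reflexive : x ≡ y → x ≃ y
  ≃-reflexive refl = ≃-refl

  ≼-refl : x ≼ x
  ≼-refl = ≼-reflexive ≃-refl

  0≼-resp : 0ᶠ ≼ u → u ≃ v → 0ᶠ ≼ v
  0≼-resp h e = ≼-trans h (≼-reflexive e)

  0≼-difference : x ≼ y → 0ᶠ ≼ y ⊝ x
  0≼-difference {x} {y} h = ≼-trans (≼-reflexive (solveᶠ 1 (λ x → κ 0ℚ :≃ x :⊕ :⊖ x) ≃-refl x)) (⊕-monoˡ-≼ (⊖ x) h)

  -- An inequality is proved by writing the difference of its sides as a sum
  -- of products of nonnegative terms.
  ≼-by : 0ᶠ ≼ u → u ≃ y ⊝ x → x ≼ y
  ≼-by {u} {y} {x} 0≼u e = ≼-trans (≼-reflexive (solveᶠ 1 (λ x → x :≃ κ 0ℚ :⊕ x) ≃-refl x))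
    (≼-trans (⊕-monoˡ-≼ x (0≼-resp 0≼u e)) (≼-reflexive (solveᶠ 2 (λ x y → y :⊝ x :⊕ x :≃ y) ≃-refl x y)))

  0≼-⊕ : 0ᶠ ≼ x → 0ᶠ ≼ y → 0ᶠ ≼ x ⊕ y
  0≼-⊕ {x} {y} 0≼x 0≼y = ≼-trans 0≼y (≼-by 0≼x (solveᶠ 2 (λ x y → x :≃ x :⊕ y :⊝ y) ≃-refl x y))

  0≼½ : 0ᶠ ≼ ⌜ ½ ⌝
  0≼½ = ⌜⌝-mono (ℚ.<⇒≤ (ℚ.positive⁻¹ ½))

  0≼1 : 0ᶠ ≼ 1ᶠ
  0≼1 = ⌜⌝-mono (ℚ.<⇒≤ 0<1)

  ⌜⌝-pos : ∀ {q} → 0ℚ ℚ.< q → 0ᶠ ≺ ⌜ q ⌝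
  ⌜⌝-pos 0<q q≼0 = ℚ.<-irrefl refl (ℚ.<-≤-trans 0<q (⌜⌝-cancel q≼0))

  ≺⇒≼ : x ≺ y → x ≼ y
  ≺⇒≼ {x} {y} x≺y with ≼-total x y
  ... | inj₁ x≼y = x≼y
  ... | inj₂ y≼x = ⊥-elim (x≺y y≼x)

  ≺-≼-trans : x ≺ y → y ≼ z → x ≺ z
  ≺-≼-trans x≺y y≼z z≼x = x≺y (≼-trans y≼z z≼x)

  reciprocal-nonNeg : 0ᶠ ≺ x → ∃[ y ] x ⊗ y ≃ 1ᶠ × 0ᶠ ≼ y
  reciprocal-nonNeg {x} 0≺x with reciprocalᶠ 0≺x
  ... | y , xy≃1 with ≼-total 0ᶠ y
  ...   | inj₁ 0≼y = y , xy≃1 , 0≼y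
  ...   | inj₂ y≼0 = ⊥-elim (⌜⌝-pos 0<1 (≼-by (⊗-nonNeg (≺⇒≼ 0≺x) (0≼-difference y≼0))
    (≃-trans (solveᶠ 2 (λ x y → x :⊗ (κ 0ℚ :⊝ y) :≃ κ 0ℚ :⊝ x :⊗ y) ≃-refl x y) (⊕-cong ≃-refl (⊖-cong xy≃1)))))

  ⊗-pos : 0ᶠ ≺ x → 0ᶠ ≺ y → 0ᶠ ≺ x ⊗ y
  ⊗-pos {x} {y} 0≺x 0≺y xy≼0 with reciprocal-nonNeg 0≺y
  ... | ρ , yρ≃1 , 0≼ρ = 0≺x (≼-by (⊗-nonNeg (0≼-difference xy≼0) 0≼ρ)
    (≃-trans (solveᶠ 3 (λ x y ρ → (κ 0ℚ :⊝ x :⊗ y) :⊗ ρ :≃ κ 0ℚ :⊝ x :⊗ (y :⊗ ρ)) ≃-refl x y ρ)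
      (≃-trans (⊕-cong ≃-refl (⊖-cong (⊗-cong ≃-refl yρ≃1)))
        (solveᶠ 1 (λ x → κ 0ℚ :⊝ x :⊗ κ 1ℚ :≃ κ 0ℚ :⊝ x) ≃-refl x))))

  ≼-limit : (∀ ε → 0ᶠ ≺ ε → x ≼ y ⊕ ε) → x ≼ y
  ≼-limit {x} {y} h with em {x ≼ y}
  ... | yes x≼y = x≼y
  ... | no x⋠y = ≼-by (0≼-⊕ step step) (solveᶠ 2 (λ x y →
      (y :⊕ (x :⊝ y) :⊗ κ ½ :⊝ x) :⊕ (y :⊕ (x :⊝ y) :⊗ κ ½ :⊝ x) :≃ y :⊝ x) ≃-refl x y)
    where
    0≺x-y : 0ᶠ ≺ x ⊝ y
    0≺x-y x-y≼0 = x⋠y (≼-by (0≼-difference x-y≼0) (solveᶠ 2 (λ x y → κ 0ℚ :⊝ (x :⊝ y) :≃ y :⊝ x) ≃-refl x y))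
    step = 0≼-difference (h ((x ⊝ y) ⊗ ⌜ ½ ⌝) (⊗-pos 0≺x-y (⌜⌝-pos (ℚ.positive⁻¹ ½))))

  infix 4 ∣_∣≼_
  -- An absolute value function is avoided: the bound consists of two nonnegative quantities, the
  -- form in which `≼-by` and `0≼-⊕` take their input.
  record ∣_∣≼_ (x e : Carrier) : Set where
    constructor ⟪_,_⟫
    field
      lower : 0ᶠ ≼ e ⊕ x
      upper : 0ᶠ ≼ e ⊝ x
  open ∣_∣≼_ public

  ∣∣-cong : x ≃ y → ∣ x ∣≼ a → ∣ y ∣≼ a
  ∣∣-cong x≃y h = ⟪ 0≼-resp (lower h) (⊕-cong ≃-refl x≃y) , 0≼-resp (upper h) (⊕-cong ≃-refl (⊖-cong x≃y)) ⟫

  ∣∣-mono : a ≼ b → ∣ x ∣≼ a → ∣ x ∣≼ b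
  ∣∣-mono {a} {b} {x} a≼b h =
    ⟪ 0≼-resp (0≼-⊕ (0≼-difference a≼b) (lower h)) (solveᶠ 3 (λ a b x → (b :⊝ a) :⊕ (a :⊕ x) :≃ b :⊕ x) ≃-refl a b x)
    , 0≼-resp (0≼-⊕ (0≼-difference a≼b) (upper h)) (solveᶠ 3 (λ a b x → (b :⊝ a) :⊕ (a :⊝ x) :≃ b :⊝ x) ≃-refl a b x) ⟫

  ∣∣-⊖ : ∣ x ∣≼ a → ∣ ⊖ x ∣≼ a
  ∣∣-⊖ {x} {a} h =
    ⟪ upper h , 0≼-resp (lower h) (solveᶠ 2 (λ a x → a :⊕ x :≃ a :⊝ (:⊖ x)) ≃-refl a x) ⟫

  ∣∣-⊕ : ∣ x ∣≼ a → ∣ y ∣≼ b → ∣ x ⊕ y ∣≼ a ⊕ b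
  ∣∣-⊕ {x} {a} {y} {b} h k =
    ⟪ 0≼-resp (0≼-⊕ (lower h) (lower k)) (solveᶠ 4 (λ a b x y → (a :⊕ x) :⊕ (b :⊕ y) :≃ (a :⊕ b) :⊕ (x :⊕ y)) ≃-refl a b x y)
    , 0≼-resp (0≼-⊕ (upper h) (upper k)) (solveᶠ 4 (λ a b x y → (a :⊝ x) :⊕ (b :⊝ y) :≃ (a :⊕ b) :⊝ (x :⊕ y)) ≃-refl a b x y) ⟫

  -- The right sides of 2 (a b + x y) = (a - x) (b - y) + (a + x) (b + y) and 2 (a b - x y) = (a -
  -- x) (b + y) + (a + x) (b - y) are sums of products of nonnegative factors.
  ∣∣-⊗ : ∣ x ∣≼ a → ∣ y ∣≼ b → ∣ x ⊗ y ∣≼ a ⊗ b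
  ∣∣-⊗ {x} {a} {y} {b} h k =
    ⟪ 0≼-resp (⊗-nonNeg 0≼½ (0≼-⊕ (⊗-nonNeg (upper h) (upper k)) (⊗-nonNeg (lower h) (lower k))))
        (solveᶠ 4 (λ a b x y → κ ½ :⊗ ((a :⊝ x) :⊗ (b :⊝ y) :⊕ (a :⊕ x) :⊗ (b :⊕ y)) :≃ a :⊗ b :⊕ x :⊗ y) ≃-refl a b x y)
    , 0≼-resp (⊗-nonNeg 0≼½ (0≼-⊕ (⊗-nonNeg (upper h) (lower k)) (⊗-nonNeg (lower h) (upper k))))
        (solveᶠ 4 (λ a b x y → κ ½ :⊗ ((a :⊝ x) :⊗ (b :⊕ y) :⊕ (a :⊕ x) :⊗ (b :⊝ y)) :≃ a :⊗ b :⊝ x :⊗ y) ≃-refl a b x y) ⟫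

  nonNeg⇒∣∣ : 0ᶠ ≼ x → x ≼ a → ∣ x ∣≼ a
  nonNeg⇒∣∣ 0≼x x≼a = ⟪ 0≼-⊕ (≼-trans 0≼x x≼a) 0≼x , 0≼-difference x≼a ⟫

  ∣∣-swap : ∣ x ⊝ y ∣≼ a → ∣ y ⊝ x ∣≼ a
  ∣∣-swap {x} {y} h = ∣∣-cong (solveᶠ 2 (λ x y → :⊖ (x :⊝ y) :≃ y :⊝ x) ≃-refl x y) (∣∣-⊖ h)

  ∣∣-triangle : ∣ x ⊝ y ∣≼ a → ∣ y ⊝ z ∣≼ b → ∣ x ⊝ z ∣≼ a ⊕ b
  ∣∣-triangle {x} {y} {z = z} h k =
    ∣∣-cong (solveᶠ 3 (λ x y z → (x :⊝ y) :⊕ (y :⊝ z) :≃ x :⊝ z) ≃-refl x y z) (∣∣-⊕ h k)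

  ⌜∣∣⌝ : ∀ q → ∣ ⌜ q ⌝ ∣≼ ⌜ ∣ q ∣ ⌝
  ⌜∣∣⌝ q with ℚ.≤-total 0ℚ q
  ... | inj₁ 0≤q rewrite ℚ.0≤p⇒∣p∣≡p 0≤q = nonNeg⇒∣∣ (⌜⌝-mono 0≤q) ≼-refl
  ... | inj₂ q≤0 rewrite sym (ℚ.∣-p∣≡∣p∣ q) | ℚ.0≤p⇒∣p∣≡p (ℚ.neg-antimono-≤ q≤0) =
    ∣∣-cong (≃-trans (⊖-cong (⌜⌝-neg q)) (solveᶠ 1 (λ q → :⊖ (:⊖ q) :≃ q) ≃-refl ⌜ q ⌝))
      (∣∣-⊖ (nonNeg⇒∣∣ (⌜⌝-mono (ℚ.neg-antimono-≤ q≤0)) ≼-refl))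

  ∣∣⇒∣⌜⌝∣ : ∀ {q e} → ∣ ⌜ q ⌝ ∣≼ ⌜ e ⌝ → ∣ q ∣ ℚ.≤ e
  ∣∣⇒∣⌜⌝∣ {q} {e} h with ℚ.≤-total 0ℚ q
  ... | inj₁ 0≤q rewrite ℚ.0≤p⇒∣p∣≡p 0≤q = ⌜⌝-cancel (≼-by (upper h) ≃-refl)
  ... | inj₂ q≤0 rewrite sym (ℚ.∣-p∣≡∣p∣ q) | ℚ.0≤p⇒∣p∣≡p (ℚ.neg-antimono-≤ q≤0) =
    ⌜⌝-cancel (≼-by (lower h) (≃-trans (solveᶠ 2 (λ q e → e :⊕ q :≃ e :⊝ (:⊖ q)) ≃-refl ⌜ q ⌝ ⌜ e ⌝)
      (⊕-cong ≃-refl (⊖-cong (≃-sym (⌜⌝-neg q))))))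

  ⌜⌝-difference : ∀ p q → ⌜ p ℚ.- q ⌝ ≃ ⌜ p ⌝ ⊝ ⌜ q ⌝
  ⌜⌝-difference p q = ≃-trans (⌜⌝-+ p (ℚ.- q)) (⊕-cong ≃-refl (⌜⌝-neg q))

  ⌜2^-⌝-suc : ∀ j → ⌜ 2^- suc j ⌝ ⊕ ⌜ 2^- suc j ⌝ ≃ ⌜ 2^- j ⌝
  ⌜2^-⌝-suc j = ≃-trans (≃-sym (⌜⌝-+ (2^- suc j) (2^- suc j))) (≃-reflexive (cong ⌜_⌝ (2^-suc j)))

  0≼⌜2^-⌝ : ∀ j → 0ᶠ ≼ ⌜ 2^- j ⌝
  0≼⌜2^-⌝ j = ⌜⌝-mono (ℚ.<⇒≤ (2^-pos j))

  InUnit : Carrier → Set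
  InUnit x = 0ᶠ ≼ x × x ≼ 1ᶠ

  inUnit-difference : InUnit x → InUnit y → ∣ x ⊝ y ∣≼ 1ᶠ
  inUnit-difference {x} {y} (0≼x , x≼1) (0≼y , y≼1) =
    ⟪ 0≼-resp (0≼-⊕ (0≼-difference y≼1) 0≼x) (solveᶠ 2 (λ x y → (κ 1ℚ :⊝ y) :⊕ x :≃ κ 1ℚ :⊕ (x :⊝ y)) ≃-refl x y)
    , 0≼-resp (0≼-⊕ (0≼-difference x≼1) 0≼y) (solveᶠ 2 (λ x y → (κ 1ℚ :⊝ x) :⊕ y :≃ κ 1ℚ :⊝ (x :⊝ y)) ≃-refl x y) ⟫

  ∣∣-nonNeg : ∣ x ∣≼ a → 0ᶠ ≼ a
  ∣∣-nonNeg {x} {a} h = 0≼-resp (⊗-nonNeg 0≼½ (0≼-⊕ (lower h) (upper h)))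
    (solveᶠ 2 (λ a x → κ ½ :⊗ ((a :⊕ x) :⊕ (a :⊝ x)) :≃ a) ≃-refl a x)

  ½⊗⌜2^-⌝ : ∀ j → ⌜ ½ ⌝ ⊗ ⌜ 2^- j ⌝ ≃ ⌜ 2^- suc j ⌝
  ½⊗⌜2^-⌝ j = ≃-trans (⊗-cong ≃-refl (≃-sym (⌜2^-⌝-suc j)))
    (solveᶠ 1 (λ h → κ ½ :⊗ (h :⊕ h) :≃ h) ≃-refl ⌜ 2^- suc j ⌝)

  ⌜2^-⌝≼1 : ∀ j → ⌜ 2^- j ⌝ ≼ 1ᶠ
  ⌜2^-⌝≼1 zero    = ⌜⌝-mono (ℚ.≤-reflexive 2^-0)
  ⌜2^-⌝≼1 (suc j) = ≼-trans (≼-by (0≼⌜2^-⌝ (suc j)) (≃-trans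
    (solveᶠ 1 (λ h → h :≃ (h :⊕ h) :⊝ h) ≃-refl ⌜ 2^- suc j ⌝) (⊕-cong (⌜2^-⌝-suc j) ≃-refl)))
    (⌜2^-⌝≼1 j)

  4⊗⌜2^-⌝ : ∀ j → ⌜ + 4 ℚ./ 1 ⌝ ⊗ ⌜ 2^- (2 ℕ.+ j) ⌝ ≃ ⌜ 2^- j ⌝
  4⊗⌜2^-⌝ j = ≃-trans
    (solveᶠ 1 (λ h → κ (+ 4 ℚ./ 1) :⊗ h :≃ (h :⊕ h) :⊕ (h :⊕ h)) ≃-refl ⌜ 2^- (2 ℕ.+ j) ⌝)
    (≃-trans (⊕-cong (⌜2^-⌝-suc (suc j)) (⌜2^-⌝-suc (suc j))) (⌜2^-⌝-suc j))

  16⊗⌜2^-⌝ : ∀ j → ⌜ + 16 ℚ./ 1 ⌝ ⊗ ⌜ 2^- (4 ℕ.+ j) ⌝ ≃ ⌜ 2^- j ⌝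
  16⊗⌜2^-⌝ j = ≃-trans
    (solveᶠ 1 (λ h → κ (+ 16 ℚ./ 1) :⊗ h :≃ κ (+ 4 ℚ./ 1) :⊗ (κ (+ 4 ℚ./ 1) :⊗ h)) ≃-refl ⌜ 2^- (4 ℕ.+ j) ⌝)
    (≃-trans (⊗-cong ≃-refl (4⊗⌜2^-⌝ (2 ℕ.+ j))) (4⊗⌜2^-⌝ j))

  2≡1+1 : ⌜ + 2 ℚ./ 1 ⌝ ≃ 1ᶠ ⊕ 1ᶠ
  2≡1+1 = solveᶠ 0 (κ (+ 2 ℚ./ 1) :≃ κ 1ℚ :⊕ κ 1ℚ) ≃-refl

  ⊕-mono : x ≼ y → u ≼ v → x ⊕ u ≼ y ⊕ v
  ⊕-mono {x} {y} {u} {v} h k = ≼-by (0≼-⊕ (0≼-difference h) (0≼-difference k))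
    (solveᶠ 4 (λ x y u v → (y :⊝ x) :⊕ (v :⊝ u) :≃ (y :⊕ v) :⊝ (x :⊕ u)) ≃-refl x y u v)

  -- Attractors of two affine contractions of the unit interval

  module IFS (r d₁ d₂ : Carrier) (0≺r : ⌜ 0ℚ ⌝ ≺ r) (r≼½ : r ≼ ⌜ ½ ⌝)
             (0≼d₁ : ⌜ 0ℚ ⌝ ≼ d₁) (d₁+r≼1 : d₁ ⊕ r ≼ ⌜ 1ℚ ⌝)
             (0≼d₂ : ⌜ 0ℚ ⌝ ≼ d₂) (d₂+r≼1 : d₂ ⊕ r ≼ ⌜ 1ℚ ⌝) where

    φ : Bool → Carrier → Carrier
    φ false x = d₁ ⊕ r ⊗ x
    φ true  x = d₂ ⊕ r ⊗ (1ᶠ ⊝ x)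

    φ-cong : ∀ b → x ≃ y → φ b x ≃ φ b y
    φ-cong false h = ⊕-cong ≃-refl (⊗-cong ≃-refl h)
    φ-cong true  h = ⊕-cong ≃-refl (⊗-cong ≃-refl (⊕-cong ≃-refl (⊖-cong h)))

    inUnit-flip : InUnit x → InUnit (1ᶠ ⊝ x)
    inUnit-flip {x} (0≼x , x≼1) = 0≼-difference x≼1
      , ≼-by 0≼x (solveᶠ 1 (λ x → x :≃ κ 1ℚ :⊝ (κ 1ℚ :⊝ x)) ≃-refl x)

    affine-inUnit : ∀ d → 0ᶠ ≼ d → d ⊕ r ≼ 1ᶠ → InUnit x → InUnit (d ⊕ r ⊗ x)
    affine-inUnit {x} d 0≼d d+r≼1 (0≼x , x≼1) =
      0≼-⊕ 0≼d (⊗-nonNeg (≺⇒≼ 0≺r) 0≼x)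
      , ≼-by (0≼-⊕ (0≼-difference d+r≼1) (⊗-nonNeg (≺⇒≼ 0≺r) (0≼-difference x≼1)))
          (solveᶠ 3 (λ d r x → (κ 1ℚ :⊝ (d :⊕ r)) :⊕ r :⊗ (κ 1ℚ :⊝ x) :≃ κ 1ℚ :⊝ (d :⊕ r :⊗ x)) ≃-refl d r x)

    φ-inUnit : ∀ b → InUnit x → InUnit (φ b x)
    φ-inUnit false = affine-inUnit d₁ 0≼d₁ d₁+r≼1
    φ-inUnit true  = affine-inUnit d₂ 0≼d₂ d₂+r≼1 ∘ inUnit-flip

    ∣r∣≼½ : ∣ r ∣≼ ⌜ ½ ⌝
    ∣r∣≼½ = nonNeg⇒∣∣ (≺⇒≼ 0≺r) r≼½

    φ-contract : ∀ b → ∣ x ⊝ y ∣≼ a → ∣ φ b x ⊝ φ b y ∣≼ ⌜ ½ ⌝ ⊗ a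
    φ-contract {x} {y} false h = ∣∣-cong
      (solveᶠ 4 (λ d r x y → r :⊗ (x :⊝ y) :≃ (d :⊕ r :⊗ x) :⊝ (d :⊕ r :⊗ y)) ≃-refl d₁ r x y)
      (∣∣-⊗ ∣r∣≼½ h)
    φ-contract {x} {y} true h = ∣∣-cong
      (solveᶠ 4 (λ d r x y → r :⊗ (y :⊝ x) :≃ (d :⊕ r :⊗ (κ 1ℚ :⊝ x)) :⊝ (d :⊕ r :⊗ (κ 1ℚ :⊝ y))) ≃-refl d₂ r x y)
      (∣∣-⊗ ∣r∣≼½ (∣∣-swap h))

    r⁻¹ : Carrier
    r⁻¹ = proj₁ (reciprocal-nonNeg 0≺r)

    r⊗r⁻¹≃1 : r ⊗ r⁻¹ ≃ 1ᶠ
    r⊗r⁻¹≃1 = proj₁ (proj₂ (reciprocal-nonNeg 0≺r))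

    cancel-r : ∀ x → (r ⊗ r⁻¹) ⊗ x ≃ x
    cancel-r x = ≃-trans (⊗-cong r⊗r⁻¹≃1 ≃-refl) (solveᶠ 1 (λ x → κ 1ℚ :⊗ x :≃ x) ≃-refl x)

    φ-expand : ∀ b → ∣ φ b x ⊝ φ b y ∣≼ r ⊗ a → ∣ x ⊝ y ∣≼ a
    φ-expand {x} {y} {a} b h = ∣∣-mono (≼-reflexive (≃-trans
        (solveᶠ 3 (λ s r a → s :⊗ (r :⊗ a) :≃ (r :⊗ s) :⊗ a) ≃-refl r⁻¹ r a) (cancel-r a))) (undo b h)
      where
      0≼r⁻¹ = proj₂ (proj₂ (reciprocal-nonNeg 0≺r))
      scaled : ∀ {u} → ∣ u ∣≼ r ⊗ a → ∣ r⁻¹ ⊗ u ∣≼ r⁻¹ ⊗ (r ⊗ a)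
      scaled = ∣∣-⊗ (nonNeg⇒∣∣ 0≼r⁻¹ ≼-refl)
      undo : ∀ b → ∣ φ b x ⊝ φ b y ∣≼ r ⊗ a → ∣ x ⊝ y ∣≼ r⁻¹ ⊗ (r ⊗ a)
      undo false h = ∣∣-cong (≃-trans
        (solveᶠ 5 (λ s d r x y → s :⊗ ((d :⊕ r :⊗ x) :⊝ (d :⊕ r :⊗ y)) :≃ (r :⊗ s) :⊗ (x :⊝ y)) ≃-refl r⁻¹ d₁ r x y)
        (cancel-r (x ⊝ y))) (scaled h)
      undo true h = ∣∣-swap (∣∣-cong (≃-trans
        (solveᶠ 5 (λ s d r x y → s :⊗ ((d :⊕ r :⊗ (κ 1ℚ :⊝ x)) :⊝ (d :⊕ r :⊗ (κ 1ℚ :⊝ y))) :≃ (r :⊗ s) :⊗ (y :⊝ x)) ≃-refl r⁻¹ d₂ r x y)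
        (cancel-r (y ⊝ x))) (scaled h))

    φ-surjective : ∀ b p → ∃[ x ] p ≃ φ b x
    φ-surjective false p = r⁻¹ ⊗ (p ⊝ d₁) , ≃-sym (≃-trans
      (solveᶠ 4 (λ s d r p → d :⊕ r :⊗ (s :⊗ (p :⊝ d)) :≃ d :⊕ (r :⊗ s) :⊗ (p :⊝ d)) ≃-refl r⁻¹ d₁ r p)
      (≃-trans (⊕-cong ≃-refl (cancel-r (p ⊝ d₁))) (solveᶠ 2 (λ d p → d :⊕ (p :⊝ d) :≃ p) ≃-refl d₁ p)))
    φ-surjective true p = 1ᶠ ⊝ r⁻¹ ⊗ (p ⊝ d₂) , ≃-sym (≃-trans
      (solveᶠ 4 (λ s d r p → d :⊕ r :⊗ (κ 1ℚ :⊝ (κ 1ℚ :⊝ s :⊗ (p :⊝ d))) :≃ d :⊕ (r :⊗ s) :⊗ (p :⊝ d)) ≃-refl r⁻¹ d₂ r p)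
      (≃-trans (⊕-cong ≃-refl (cancel-r (p ⊝ d₂))) (solveᶠ 2 (λ d p → d :⊕ (p :⊝ d) :≃ p) ≃-refl d₂ p)))

    -- An address together with all its tails: no limit of a digit sequence ever has to be formed,
    -- and shifting or extending an address is a matter of reindexing.
    record Attractor (p : Carrier) : Set where
      field
        digits : ℕ → Bool
        tails  : ℕ → Carrier
        start  : tails 0 ≃ p
        inUnit : ∀ n → InUnit (tails n)
        step   : ∀ n → tails n ≃ φ (digits n) (tails (suc n))
    open Attractor public

    attractor-inUnit : Attractor x → InUnit x
    attractor-inUnit A = ≼-trans (proj₁ (inUnit A 0)) (≼-reflexive (start A))
                       , ≼-trans (≼-reflexive (≃-sym (start A))) (proj₂ (inUnit A 0))

    attractor-step : Attractor x → ∃[ b ] ∃[ y ] x ≃ φ b y × Attractor y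
    attractor-step A = digits A 0 , tails A 1 , ≃-trans (≃-sym (start A)) (step A 0) , record
      { digits = digits A ∘ suc ; tails = tails A ∘ suc ; start = ≃-refl
      ; inUnit = inUnit A ∘ suc ; step = step A ∘ suc }

    -- The attractor is the greatest such set. Since `next` returns its digit and preimage as data,
    -- iterating it produces an address without a choice principle.
    attractor-coinduction : (P : Carrier → Set) →
      (∀ {x} → P x → InUnit x) → (∀ {x} → P x → ∃[ b ] ∃[ y ] x ≃ φ b y × P y) →
      ∀ {x} → P x → Attractor x
    attractor-coinduction P unit next {x} Px = record
      { digits = λ n → proj₁ (next (proj₂ (orbit n)))
      ; tails  = proj₁ ∘ orbit
      ; start  = ≃-refl
      ; inUnit = λ n → unit (proj₂ (orbit n))
      ; step   = λ n → proj₁ (proj₂ (proj₂ (next (proj₂ (orbit n)))))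
      }
      where
      orbit : ℕ → ∃ P
      orbit zero    = x , Px
      orbit (suc n) = proj₁ (proj₂ (next (proj₂ (orbit n)))) , proj₂ (proj₂ (proj₂ (next (proj₂ (orbit n)))))

    attractor-φ : ∀ b → Attractor x → Attractor (φ b x)
    attractor-φ {x} b A = record
      { digits = λ { zero → b ; (suc n) → digits A n }
      ; tails  = λ { zero → φ b x ; (suc n) → tails A n }
      ; start  = ≃-refl
      ; inUnit = λ { zero → φ-inUnit b (attractor-inUnit A) ; (suc n) → inUnit A n }
      ; step   = λ { zero → φ-cong b (≃-sym (start A)) ; (suc n) → step A n } }

    -- Closedness: the closure of the attractor lies in the union of its images
    -- under the two maps, hence in the attractor by coinduction.

    Adherent : Carrier → Set
    Adherent p = ∀ ε → 0ᶠ ≺ ε → ∃[ x ] Attractor x × ∣ p ⊝ x ∣≼ ε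

    AdherentTo : Bool → Carrier → Set
    AdherentTo b p = ∀ ε → 0ᶠ ≺ ε → ∃[ x ] Attractor x × ∣ p ⊝ φ b x ∣≼ ε

    adherent-inUnit : Adherent x → InUnit x
    adherent-inUnit {p} adh = ≼-limit above , ≼-limit below
      where
      above : ∀ ε → 0ᶠ ≺ ε → 0ᶠ ≼ p ⊕ ε
      above ε 0≺ε with adh ε 0≺ε
      ... | x , A , near = ≼-by (0≼-⊕ (lower near) (proj₁ (attractor-inUnit A)))
        (solveᶠ 3 (λ p x e → (e :⊕ (p :⊝ x)) :⊕ x :≃ (p :⊕ e) :⊝ κ 0ℚ) ≃-refl p x ε)
      below : ∀ ε → 0ᶠ ≺ ε → p ≼ 1ᶠ ⊕ ε
      below ε 0≺ε with adh ε 0≺ε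
      ... | x , A , near = ≼-by (0≼-⊕ (upper near) (0≼-difference (proj₂ (attractor-inUnit A))))
        (solveᶠ 3 (λ p x e → (e :⊝ (p :⊝ x)) :⊕ (κ 1ℚ :⊝ x) :≃ (κ 1ℚ :⊕ e) :⊝ p) ≃-refl p x ε)

    ¬adherentTo : ∀ b {p} → ¬ AdherentTo b p →
      ∃[ ε ] 0ᶠ ≺ ε × (∀ x → Attractor x → ¬ ∣ p ⊝ φ b x ∣≼ ε)
    ¬adherentTo b {p} ¬adh with em {∃[ ε ] 0ᶠ ≺ ε × (∀ x → Attractor x → ¬ ∣ p ⊝ φ b x ∣≼ ε)}
    ... | yes h = h
    ... | no ¬h = ⊥-elim (¬adh adh)
      where
      adh : AdherentTo b p
      adh ε 0≺ε with em {∃[ x ] Attractor x × ∣ p ⊝ φ b x ∣≼ ε}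
      ... | yes k = k
      ... | no ¬k = ⊥-elim (¬h (ε , 0≺ε , λ x A near → ¬k (x , A , near)))

    -- If the first image stays farther than δ from the point, every approximation within δ must
    -- come from the second image; coarser tolerances fall back on δ.
    adherent-split : Adherent x → AdherentTo false x ⊎ AdherentTo true x
    adherent-split {p} adh with em {AdherentTo false p}
    ... | yes h = inj₁ h
    ... | no ¬h with ¬adherentTo false ¬h
    ...   | δ , 0≺δ , far = inj₂ approach
      where
      within : ∀ ε → 0ᶠ ≺ ε → ε ≼ δ → ∃[ x ] Attractor x × ∣ p ⊝ φ true x ∣≼ ε
      within ε 0≺ε ε≼δ with adh ε 0≺ε
      ... | x , A , near with attractor-step A
      ...   | true  , y , x≃φy , B = y , B , ∣∣-cong (⊕-cong ≃-refl (⊖-cong x≃φy)) near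
      ...   | false , y , x≃φy , B =
        ⊥-elim (far y B (∣∣-mono ε≼δ (∣∣-cong (⊕-cong ≃-refl (⊖-cong x≃φy)) near)))
      approach : AdherentTo true p
      approach ε 0≺ε with ≼-total ε δ
      ... | inj₁ ε≼δ = within ε 0≺ε ε≼δ
      ... | inj₂ δ≼ε with within δ 0≺δ ≼-refl
      ...   | x , A , near = x , A , ∣∣-mono δ≼ε near

    adherent-pull : ∀ b → AdherentTo b x → ∃[ y ] x ≃ φ b y × Adherent y
    adherent-pull {p} b adh with φ-surjective b p
    ... | y , p≃φy = y , p≃φy , λ ε 0≺ε →
      -- Undoing φ magnifies distances by 1 / r, so the tolerance r ε is requested in the image.
      let x , A , near = adh (r ⊗ ε) (⊗-pos 0≺r 0≺ε)
      in x , A , φ-expand b (∣∣-cong (⊕-cong p≃φy ≃-refl) near)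

    adherent-step : Adherent x → ∃[ b ] ∃[ y ] x ≃ φ b y × Adherent y
    adherent-step adh with adherent-split adh
    ... | inj₁ h = false , adherent-pull false h
    ... | inj₂ h = true  , adherent-pull true h

    attractor-closed : ∀ p → ¬ Attractor p → ∃[ ε ] 0ᶠ ≺ ε × (∀ x → Attractor x → ¬ ∣ p ⊝ x ∣≼ ε)
    attractor-closed p p∉A with em {∃[ ε ] 0ᶠ ≺ ε × (∀ x → Attractor x → ¬ ∣ p ⊝ x ∣≼ ε)}
    ... | yes h = h
    ... | no ¬h = ⊥-elim (p∉A (attractor-coinduction Adherent adherent-inUnit adherent-step adh))
      where
      adh : Adherent p
      adh ε 0≺ε with em {∃[ x ] Attractor x × ∣ p ⊝ x ∣≼ ε}
      ... | yes k = k
      ... | no ¬k = ⊥-elim (¬h (ε , 0≺ε , λ x A near → ¬k (x , A , near)))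

    attractor-cong : x ≃ y → Attractor x → Attractor y
    attractor-cong x≃y A = record
      { digits = digits A ; tails = tails A ; start = ≃-trans (start A) x≃y
      ; inUnit = inUnit A ; step = step A }

    -- The points with eventually constant digits: images of the fixed point of
    -- φ false under the words in φ false and φ true, a word being read off the
    -- binary digits of k with the least significant digit outermost.

    1-r : Carrier
    1-r = 1ᶠ ⊝ r

    0≺1-r : 0ᶠ ≺ 1-r
    0≺1-r = ≺-≼-trans (⌜⌝-pos (ℚ.positive⁻¹ ½)) (≼-by (0≼-difference r≼½)
      (solveᶠ 1 (λ r → κ ½ :⊝ r :≃ (κ 1ℚ :⊝ r) :⊝ κ ½) ≃-refl r))

    [1-r]⁻¹ : Carrier
    [1-r]⁻¹ = proj₁ (reciprocal-nonNeg 0≺1-r)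

    z₀ : Carrier
    z₀ = d₁ ⊗ [1-r]⁻¹

    z₀-fixed : z₀ ≃ φ false z₀
    z₀-fixed = ≃-trans (solveᶠ 3 (λ d r s → d :⊗ s :≃ d :⊗ ((κ 1ℚ :⊝ r) :⊗ s) :⊕ r :⊗ (d :⊗ s)) ≃-refl d₁ r [1-r]⁻¹)
      (⊕-cong (≃-trans (⊗-cong ≃-refl (proj₁ (proj₂ (reciprocal-nonNeg 0≺1-r))))
        (solveᶠ 1 (λ d → d :⊗ κ 1ℚ :≃ d) ≃-refl d₁)) ≃-refl)

    -- Identifies a rational solution of the fixed point equation with `z₀`, although `z₀` is formed
    -- with a reciprocal taken in the field.
    fixed-unique : x ≃ φ false x → x ≃ z₀
    fixed-unique {x} h = ≃-trans
      (≃-trans (solveᶠ 1 (λ x → x :≃ x :⊗ κ 1ℚ) ≃-refl x)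
        (⊗-cong ≃-refl (≃-sym (proj₁ (proj₂ (reciprocal-nonNeg 0≺1-r))))))
      (≃-trans (solveᶠ 3 (λ x r s → x :⊗ ((κ 1ℚ :⊝ r) :⊗ s) :≃ (x :⊝ r :⊗ x) :⊗ s) ≃-refl x r [1-r]⁻¹)
        (⊗-cong (≃-trans (⊕-cong h ≃-refl) (solveᶠ 3 (λ d r x → (d :⊕ r :⊗ x) :⊝ r :⊗ x :≃ d) ≃-refl d₁ r x)) ≃-refl))

    z₀-inUnit : InUnit z₀
    z₀-inUnit = ⊗-nonNeg 0≼d₁ 0≼s
      , ≼-by (⊗-nonNeg (0≼-difference d₁+r≼1) 0≼s) (≃-trans
          (solveᶠ 3 (λ d r s → (κ 1ℚ :⊝ (d :⊕ r)) :⊗ s :≃ (κ 1ℚ :⊝ r) :⊗ s :⊝ d :⊗ s) ≃-refl d₁ r [1-r]⁻¹)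
          (⊕-cong (proj₁ (proj₂ (reciprocal-nonNeg 0≺1-r))) ≃-refl))
      where 0≼s = proj₂ (proj₂ (reciprocal-nonNeg 0≺1-r))

    z₀-attractor : Attractor z₀
    z₀-attractor = attractor-coinduction (_≃ z₀)
      (λ h → ≼-trans (proj₁ z₀-inUnit) (≼-reflexive (≃-sym h)) , ≼-trans (≼-reflexive h) (proj₂ z₀-inUnit))
      (λ h → false , z₀ , ≃-trans h z₀-fixed , ≃-refl) ≃-refl

    digit : ℕ → Bool
    digit k = toBool (bit k)

    point : ℕ → ℕ → Carrier
    point zero    k = z₀
    point (suc N) k = φ (digit k) (point N (half k))

    point-attractor : ∀ N k → Attractor (point N k)
    point-attractor zero    k = z₀-attractor
    point-attractor (suc N) k = attractor-φ (digit k) (point-attractor N (half k))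

    point-double : ∀ N b k → point (suc N) (double b k) ≡ φ b (point N k)
    point-double N b k = cong₂ (λ c j → φ c (point N j)) (toBool-bit-double b k) (half-double b k)

    -- The index collects the first N digits of the address; the tails behind them differ by at most
    -- 1, and each digit halves the distance. The bound on the index is what makes the distance to
    -- the net a finite minimum.
    attractor-net : Attractor x → ∀ N → ∃[ k ] k ℕ.< 2 ℕ.^ N × ∣ x ⊝ point N k ∣≼ ⌜ 2^- N ⌝
    attractor-net A zero = 0 , ℕ.s≤s ℕ.z≤n
      , ∣∣-mono (⌜⌝-mono (ℚ.≤-reflexive (sym 2^-0))) (inUnit-difference (attractor-inUnit A) z₀-inUnit)
    attractor-net {x} A (suc N) =
      let b , y , x≃φy , B = attractor-step A
          k , k<2^N , near = attractor-net B N
      in double b k , double-< b k<2^N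
      , subst (λ p → ∣ x ⊝ p ∣≼ ⌜ 2^- suc N ⌝) (sym (point-double N b k))
          (∣∣-cong (⊕-cong (≃-sym x≃φy) ≃-refl) (∣∣-mono (≼-reflexive (½⊗⌜2^-⌝ N)) (φ-contract b near)))

    -- Rational approximations of the points, from approximations of the
    -- parameters: an error e in the argument of φ becomes at most 4 δ + e / 2,
    -- which leaves 8 δ + 2⁻ᵐ invariant up to replacing m by m + 1.

    module Approximation
      (r̃ d̃₁ d̃₂ : ℕ → ℚ)
      (r̃-near : ∀ j → ∣ ⌜ r̃ j ⌝ ⊝ r ∣≼ ⌜ 2^- j ⌝)
      (d̃₁-near : ∀ j → ∣ ⌜ d̃₁ j ⌝ ⊝ d₁ ∣≼ ⌜ 2^- j ⌝)
      (d̃₂-near : ∀ j → ∣ ⌜ d̃₂ j ⌝ ⊝ d₂ ∣≼ ⌜ 2^- j ⌝) where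

      φ̃ : ℕ → Bool → ℚ → ℚ
      φ̃ j false x = d̃₁ j ℚ.+ r̃ j ℚ.* x
      φ̃ j true  x = d̃₂ j ℚ.+ r̃ j ℚ.* (1ℚ ℚ.- x)

      z̃ : ℕ → ℕ → ℚ
      z̃ j zero    = 0ℚ
      z̃ j (suc m) = φ̃ j false (z̃ j m)

      fold : (ℕ → ℚ) → ℕ → ℕ → ℕ → ℚ
      fold s j zero    k = s j
      fold s j (suc N) k = φ̃ j (digit k) (fold s j N (half k))

      -- At precision j the fixed point is iterated j times, so that stopping the iteration costs
      -- 2⁻ʲ, no more than the error of one parameter.
      pointʲ : ℕ → ℕ → ℕ → ℚ
      pointʲ = fold (λ j → z̃ j j)

      error : Carrier → Carrier → Carrier
      error δ e = ⌜ + 4 ℚ./ 1 ⌝ ⊗ δ ⊕ ⌜ ½ ⌝ ⊗ e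

      -- The error splits as (d′ - d) + (r′ - r) x′ + r (x′ - x). From e ≤ 2 and x in the unit
      -- interval, x′ is at most 3 in absolute value, which gives δ + 3 δ + e / 2.
      affine-error : ∀ {d d′ r′ x x′ δ e} → ∣ d′ ⊝ d ∣≼ δ → ∣ r′ ⊝ r ∣≼ δ → ∣ x′ ⊝ x ∣≼ e → e ≼ ⌜ + 2 ℚ./ 1 ⌝ →
        InUnit x → ∣ (d′ ⊕ r′ ⊗ x′) ⊝ (d ⊕ r ⊗ x) ∣≼ error δ e
      affine-error {d} {d′} {r′} {x} {x′} {δ} {e} hd hr hx e≼2 (0≼x , x≼1) = ∣∣-cong
        (solveᶠ 6 (λ d d′ r r′ x x′ → (d′ :⊝ d) :⊕ ((r′ :⊝ r) :⊗ x′ :⊕ r :⊗ (x′ :⊝ x)) :≃ (d′ :⊕ r′ :⊗ x′) :⊝ (d :⊕ r :⊗ x))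
          ≃-refl d d′ r r′ x x′)
        (∣∣-mono (≼-reflexive (solveᶠ 2 (λ δ e → δ :⊕ (δ :⊗ κ (+ 3 ℚ./ 1) :⊕ κ ½ :⊗ e) :≃ κ (+ 4 ℚ./ 1) :⊗ δ :⊕ κ ½ :⊗ e) ≃-refl δ e))
          (∣∣-⊕ hd (∣∣-⊕ (∣∣-⊗ hr x′≼3) (∣∣-⊗ ∣r∣≼½ hx))))
        where
        x′≼3 : ∣ x′ ∣≼ ⌜ + 3 ℚ./ 1 ⌝
        x′≼3 = ∣∣-cong (solveᶠ 2 (λ x x′ → (x′ :⊝ x) :⊕ x :≃ x′) ≃-refl x x′)
          (∣∣-mono (≼-by (0≼-difference e≼2) (solveᶠ 1 (λ e → κ (+ 2 ℚ./ 1) :⊝ e :≃ κ (+ 3 ℚ./ 1) :⊝ (e :⊕ κ 1ℚ)) ≃-refl e))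
            (∣∣-⊕ hx (nonNeg⇒∣∣ 0≼x x≼1)))

      φ̃-error : ∀ j b {q e} → ∣ ⌜ q ⌝ ⊝ x ∣≼ e → e ≼ ⌜ + 2 ℚ./ 1 ⌝ → InUnit x →
        ∣ ⌜ φ̃ j b q ⌝ ⊝ φ b x ∣≼ error ⌜ 2^- j ⌝ e
      φ̃-error j false {q} h e≼2 u = ∣∣-cong
        (⊕-cong (≃-sym (≃-trans (⌜⌝-+ (d̃₁ j) (r̃ j ℚ.* q)) (⊕-cong ≃-refl (⌜⌝-* (r̃ j) q)))) ≃-refl)
        (affine-error (d̃₁-near j) (r̃-near j) h e≼2 u)
      φ̃-error {x} j true {q} h e≼2 u = ∣∣-cong
        (⊕-cong (≃-sym (≃-trans (⌜⌝-+ (d̃₂ j) (r̃ j ℚ.* (1ℚ ℚ.- q))) (⊕-cong ≃-refl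
          (≃-trans (⌜⌝-* (r̃ j) (1ℚ ℚ.- q)) (⊗-cong ≃-refl (⌜⌝-difference 1ℚ q)))))) ≃-refl)
        (affine-error (d̃₂-near j) (r̃-near j)
          (∣∣-cong (solveᶠ 2 (λ q x → x :⊝ q :≃ (κ 1ℚ :⊝ q) :⊝ (κ 1ℚ :⊝ x)) ≃-refl ⌜ q ⌝ x) (∣∣-swap h))
          e≼2 (inUnit-flip u))

      module _ (j : ℕ) where
        private
          i : ℕ
          -- 16 δ is 2⁻ʲ, the first power of 2 that leaves room for the final error 9 δ.
          i = 4 ℕ.+ j
          δ : Carrier
          δ = ⌜ 2^- i ⌝

        16δ≼1 : ⌜ + 16 ℚ./ 1 ⌝ ⊗ δ ≼ 1ᶠ
        16δ≼1 = ≼-trans (≼-reflexive (16⊗⌜2^-⌝ j)) (⌜2^-⌝≼1 j)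

        nδ≼16δ : ∀ n m → 0ᶠ ≼ ⌜ m ⌝ → n ℚ.+ m ≡ + 16 ℚ./ 1 → ⌜ n ⌝ ⊗ δ ≼ ⌜ + 16 ℚ./ 1 ⌝ ⊗ δ
        nδ≼16δ n m 0≼m n+m≡16 = ≼-by (⊗-nonNeg 0≼m (0≼⌜2^-⌝ i)) (≃-sym (≃-trans
          (⊕-cong (⊗-cong (≃-trans (≃-reflexive (cong ⌜_⌝ (sym n+m≡16))) (⌜⌝-+ n m)) ≃-refl) ≃-refl)
          (solveᶠ 3 (λ n m δ → (n :⊕ m) :⊗ δ :⊝ n :⊗ δ :≃ m :⊗ δ) ≃-refl ⌜ n ⌝ ⌜ m ⌝ δ)))

        8δ≼16δ = nδ≼16δ (+ 8 ℚ./ 1) (+ 8 ℚ./ 1) (⌜⌝-mono (ℚ.<⇒≤ (ℚ.positive⁻¹ (+ 8 ℚ./ 1)))) refl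
        9δ≼16δ = nδ≼16δ (+ 9 ℚ./ 1) (+ 7 ℚ./ 1) (⌜⌝-mono (ℚ.<⇒≤ (ℚ.positive⁻¹ (+ 7 ℚ./ 1)))) refl

        z̃-error : ∀ m → ∣ ⌜ z̃ i m ⌝ ⊝ z₀ ∣≼ ⌜ + 8 ℚ./ 1 ⌝ ⊗ δ ⊕ ⌜ 2^- m ⌝
        z̃-error zero = ∣∣-mono (≼-by (⊗-nonNeg (⌜⌝-mono (ℚ.<⇒≤ (ℚ.positive⁻¹ (+ 8 ℚ./ 1)))) (0≼⌜2^-⌝ i)) (≃-trans
            (solveᶠ 1 (λ δ → κ (+ 8 ℚ./ 1) :⊗ δ :≃ (κ (+ 8 ℚ./ 1) :⊗ δ :⊕ κ 1ℚ) :⊝ κ 1ℚ) ≃-refl δ) ≃-refl))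
          (inUnit-difference (≼-refl , 0≼1) z₀-inUnit)
        z̃-error (suc m) = ∣∣-cong (⊕-cong ≃-refl (⊖-cong (≃-sym z₀-fixed))) (∣∣-mono
          (≼-reflexive (≃-trans
            (solveᶠ 2 (λ δ h → κ (+ 4 ℚ./ 1) :⊗ δ :⊕ κ ½ :⊗ (κ (+ 8 ℚ./ 1) :⊗ δ :⊕ h) :≃ κ (+ 8 ℚ./ 1) :⊗ δ :⊕ κ ½ :⊗ h)
              ≃-refl δ ⌜ 2^- m ⌝)
            (⊕-cong ≃-refl (½⊗⌜2^-⌝ m))))
          (φ̃-error i false (z̃-error m) (≼-trans (⊕-mono (≼-trans 8δ≼16δ 16δ≼1) (⌜2^-⌝≼1 m)) (≼-reflexive (≃-sym 2≡1+1)))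
            z₀-inUnit))

        -- The start has error 8 δ + 2⁻ⁱ = 9 δ, and one more map gives 4 δ + 9 δ / 2 ≤ 9 δ: the
        -- error does not grow with the length of the word.
        pointʲ-9δ : ∀ N k → ∣ ⌜ pointʲ i N k ⌝ ⊝ point N k ∣≼ ⌜ + 9 ℚ./ 1 ⌝ ⊗ δ
        pointʲ-9δ zero k = ∣∣-mono (≼-reflexive
          (solveᶠ 1 (λ δ → κ (+ 8 ℚ./ 1) :⊗ δ :⊕ δ :≃ κ (+ 9 ℚ./ 1) :⊗ δ) ≃-refl δ)) (z̃-error i)
        pointʲ-9δ (suc N) k = ∣∣-mono (≼-by (⊗-nonNeg 0≼½ (0≼⌜2^-⌝ i))
            (solveᶠ 1 (λ δ → κ ½ :⊗ δ :≃ κ (+ 9 ℚ./ 1) :⊗ δ :⊝ (κ (+ 4 ℚ./ 1) :⊗ δ :⊕ κ ½ :⊗ (κ (+ 9 ℚ./ 1) :⊗ δ))) ≃-refl δ))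
          (φ̃-error i (digit k) (pointʲ-9δ N (half k))
            (≼-trans (≼-trans 9δ≼16δ 16δ≼1) (⌜⌝-mono {1ℚ} {+ 2 ℚ./ 1} (ℚ.*≤* (ℤ.+≤+ (ℕ.s≤s ℕ.z≤n)))))
            (attractor-inUnit (point-attractor N (half k))))

        pointʲ-error : ∀ N k → ∣ ⌜ pointʲ i N k ⌝ ⊝ point N k ∣≼ ⌜ 2^- j ⌝
        pointʲ-error N k = ∣∣-mono (≼-trans 9δ≼16δ (≼-reflexive (16⊗⌜2^-⌝ j))) (pointʲ-9δ N k)

      gap-to : ℕ → ℚ → ℕ → ℚ
      gap-to n q k = ∣ q ℚ.- pointʲ (4 ℕ.+ n) n k ∣

      -- The range includes 2ⁿ itself; that index also names a point of the attractor, so the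
      -- minimum is still taken over approximations of such points.
      distance : ℕ → ℚ → ℚ
      distance n q = minimum (gap-to n q) (2 ℕ.^ n)

      -- One 2⁻ⁿ pays for passing from the point to the net, the other for the rational
      -- approximation of the net.
      distance-sound : ∀ n q {ρ} → Attractor x → ∣ x ⊝ ⌜ q ⌝ ∣≼ ⌜ ρ ⌝ →
        distance n q ℚ.≤ ρ ℚ.+ 2^- n ℚ.+ 2^- n
      distance-sound {x} n q {ρ} A near = let k , k<2^n , x~point = attractor-net A n in ℚ.≤-trans {distance n q} {gap-to n q k} (minimum-≤ (gap-to n q) (ℕ.<⇒≤ k<2^n)) (∣∣⇒∣⌜⌝∣
        (∣∣-cong (≃-sym (⌜⌝-difference q (pointʲ (4 ℕ.+ n) n k)))
          (∣∣-mono (≼-reflexive (≃-sym (≃-trans (⌜⌝-+ (ρ ℚ.+ 2^- n) (2^- n)) (⊕-cong (⌜⌝-+ ρ (2^- n)) ≃-refl))))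
            (∣∣-triangle (∣∣-triangle (∣∣-swap near) x~point) (∣∣-swap (pointʲ-error n n k))))))

      -- A smaller value would be attained at some net point and bring it closer to p than the
      -- separation from the attractor allows. One 2⁻ⁿ pays for replacing p by q, the other for the
      -- approximation of the net point.
      distance-complete : ∀ p → ¬ Attractor p → ∃[ m ] ∀ n q → ∣ p ⊝ ⌜ q ⌝ ∣≼ ⌜ 2^- n ⌝ →
        2^- m ℚ.≤ distance n q ℚ.+ 2^- n ℚ.+ 2^- n
      distance-complete p p∉A = m , λ n q near → ℚ.≮⇒≥ λ small →
        let k , attained = minimum-attained (gap-to n q) (2 ℕ.^ n)
        in far (point n k) (point-attractor n k) (too-near n q k near attained small)
        where
        δ : Carrier
        δ = proj₁ (attractor-closed p p∉A)
        0≺δ : 0ᶠ ≺ δ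
        0≺δ = proj₁ (proj₂ (attractor-closed p p∉A))
        far : ∀ x → Attractor x → ¬ ∣ p ⊝ x ∣≼ δ
        far = proj₂ (proj₂ (attractor-closed p p∉A))
        m : ℕ
        m = proj₁ (archimedean 0≺δ)
        too-near : ∀ n q k → ∣ p ⊝ ⌜ q ⌝ ∣≼ ⌜ 2^- n ⌝ → distance n q ≡ gap-to n q k →
          distance n q ℚ.+ 2^- n ℚ.+ 2^- n ℚ.< 2^- m → ∣ p ⊝ point n k ∣≼ δ
        too-near n q k near attained small = ∣∣-mono
          (≼-trans (≼-reflexive (≃-sym (≃-trans
              (⌜⌝-+ (distance n q ℚ.+ 2^- n) (2^- n)) (⊕-cong (⌜⌝-+ (distance n q) (2^- n)) ≃-refl))))
            (≼-trans (⌜⌝-mono (ℚ.<⇒≤ small)) (proj₂ (archimedean 0≺δ))))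
          (∣∣-mono (≼-reflexive (solveᶠ 2 (λ h d → h :⊕ (d :⊕ h) :≃ (d :⊕ h) :⊕ h) ≃-refl ⌜ 2^- n ⌝ ⌜ distance n q ⌝))
            (∣∣-triangle near (∣∣-triangle q~point (pointʲ-error n n k))))
          where
          q~point : ∣ ⌜ q ⌝ ⊝ ⌜ pointʲ (4 ℕ.+ n) n k ⌝ ∣≼ ⌜ distance n q ⌝
          q~point = subst (λ d → ∣ ⌜ q ⌝ ⊝ ⌜ pointʲ (4 ℕ.+ n) n k ⌝ ∣≼ ⌜ d ⌝) (sym attained)
            (∣∣-cong (⌜⌝-difference q (pointʲ (4 ℕ.+ n) n k)) (⌜∣∣⌝ (q ℚ.- pointʲ (4 ℕ.+ n) n k)))

      -- With exact parameters at index 0 the fixed point d / (1 - r) is rational; the division is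
      -- possible since r ≤ ½.
      exact-start : ⌜ r̃ 0 ⌝ ≃ r → ⌜ d̃₁ 0 ⌝ ≃ d₁ → ∃[ s ] ⌜ s ⌝ ≃ z₀
      exact-start hr hd = s , fixed-unique (≃-trans (≃-reflexive (cong ⌜_⌝ s≡d+rs))
        (≃-trans (⌜⌝-+ d′ (r′ ℚ.* s)) (⊕-cong hd (≃-trans (⌜⌝-* r′ s) (⊗-cong hr ≃-refl)))))
        where
        r′ d′ : ℚ
        r′ = r̃ 0
        d′ = d̃₁ 0
        0<1-r : 0ℚ ℚ.< 1ℚ ℚ.- r′
        0<1-r = ℚ.<-≤-trans (ℚ.positive⁻¹ ½)
          (ℚ.+-monoʳ-≤ 1ℚ (ℚ.neg-antimono-≤ (⌜⌝-cancel (≼-trans (≼-reflexive hr) r≼½))))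
        c s : ℚ
        c = proj₁ (inverse (1ℚ ℚ.- r′) 0<1-r)
        s = d′ ℚ.* c
        s≡d+rs : s ≡ d′ ℚ.+ r′ ℚ.* s
        s≡d+rs = begin
          d′ ℚ.* c
            ≡⟨ solve 4 (λ d c r o → d :* c := d :* ((o :- r) :* c) :+ (r :* (d :* c) :+ (d :* c :- o :* (d :* c)))) refl d′ c r′ 1ℚ ⟩
          d′ ℚ.* ((1ℚ ℚ.- r′) ℚ.* c) ℚ.+ (r′ ℚ.* s ℚ.+ (s ℚ.- 1ℚ ℚ.* s))
            ≡⟨ cong₂ (λ p q → d′ ℚ.* p ℚ.+ (r′ ℚ.* s ℚ.+ (s ℚ.- q))) (proj₂ (proj₂ (inverse (1ℚ ℚ.- r′) 0<1-r))) (ℚ.*-identityˡ s) ⟩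
          d′ ℚ.* 1ℚ ℚ.+ (r′ ℚ.* s ℚ.+ (s ℚ.- s))
            ≡⟨ cong₂ (λ p q → p ℚ.+ (r′ ℚ.* s ℚ.+ q)) (ℚ.*-identityʳ d′) (ℚ.+-inverseʳ s) ⟩
          d′ ℚ.+ (r′ ℚ.* s ℚ.+ 0ℚ)
            ≡⟨ cong (d′ ℚ.+_) (ℚ.+-identityʳ (r′ ℚ.* s)) ⟩
          d′ ℚ.+ r′ ℚ.* s ∎
          where open ≡-Reasoning

      fold-exact : ⌜ r̃ 0 ⌝ ≃ r → ⌜ d̃₁ 0 ⌝ ≃ d₁ → ⌜ d̃₂ 0 ⌝ ≃ d₂ → ∀ s → ⌜ s 0 ⌝ ≃ z₀ →
        ∀ N k → ⌜ fold s 0 N k ⌝ ≃ point N k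
      fold-exact hr h₁ h₂ s hs zero k = hs
      fold-exact hr h₁ h₂ s hs (suc N) k = φ̃-exact (digit k) (fold-exact hr h₁ h₂ s hs N (half k))
        where
        φ̃-exact : ∀ b {q} → ⌜ q ⌝ ≃ x → ⌜ φ̃ 0 b q ⌝ ≃ φ b x
        φ̃-exact false {q} h = ≃-trans (⌜⌝-+ (d̃₁ 0) (r̃ 0 ℚ.* q))
          (⊕-cong h₁ (≃-trans (⌜⌝-* (r̃ 0) q) (⊗-cong hr h)))
        φ̃-exact true {q} h = ≃-trans (⌜⌝-+ (d̃₂ 0) (r̃ 0 ℚ.* (1ℚ ℚ.- q)))
          (⊕-cong h₂ (≃-trans (⌜⌝-* (r̃ 0) (1ℚ ℚ.- q)) (⊗-cong hr (≃-trans (⌜⌝-difference 1ℚ q) (⊕-cong ≃-refl (⊖-cong h))))))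

      module Computability
        (r̃-fractional : Fractional {1} (r̃ ∘ head))
        (d̃₁-fractional : Fractional {1} (d̃₁ ∘ head))
        (d̃₂-fractional : Fractional {1} (d̃₂ ∘ head)) where

        φ̃-fractional : ∀ {n} {j b : Vec ℕ n → ℕ} {q : Vec ℕ n → ℚ} → Computable j → Computable b → Fractional q →
          Fractional (λ xs → φ̃ (j xs) (toBool (b xs)) (q xs))
        φ̃-fractional {j = j} {b} {q} cj cb fq = fractional-cong (λ xs → if-φ̃ (j xs) (q xs) (toBool (b xs)))
          (fractional-if cb
            (at d̃₂ d̃₂-fractional cj +ᶠ at r̃ r̃-fractional cj *ᶠ (fractional-const 1ℚ -ᶠ fq))
            (at d̃₁ d̃₁-fractional cj +ᶠ at r̃ r̃-fractional cj *ᶠ fq))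
          where
          if-φ̃ : ∀ j q b → (if b then φ̃ j true q else φ̃ j false q) ≡ φ̃ j b q
          if-φ̃ j q true  = refl
          if-φ̃ j q false = refl

        z̃-fractional : Fractional {2} (λ xs → z̃ (lookup xs #1) (lookup xs #0))
        z̃-fractional = fractional-rec {h = λ _ q xs → φ̃ (lookup xs #0) false q}
          (fractional-const 0ℚ)
          (fractional-cong (λ { (_ ∷ _ ∷ _ ∷ []) → refl })
            (φ̃-fractional (computable-lookup #2) (computable-const 0) (fractional-decode (computable-lookup #1))))
          (λ _ → refl) (λ _ _ → refl)

        -- fold peels off the digits of k starting with the outermost map; a
        -- primitive recursion has to start with the innermost one.
        module _ (s : ℕ → ℚ) (s-fractional : Fractional {1} (s ∘ head)) where
          inner : ℕ → ℕ → ℕ → ℕ → ℚ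
          inner zero    N k j = s j
          -- The innermost map carries digit number N - 1, so stage t + 1 applies digit number N -
          -- (t + 1).
          inner (suc t) N k j = φ̃ j (digit (shift (N ℕ.∸ suc t) k)) (inner t N k j)

          inner-fractional : Fractional {4} (λ xs → inner (lookup xs #0) (lookup xs #1) (lookup xs #2) (lookup xs #3))
          inner-fractional = fractional-rec
            {h = λ t q xs → φ̃ (lookup xs #2) (digit (shift (lookup xs #0 ℕ.∸ suc t) (lookup xs #1))) q}
            (at s s-fractional (computable-lookup #2))
            (fractional-cong (λ { (_ ∷ _ ∷ _ ∷ _ ∷ _ ∷ []) → refl })
              (φ̃-fractional (computable-lookup #4)
                (computable-∘₁ bit computable-bit (computable-∘₂ shift computable-shift
                  (computable-lookup #2 ∸ᶜ computable-suc (computable-lookup #0)) (computable-lookup #3)))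
                (fractional-decode (computable-lookup #1))))
            (λ _ → refl) (λ _ _ → refl)

          inner≡fold : ∀ N k j t → t ℕ.≤ N → inner t N k j ≡ fold s j t (shift (N ℕ.∸ t) k)
          inner≡fold N k j zero    _   = refl
          inner≡fold N k j (suc t) t<N = cong (φ̃ j (digit (shift (N ℕ.∸ suc t) k)))
            (trans (inner≡fold N k j t (ℕ.<⇒≤ t<N))
              (cong (λ i → fold s j t (shift i k)) (ℕ.+-∸-assoc 1 {N} {suc t} t<N)))

          fold-fractional : ∀ {n} {j N k : Vec ℕ n → ℕ} → Computable j → Computable N → Computable k →
            Fractional (λ xs → fold s (j xs) (N xs) (k xs))
          fold-fractional {j = j} {N} {k} cj cN ck = fractional-cong
            (λ xs → trans (inner≡fold (N xs) (k xs) (j xs) (N xs) ℕ.≤-refl)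
              (cong (λ i → fold s (j xs) (N xs) (shift i (k xs))) (ℕ.n∸n≡0 (N xs))))
            (fractional-∘ {fs = N ∷ N ∷ k ∷ j ∷ []} inner-fractional (cN ∷ cN ∷ ck ∷ cj ∷ []))

        pointʲ-fractional : ∀ {n} {j N k : Vec ℕ n → ℕ} → Computable j → Computable N → Computable k →
          Fractional (λ xs → pointʲ (j xs) (N xs) (k xs))
        pointʲ-fractional = fold-fractional (λ j → z̃ j j)
          (fractional-∘ {fs = head ∷ head ∷ []} z̃-fractional (computable-head ∷ computable-head ∷ []))

        distance-fractional : ∀ {n} {i e : Vec ℕ n → ℕ} → Computable i → Computable e →
          Fractional (λ xs → distance (i xs) (decode (e xs)))
        distance-fractional {i = i} {e} ci ce = fractional-∘ {fs = (2 ℕ.^_) ∘ i ∷ i ∷ e ∷ []} minimum-fractional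
          (computable-∘₁ (2 ℕ.^_) computable-2^ ci ∷ ci ∷ ce ∷ [])
          where
          gap-fractional : ∀ {n} {i e k : Vec ℕ n → ℕ} → Computable i → Computable e → Computable k →
            Fractional (λ xs → gap-to (i xs) (decode (e xs)) (k xs))
          gap-fractional ci ce ck =
            ∣ fractional-decode ce -ᶠ pointʲ-fractional (computable-const 4 +ᶜ ci) ci ck ∣ᶠ
          minimum-fractional : Fractional {3} (λ xs → minimum (gap-to (lookup xs #1) (decode (lookup xs #2))) (lookup xs #0))
          minimum-fractional = fractional-rec
            {h = λ k q xs → q ℚ.⊓ gap-to (lookup xs #0) (decode (lookup xs #1)) (suc k)}
            (gap-fractional (computable-lookup #0) (computable-lookup #1) (computable-const 0))
            (fractional-cong (λ { (_ ∷ _ ∷ _ ∷ _ ∷ []) → refl })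
              (fractional-decode (computable-lookup #1) ⊓ᶠ
                gap-fractional (computable-lookup #2) (computable-lookup #3) (computable-suc (computable-lookup #0))))
            (λ _ → refl) (λ _ _ → refl)

  -- Balls and products in the plane

  -- If x > a ≥ 0, both factors of x² - a² = (x - a) (x + a) are positive.
  square-cancel : x ⊗ x ≼ a ⊗ a → 0ᶠ ≼ a → x ≼ a
  square-cancel {x} {a} h 0≼a with em {x ≼ a}
  ... | yes x≼a = x≼a
  ... | no x⋠a = ⊥-elim (⊗-pos 0≺x-a (≺-≼-trans 0≺x-a (≼-by (0≼-⊕ 0≼a 0≼a)
      (solveᶠ 2 (λ x a → a :⊕ a :≃ (x :⊕ a) :⊝ (x :⊝ a)) ≃-refl x a)))
      (≼-by (0≼-difference h) (solveᶠ 2 (λ x a → a :⊗ a :⊝ x :⊗ x :≃ κ 0ℚ :⊝ (x :⊝ a) :⊗ (x :⊕ a)) ≃-refl x a)))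
    where
    0≺x-a : 0ᶠ ≺ x ⊝ a
    0≺x-a x-a≼0 = x⋠a (≼-by (0≼-difference x-a≼0) (solveᶠ 2 (λ x a → κ 0ℚ :⊝ (x :⊝ a) :≃ a :⊝ x) ≃-refl x a))

  0≼-square : ∀ x → 0ᶠ ≼ x ⊗ x
  0≼-square x with ≼-total 0ᶠ x
  ... | inj₁ 0≼x = ⊗-nonNeg 0≼x 0≼x
  ... | inj₂ x≼0 = 0≼-resp (⊗-nonNeg (0≼-difference x≼0) (0≼-difference x≼0))
    (solveᶠ 1 (λ x → (κ 0ℚ :⊝ x) :⊗ (κ 0ℚ :⊝ x) :≃ x :⊗ x) ≃-refl x)

  norm² : Carrier → Carrier → Carrier
  norm² x y = x ⊗ x ⊕ y ⊗ y

  norm²⇒∣∣ˡ : norm² x y ≼ a ⊗ a → 0ᶠ ≼ a → ∣ x ∣≼ a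
  norm²⇒∣∣ˡ {x} {y} {a} h 0≼a =
    ⟪ 0≼-resp (0≼-difference (square-cancel { ⊖ x} (≼-trans (≼-reflexive (solveᶠ 1 (λ x → (:⊖ x) :⊗ (:⊖ x) :≃ x :⊗ x) ≃-refl x)) x²≼a²) 0≼a))
        (solveᶠ 2 (λ x a → a :⊝ (:⊖ x) :≃ a :⊕ x) ≃-refl x a)
    , 0≼-difference (square-cancel x²≼a² 0≼a) ⟫
    where
    x²≼a² : x ⊗ x ≼ a ⊗ a
    x²≼a² = ≼-trans (≼-by (0≼-square y) (solveᶠ 2 (λ x y → y :⊗ y :≃ (x :⊗ x :⊕ y :⊗ y) :⊝ x :⊗ x) ≃-refl x y)) h

  norm²⇒∣∣ʳ : norm² x y ≼ a ⊗ a → 0ᶠ ≼ a → ∣ y ∣≼ a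
  norm²⇒∣∣ʳ {x} {y} h = norm²⇒∣∣ˡ {y} {x} (≼-trans (≼-reflexive
    (solveᶠ 2 (λ x y → y :⊗ y :⊕ x :⊗ x :≃ x :⊗ x :⊕ y :⊗ y) ≃-refl x y)) h)

  -- The strict room comes from 2 ε² < 4 ε² ≤ a². If the conclusion failed, the listed nonnegative
  -- terms would add up to -2 ε².
  ∣∣⇒norm² : ∣ x ∣≼ ε → ∣ y ∣≼ ε → 0ᶠ ≺ ε → ε ⊕ ε ≼ a → norm² x y ≺ a ⊗ a
  ∣∣⇒norm² {x} {ε} {y} {a} hx hy 0≺ε 2ε≼a a²≼ = ⊗-pos 0≺ε 0≺ε (≼-by
    (⊗-nonNeg 0≼½ (0≼-⊕ (0≼-difference a²≼) (0≼-⊕ (0≼-⊕ (upper (∣∣-⊗ hx hx)) (upper (∣∣-⊗ hy hy)))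
      (0≼-⊕ (⊗-nonNeg (0≼-difference 2ε≼a) 0≼a) (⊗-nonNeg (0≼-difference 2ε≼a) (0≼-⊕ 0≼ε 0≼ε))))))
    (solveᶠ 4 (λ x y e a → κ ½ :⊗ ((x :⊗ x :⊕ y :⊗ y :⊝ a :⊗ a) :⊕ (((e :⊗ e :⊝ x :⊗ x) :⊕ (e :⊗ e :⊝ y :⊗ y))
        :⊕ ((a :⊝ (e :⊕ e)) :⊗ a :⊕ (a :⊝ (e :⊕ e)) :⊗ (e :⊕ e)))) :≃ κ 0ℚ :⊝ e :⊗ e) ≃-refl x y ε a))
    where
    0≼ε = ≺⇒≼ 0≺ε
    0≼a = ≼-trans (0≼-⊕ 0≼ε 0≼ε) 2ε≼a

  -- The radius gives up three times h while soundness accounts for two; the third is the strict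
  -- margin behind the contradiction.
  radius-small : ∀ {m R h} → 0ℚ ℚ.< h → R ≡ m ℚ.- (h ℚ.+ h ℚ.+ h) → m ℚ.≤ R ℚ.+ h ℚ.+ h → ⊥
  radius-small {m} {R} {h} 0<h R≡ m≤ = ℚ.<-irrefl refl (begin-strict
    m                                    ≤⟨ m≤ ⟩
    R ℚ.+ h ℚ.+ h                        <⟨ p<p+ε (R ℚ.+ h ℚ.+ h) 0<h ⟩
    R ℚ.+ h ℚ.+ h ℚ.+ h                  ≡⟨ cong (λ p → p ℚ.+ h ℚ.+ h ℚ.+ h) R≡ ⟩
    m ℚ.- (h ℚ.+ h ℚ.+ h) ℚ.+ h ℚ.+ h ℚ.+ h ≡⟨ solve 2 (λ m h → m :- (h :+ h :+ h) :+ h :+ h :+ h := m) refl m h ⟩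
    m ∎)
    where
    open ℚ.≤-Reasoning

  -- All that the product needs to know of a factor. The distance itself, an infimum, is never
  -- formed: `sound` keeps the rational bound below it up to an error, and `complete` keeps the
  -- bound away from 0 near each point outside.
  record DistanceBound (A : Carrier → Set) : Set where
    field
      bound    : ℕ → ℚ → ℚ
      sound    : ∀ n q {x ρ} → A x → ∣ x ⊝ ⌜ q ⌝ ∣≼ ⌜ ρ ⌝ → bound n q ℚ.≤ ρ ℚ.+ 2^- n ℚ.+ 2^- n
      complete : ∀ p → ¬ A p → ∃[ m ] ∀ n q → ∣ p ⊝ ⌜ q ⌝ ∣≼ ⌜ 2^- n ⌝ →
                 2^- m ℚ.≤ bound n q ℚ.+ 2^- n ℚ.+ 2^- n
      separated : ∀ p → ¬ A p → ∃[ ε ] 0ᶠ ≺ ε × (∀ x → A x → ¬ ∣ p ⊝ x ∣≼ ε)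
  open DistanceBound

  module Product {A B : Carrier → Set} (DA : DistanceBound A) (DB : DistanceBound B) where

    -- A disc lies in the square around it, so it misses the product as soon as one of its
    -- projections misses a factor. The maximum selects such a factor without deciding which one it
    -- is.
    radius : ℕ → ℚ → ℚ → ℚ
    radius n p q = bound DA n p ℚ.⊔ bound DB n q ℚ.- (2^- n ℚ.+ 2^- n ℚ.+ 2^- n)

    ball-disjoint : ∀ n p q → A x → B y → 0ᶠ ≼ ⌜ radius n p q ⌝ →
      ¬ norm² (x ⊝ ⌜ p ⌝) (y ⊝ ⌜ q ⌝) ≼ ⌜ radius n p q ⌝ ⊗ ⌜ radius n p q ⌝
    ball-disjoint {x} {y} n p q Ax By 0≼R h = cases (ℚ.⊔-sel (bound DA n p) (bound DB n q))
      where
      3h : ℚ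
      3h = 2^- n ℚ.+ 2^- n ℚ.+ 2^- n
      cases : bound DA n p ℚ.⊔ bound DB n q ≡ bound DA n p ⊎ bound DA n p ℚ.⊔ bound DB n q ≡ bound DB n q → ⊥
      cases (inj₁ e) = radius-small {bound DA n p} {radius n p q} {2^- n} (2^-pos n) (cong (ℚ._- 3h) e)
        (sound DA n p {x} {radius n p q} Ax (norm²⇒∣∣ˡ h 0≼R))
      cases (inj₂ e) = radius-small {bound DB n q} {radius n p q} {2^- n} (2^-pos n) (cong (ℚ._- 3h) e)
        (sound DB n q {y} {radius n p q} By (norm²⇒∣∣ʳ h 0≼R))

    enlarge : ∀ {p q r} h → r ℚ.≤ p ℚ.+ h ℚ.+ h → p ℚ.≤ q → r ℚ.≤ q ℚ.+ h ℚ.+ h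
    enlarge h r≤ p≤q = ℚ.≤-trans r≤ (ℚ.+-monoˡ-≤ h (ℚ.+-monoˡ-≤ h p≤q))

    -- As 2⁻ᵐ is 16 h, the hypothesis reads M ≥ 14 h, and M - 3 h exceeds 2 h by at least 9 h. A
    -- radius of 2 h is what a centre within h in each coordinate requires.
    radius-large : ∀ m {M} → let h = 2^- (4 ℕ.+ m) in 2^- m ℚ.≤ M ℚ.+ h ℚ.+ h →
      ⌜ h ⌝ ⊕ ⌜ h ⌝ ≼ ⌜ M ℚ.- (h ℚ.+ h ℚ.+ h) ⌝
    radius-large m {M} 2^-m≤ = ≼-by
      (0≼-⊕ (0≼-difference (≼-trans (≼-reflexive (16⊗⌜2^-⌝ m)) (≼-trans (⌜⌝-mono 2^-m≤) (≼-reflexive sum))))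
        (⊗-nonNeg (⌜⌝-mono (ℚ.<⇒≤ (ℚ.positive⁻¹ (+ 9 ℚ./ 1)))) (0≼⌜2^-⌝ (4 ℕ.+ m))))
      (≃-trans
        (solveᶠ 2 (λ M h → (M :⊕ h :⊕ h :⊝ κ (+ 16 ℚ./ 1) :⊗ h) :⊕ κ (+ 9 ℚ./ 1) :⊗ h :≃ (M :⊝ (h :⊕ h :⊕ h)) :⊝ (h :⊕ h))
          ≃-refl ⌜ M ⌝ ⌜ h ⌝)
        (⊕-cong (≃-sym (≃-trans (⌜⌝-difference M (h ℚ.+ h ℚ.+ h)) (⊕-cong ≃-refl (⊖-cong
          (≃-trans (⌜⌝-+ (h ℚ.+ h) h) (⊕-cong (⌜⌝-+ h h) ≃-refl)))))) ≃-refl))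
      where
      h : ℚ
      h = 2^- (4 ℕ.+ m)
      sum : ⌜ M ℚ.+ h ℚ.+ h ⌝ ≃ ⌜ M ⌝ ⊕ ⌜ h ⌝ ⊕ ⌜ h ⌝
      sum = ≃-trans (⌜⌝-+ (M ℚ.+ h) h) (⊕-cong (⌜⌝-+ M h) ≃-refl)

    dense-∣∣ : ∀ x n → ∃[ q ] ∣ x ⊝ ⌜ q ⌝ ∣≼ ⌜ 2^- n ⌝
    dense-∣∣ x n = let q , x≼ , q≼ = dense x n in q , near ⌜ q ⌝ ⌜ 2^- n ⌝ x≼ q≼
      where
      near : ∀ q h → x ≼ q ⊕ h → q ≼ x ⊕ h → ∣ x ⊝ q ∣≼ h
      near q h x≼ q≼ =
        ⟪ 0≼-resp (0≼-difference q≼) (solveᶠ 3 (λ x q h → (x :⊕ h) :⊝ q :≃ h :⊕ (x :⊝ q)) ≃-refl x q h)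
        , 0≼-resp (0≼-difference x≼) (solveᶠ 3 (λ x q h → (q :⊕ h) :⊝ x :≃ h :⊝ (x :⊝ q)) ≃-refl x q h) ⟫

    BallAround : Carrier → Carrier → Set
    BallAround x y = ∃[ n ] ∃[ p ] ∃[ q ]
      0ᶠ ≺ ⌜ radius n p q ⌝ × norm² (x ⊝ ⌜ p ⌝) (y ⊝ ⌜ q ⌝) ≺ ⌜ radius n p q ⌝ ⊗ ⌜ radius n p q ⌝

    ballAround : ∀ x y m →
      (∀ n p q → ∣ x ⊝ ⌜ p ⌝ ∣≼ ⌜ 2^- n ⌝ → ∣ y ⊝ ⌜ q ⌝ ∣≼ ⌜ 2^- n ⌝ →
        2^- m ℚ.≤ bound DA n p ℚ.⊔ bound DB n q ℚ.+ 2^- n ℚ.+ 2^- n) →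
      BallAround x y
    ballAround x y m far = n , p , q , positive large , ∣∣⇒norm² x~p y~q 0≺h large
      where
      n : ℕ
      n = 4 ℕ.+ m
      p q : ℚ
      p = proj₁ (dense-∣∣ x n)
      q = proj₁ (dense-∣∣ y n)
      x~p : ∣ x ⊝ ⌜ p ⌝ ∣≼ ⌜ 2^- n ⌝
      x~p = proj₂ (dense-∣∣ x n)
      y~q : ∣ y ⊝ ⌜ q ⌝ ∣≼ ⌜ 2^- n ⌝
      y~q = proj₂ (dense-∣∣ y n)
      0≺h : 0ᶠ ≺ ⌜ 2^- n ⌝
      0≺h = ⌜⌝-pos (2^-pos n)
      large : ⌜ 2^- n ⌝ ⊕ ⌜ 2^- n ⌝ ≼ ⌜ radius n p q ⌝
      large = radius-large m {bound DA n p ℚ.⊔ bound DB n q} (far n p q x~p y~q)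
      positive : ∀ {u} → ⌜ 2^- n ⌝ ⊕ ⌜ 2^- n ⌝ ≼ u → 0ᶠ ≺ u
      positive h = ≺-≼-trans 0≺h (≼-trans
        (≼-by (≺⇒≼ 0≺h) (solveᶠ 1 (λ h → h :≃ (h :⊕ h) :⊝ h) ≃-refl ⌜ 2^- n ⌝)) h)

    -- Excluded middle decides which factor is missed; it only proves that a suitable ball exists,
    -- while the family of balls is fixed beforehand.
    ball-cover : ∀ x y → ¬ (A x × B y) → BallAround x y
    ball-cover x y ∉A×B = cases (em {A x})
      where
      cases : Dec (A x) → BallAround x y
      cases (no x∉A) =
        let m , far = complete DA x x∉A
        in ballAround x y m λ n p q x~p _ → enlarge {bound DA n p} {bound DA n p ℚ.⊔ bound DB n q} (2^- n)
             (far n p x~p) (ℚ.p≤p⊔q (bound DA n p) (bound DB n q))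
      cases (yes x∈A) =
        let m , far = complete DB y (λ y∈B → ∉A×B (x∈A , y∈B))
        in ballAround x y m λ n p q _ y~q → enlarge {bound DB n q} {bound DA n p ℚ.⊔ bound DB n q} (2^- n)
             (far n q y~q) (ℚ.p≤q⊔p (bound DA n p) (bound DB n q))

    product-separated : ∀ x y → ¬ (A x × B y) → ∃[ ε ] 0ᶠ ≺ ε ×
      (∀ x′ y′ → norm² (x′ ⊝ x) (y′ ⊝ y) ≼ ε ⊗ ε → ¬ (A x′ × B y′))
    product-separated x y ∉A×B with em {A x}
    ... | no x∉A with separated DA x x∉A
    ...   | ε , 0≺ε , far = ε , 0≺ε , λ x′ y′ near (x′∈A , _) →
      far x′ x′∈A (∣∣-swap (norm²⇒∣∣ˡ near (≺⇒≼ 0≺ε)))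
    product-separated x y ∉A×B | yes x∈A with separated DB y (λ y∈B → ∉A×B (x∈A , y∈B))
    ...   | ε , 0≺ε , far = ε , 0≺ε , λ x′ y′ near (_ , y′∈B) →
      far y′ y′∈B (∣∣-swap (norm²⇒∣∣ʳ near (≺⇒≼ 0≺ε)))

  interval⇒∣∣ : ∀ q h → ⌜ q ℚ.- h ⌝ ≼ x → x ≼ ⌜ q ℚ.+ h ⌝ → ∣ ⌜ q ⌝ ⊝ x ∣≼ ⌜ h ⌝
  interval⇒∣∣ {x} q h l u =
    ⟪ 0≼-resp (0≼-difference (≼-trans u (≼-reflexive (⌜⌝-+ q h))))
        (solveᶠ 3 (λ x q h → (q :⊕ h) :⊝ x :≃ h :⊕ (q :⊝ x)) ≃-refl x ⌜ q ⌝ ⌜ h ⌝)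
    , 0≼-resp (0≼-difference (≼-trans (≼-reflexive (≃-sym (⌜⌝-difference q h))) l))
        (solveᶠ 3 (λ x q h → x :⊝ (q :⊝ h) :≃ h :⊝ (q :⊝ x)) ≃-refl x ⌜ q ⌝ ⌜ h ⌝) ⟫

  ∣∣⇒interval : ∀ q h → ∣ ⌜ q ⌝ ⊝ x ∣≼ ⌜ h ⌝ → ⌜ q ℚ.- h ⌝ ≼ x × x ≼ ⌜ q ℚ.+ h ⌝
  ∣∣⇒interval {x} q h near =
      ≼-trans (≼-reflexive (⌜⌝-difference q h)) (≼-by (upper near)
        (solveᶠ 3 (λ x q h → h :⊝ (q :⊝ x) :≃ x :⊝ (q :⊝ h)) ≃-refl x ⌜ q ⌝ ⌜ h ⌝))
    , ≼-trans (≼-by (lower near) (solveᶠ 3 (λ x q h → h :⊕ (q :⊝ x) :≃ (q :⊕ h) :⊝ x) ≃-refl x ⌜ q ⌝ ⌜ h ⌝))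
        (≼-reflexive (≃-sym (⌜⌝-+ q h)))

  ≃⇒∣∣ : x ≃ y → 0ᶠ ≼ a → ∣ x ⊝ y ∣≼ a
  ≃⇒∣∣ {x} {y} {a} x≃y 0≼a = ∣∣-cong (⊕-cong (≃-sym x≃y) ≃-refl) (∣∣-cong
    (solveᶠ 1 (λ y → κ 0ℚ :≃ y :⊝ y) ≃-refl y) (nonNeg⇒∣∣ ≼-refl 0≼a))

  norm²-net : 0ᶠ ≺ ε → ∃[ N ] ∀ {x y x′ y′} → ∣ x ⊝ x′ ∣≼ ⌜ 2^- N ⌝ → ∣ y ⊝ y′ ∣≼ ⌜ 2^- N ⌝ →
    norm² (x′ ⊝ x) (y′ ⊝ y) ≺ ε ⊗ ε
  norm²-net 0≺ε = let m , 2^-m≼ε = archimedean 0≺ε in suc m , λ hx hy → ∣∣⇒norm² (∣∣-swap hx) (∣∣-swap hy) (⌜⌝-pos (2^-pos (suc m)))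
    (≼-trans (≼-reflexive (⌜2^-⌝-suc m)) 2^-m≼ε)

  -- Disjoint strips, and inversion of the expansion factor

  record Strips (r d₁ d₂ : Carrier) : Set where
    field
      0≺r      : 0ᶠ ≺ r
      inUnit₁  : ∀ {x} → d₁ ≼ x → x ≼ d₁ ⊕ r → InUnit x
      inUnit₂  : ∀ {x} → d₂ ≼ x → x ≼ d₂ ⊕ r → InUnit x
      disjoint : ∀ {x} → d₁ ≼ x → x ≼ d₁ ⊕ r → d₂ ≼ x → x ≼ d₂ ⊕ r → ⊥

    x≼x+r : ∀ x → x ≼ x ⊕ r
    x≼x+r x = ≼-by (≺⇒≼ 0≺r) (solveᶠ 2 (λ x r → r :≃ (x :⊕ r) :⊝ x) ≃-refl x r)

    0≼d₁ : 0ᶠ ≼ d₁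
    0≼d₁ = proj₁ (inUnit₁ ≼-refl (x≼x+r d₁))
    0≼d₂ : 0ᶠ ≼ d₂
    0≼d₂ = proj₁ (inUnit₂ ≼-refl (x≼x+r d₂))
    d₁+r≼1 : d₁ ⊕ r ≼ 1ᶠ
    d₁+r≼1 = proj₂ (inUnit₁ (x≼x+r d₁) ≼-refl)
    d₂+r≼1 : d₂ ⊕ r ≼ 1ᶠ
    d₂+r≼1 = proj₂ (inUnit₂ (x≼x+r d₂) ≼-refl)

    -- Strips wider than ½ would both contain ½.
    r≼½ : r ≼ ⌜ ½ ⌝
    r≼½ with ≼-total r ⌜ ½ ⌝
    ... | inj₁ h = h
    ... | inj₂ ½≼r = ⊥-elim (disjoint (d≼½ d₁+r≼1) (½≼d+r 0≼d₁) (d≼½ d₂+r≼1) (½≼d+r 0≼d₂))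
      where
      d≼½ : ∀ {d} → d ⊕ r ≼ 1ᶠ → d ≼ ⌜ ½ ⌝
      d≼½ {d} h = ≼-by (0≼-⊕ (0≼-difference h) (0≼-difference ½≼r))
        (solveᶠ 2 (λ d r → (κ 1ℚ :⊝ (d :⊕ r)) :⊕ (r :⊝ κ ½) :≃ κ ½ :⊝ d) ≃-refl d r)
      ½≼d+r : ∀ {d} → 0ᶠ ≼ d → ⌜ ½ ⌝ ≼ d ⊕ r
      ½≼d+r {d} h = ≼-by (0≼-⊕ h (0≼-difference ½≼r)) (solveᶠ 2 (λ d r → d :⊕ (r :⊝ κ ½) :≃ (d :⊕ r) :⊝ κ ½) ≃-refl d r)

  module StripsIFS {r d₁ d₂ : Carrier} (strips : Strips r d₁ d₂) where
    open Strips strips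
    open IFS r d₁ d₂ 0≺r r≼½ 0≼d₁ d₁+r≼1 0≼d₂ d₂+r≼1 public

    affine∈strip : ∀ d → InUnit x → d ≼ d ⊕ r ⊗ x × d ⊕ r ⊗ x ≼ d ⊕ r
    affine∈strip {x} d (0≼x , x≼1) =
        ≼-by (⊗-nonNeg (≺⇒≼ 0≺r) 0≼x) (solveᶠ 3 (λ d r x → r :⊗ x :≃ (d :⊕ r :⊗ x) :⊝ d) ≃-refl d r x)
      , ≼-by (⊗-nonNeg (≺⇒≼ 0≺r) (0≼-difference x≼1))
          (solveᶠ 3 (λ d r x → r :⊗ (κ 1ℚ :⊝ x) :≃ (d :⊕ r) :⊝ (d :⊕ r :⊗ x)) ≃-refl d r x)

  0≺reciprocal : 0ᶠ ≺ x → x ⊗ y ≃ 1ᶠ → 0ᶠ ≺ y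
  0≺reciprocal {x} {y} 0≺x xy≃1 y≼0 = ⌜⌝-pos 0<1 (≼-by (⊗-nonNeg (≺⇒≼ 0≺x) (0≼-difference y≼0))
    (≃-trans (solveᶠ 2 (λ x y → x :⊗ (κ 0ℚ :⊝ y) :≃ κ 0ℚ :⊝ x :⊗ y) ≃-refl x y) (⊕-cong ≃-refl (⊖-cong xy≃1))))

  module Reciprocal {μ ν : Carrier} (μν≃1 : μ ⊗ ν ≃ 1ᶠ) where

    cancel-μ : ∀ x → (μ ⊗ ν) ⊗ x ≃ x
    cancel-μ x = ≃-trans (⊗-cong μν≃1 ≃-refl) (solveᶠ 1 (λ x → κ 1ℚ :⊗ x :≃ x) ≃-refl x)

    expand⇒contract : ∀ c x y → y ≃ μ ⊗ (x ⊝ c) → x ≃ c ⊕ ν ⊗ y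
    expand⇒contract c x y h = ≃-sym (≃-trans (⊕-cong ≃-refl (⊗-cong ≃-refl h)) (≃-trans
      (solveᶠ 4 (λ c x m n → c :⊕ n :⊗ (m :⊗ (x :⊝ c)) :≃ c :⊕ (m :⊗ n) :⊗ (x :⊝ c)) ≃-refl c x μ ν)
      (≃-trans (⊕-cong ≃-refl (cancel-μ (x ⊝ c))) (solveᶠ 2 (λ c x → c :⊕ (x :⊝ c) :≃ x) ≃-refl c x))))

    contract⇒expand : ∀ c y → μ ⊗ (c ⊕ ν ⊗ y ⊝ c) ≃ y
    contract⇒expand c y = ≃-trans
      (solveᶠ 4 (λ c y m n → m :⊗ (c :⊕ n :⊗ y :⊝ c) :≃ (m :⊗ n) :⊗ y) ≃-refl c y μ ν) (cancel-μ y)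

    expand⇒contract-flip : ∀ c x y → y ≃ 1ᶠ ⊝ μ ⊗ (x ⊝ c) → x ≃ c ⊕ ν ⊗ (1ᶠ ⊝ y)
    expand⇒contract-flip c x y h = expand⇒contract c x (1ᶠ ⊝ y) (≃-trans (⊕-cong ≃-refl (⊖-cong h))
      (solveᶠ 1 (λ t → κ 1ℚ :⊝ (κ 1ℚ :⊝ t) :≃ t) ≃-refl (μ ⊗ (x ⊝ c))))

    contract⇒expand-flip : ∀ c y → 1ᶠ ⊝ μ ⊗ (c ⊕ ν ⊗ (1ᶠ ⊝ y) ⊝ c) ≃ y
    contract⇒expand-flip c y = ≃-trans (⊕-cong ≃-refl (⊖-cong (contract⇒expand c (1ᶠ ⊝ y))))
      (solveᶠ 1 (λ y → κ 1ℚ :⊝ (κ 1ℚ :⊝ y) :≃ y) ≃-refl y)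

    module _ (0≺ν : 0ᶠ ≺ ν) (ν≼½ : ν ≼ ⌜ ½ ⌝) where

      2≼μ : 0ᶠ ≺ μ → 1ᶠ ⊕ 1ᶠ ≼ μ
      2≼μ 0≺μ = ≼-by (0≼-⊕ (⊗-nonNeg (≺⇒≼ 0≺μ) (0≼-difference ν≼½)) (⊗-nonNeg (≺⇒≼ 0≺μ) (0≼-difference ν≼½)))
        (≃-trans (solveᶠ 2 (λ m n → m :⊗ (κ ½ :⊝ n) :⊕ m :⊗ (κ ½ :⊝ n) :≃ m :⊝ (m :⊗ n :⊕ m :⊗ n)) ≃-refl μ ν)
          (⊕-cong ≃-refl (⊖-cong (⊕-cong μν≃1 μν≃1))))

      -- Because μ ≥ 2, even an error of 1 leaves room: every given approximation is safely
      -- invertible, the crudest included.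
      1≼approximation : 0ᶠ ≺ μ → ∀ {q h} → ∣ ⌜ q ⌝ ⊝ μ ∣≼ h → h ≼ 1ᶠ → 1ℚ ℚ.≤ q
      1≼approximation 0≺μ {q} {h} near h≼1 = ⌜⌝-cancel (≼-by
        (0≼-⊕ (0≼-⊕ (lower near) (0≼-difference h≼1)) (0≼-difference (2≼μ 0≺μ)))
        (solveᶠ 3 (λ q h m → ((h :⊕ (q :⊝ m)) :⊕ (κ 1ℚ :⊝ h)) :⊕ (m :⊝ (κ 1ℚ :⊕ κ 1ℚ)) :≃ q :⊝ κ 1ℚ) ≃-refl ⌜ q ⌝ h μ))

      -- From p - ν = p ν (μ - q) with 0 ≤ p ≤ 1 and 0 ≤ ν ≤ ½: inversion loses no precision, so the
      -- index of the approximation need not be shifted.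
      reciprocal-near : ∀ {p q h} → ∣ ⌜ q ⌝ ⊝ μ ∣≼ h → 1ℚ ℚ.≤ q → q ℚ.* p ≡ 1ℚ → 0ℚ ℚ.< p → ∣ ⌜ p ⌝ ⊝ ν ∣≼ h
      reciprocal-near {p} {q} {h} near 1≤q qp≡1 0<p = ∣∣-cong
        (≃-trans (solveᶠ 4 (λ p q m n → p :⊗ (n :⊗ (m :⊝ q)) :≃ (m :⊗ n) :⊗ p :⊝ (q :⊗ p) :⊗ n) ≃-refl ⌜ p ⌝ ⌜ q ⌝ μ ν)
          (⊕-cong (cancel-μ ⌜ p ⌝) (⊖-cong (≃-trans (⊗-cong ⌜q⌝⌜p⌝≃1 ≃-refl) (solveᶠ 1 (λ n → κ 1ℚ :⊗ n :≃ n) ≃-refl ν)))))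
        (∣∣-mono (≼-by (⊗-nonNeg 0≼½ (∣∣-nonNeg near)) (solveᶠ 1 (λ h → κ ½ :⊗ h :≃ h :⊝ κ 1ℚ :⊗ (κ ½ :⊗ h)) ≃-refl h))
          (∣∣-⊗ (nonNeg⇒∣∣ 0≼p p≼1) (∣∣-⊗ (nonNeg⇒∣∣ (≺⇒≼ 0≺ν) ν≼½) (∣∣-swap near))))
        where
        ⌜q⌝⌜p⌝≃1 : ⌜ q ⌝ ⊗ ⌜ p ⌝ ≃ 1ᶠ
        ⌜q⌝⌜p⌝≃1 = ≃-trans (≃-sym (⌜⌝-* q p)) (≃-reflexive (cong ⌜_⌝ qp≡1))
        0≼p : 0ᶠ ≼ ⌜ p ⌝
        0≼p = ⌜⌝-mono (ℚ.<⇒≤ 0<p)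
        p≼1 : ⌜ p ⌝ ≼ 1ᶠ
        p≼1 = ≼-by (⊗-nonNeg (0≼-difference (⌜⌝-mono 1≤q)) 0≼p) (≃-trans
          (solveᶠ 2 (λ p q → (q :⊝ κ 1ℚ) :⊗ p :≃ q :⊗ p :⊝ p) ≃-refl ⌜ p ⌝ ⌜ q ⌝)
          (⊕-cong ⌜q⌝⌜p⌝≃1 ≃-refl))

    reciprocal-exact : ∀ {p q} → ⌜ q ⌝ ≃ μ → q ℚ.* p ≡ 1ℚ → ⌜ p ⌝ ≃ ν
    reciprocal-exact {p} {q} q≃μ qp≡1 = ≃-trans (≃-sym (cancel-μ ⌜ p ⌝)) (≃-trans
      (solveᶠ 3 (λ p m n → (m :⊗ n) :⊗ p :≃ (m :⊗ p) :⊗ n) ≃-refl ⌜ p ⌝ μ ν)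
      (≃-trans (⊗-cong (≃-trans (⊗-cong (≃-sym q≃μ) ≃-refl) (≃-trans (≃-sym (⌜⌝-* q p)) (≃-reflexive (cong ⌜_⌝ qp≡1)))) ≃-refl)
        (solveᶠ 1 (λ n → κ 1ℚ :⊗ n :≃ n) ≃-refl ν)))

  -- Common ground of computable and rational parameters, with the approximating sequence in the
  -- form in which it can be computed with.
  record Approximable (x : Carrier) : Set where
    field
      approximation : ℕ → ℚ
      fractional    : Fractional {1} (approximation ∘ head)
      near          : ∀ j → ∣ ⌜ approximation j ⌝ ⊝ x ∣≼ ⌜ 2^- j ⌝

-- Opaque copies of the operations: deciding whether two sums of reals are equal
-- would otherwise compare the proofs that they are Cauchy.

infixl 6 _+ᴿ_
infixl 7 _*ᴿ_
infix  8 -ᴿ_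

abstract
  _+ᴿ_ _*ᴿ_ : ℝ → ℝ → ℝ
  _+ᴿ_ = _+_
  _*ᴿ_ = _*_

  -ᴿ_ : ℝ → ℝ
  -ᴿ_ = -_

  +ᴿ-def : ∀ x y → x +ᴿ y ≡ x + y
  +ᴿ-def x y = refl

  *ᴿ-def : ∀ x y → x *ᴿ y ≡ x * y
  *ᴿ-def x y = refl

  -ᴿ-def : ∀ x → -ᴿ x ≡ - x
  -ᴿ-def x = refl

  ℝ-isCommutativeRing : IsCommutativeRing _≈ʳ_ _+ᴿ_ _*ᴿ_ -ᴿ_ 0ℝ 1ℝ
  ℝ-isCommutativeRing = record
    { isRing = record
      { +-isAbelianGroup = record
        { isGroup = record
          { isMonoid = record
            { isSemigroup = record
              { isMagma = record
                { isEquivalence = record { refl = ≈-refl ; sym = ≈-sym ; trans = ≈-trans }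
                ; ∙-cong = λ {x} {y} {u} {v} → +-cong {x} {y} {u} {v} }
              ; assoc = λ x y z → ∀≡⇒≈ {x +ᴿ y +ᴿ z} {x +ᴿ (y +ᴿ z)} λ n → ℚ.+-assoc (seq x n) (seq y n) (seq z n) }
            ; identity = (λ x → ∀≡⇒≈ {0ℝ +ᴿ x} {x} λ n → ℚ.+-identityˡ (seq x n))
                       , (λ x → ∀≡⇒≈ {x +ᴿ 0ℝ} {x} λ n → ℚ.+-identityʳ (seq x n)) }
          ; inverse = (λ x → ∀≡⇒≈ {(-ᴿ x) +ᴿ x} {0ℝ} λ n → ℚ.+-inverseˡ (seq x n))
                    , (λ x → ∀≡⇒≈ {x +ᴿ (-ᴿ x)} {0ℝ} λ n → ℚ.+-inverseʳ (seq x n))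
          ; ⁻¹-cong = λ {x} {y} → neg-cong {x} {y} }
        ; comm = λ x y → ∀≡⇒≈ {x +ᴿ y} {y +ᴿ x} λ n → ℚ.+-comm (seq x n) (seq y n) }
      ; *-cong = λ {x} {y} {u} {v} → *-cong {x} {y} {u} {v}
      ; *-assoc = λ x y z → ∀≡⇒≈ {x *ᴿ y *ᴿ z} {x *ᴿ (y *ᴿ z)} λ n → ℚ.*-assoc (seq x n) (seq y n) (seq z n)
      ; *-identity = (λ x → ∀≡⇒≈ {1ℝ *ᴿ x} {x} λ n → ℚ.*-identityˡ (seq x n))
                   , (λ x → ∀≡⇒≈ {x *ᴿ 1ℝ} {x} λ n → ℚ.*-identityʳ (seq x n))
      ; distrib = (λ x y z → ∀≡⇒≈ {x *ᴿ (y +ᴿ z)} {x *ᴿ y +ᴿ x *ᴿ z} λ n → ℚ.*-distribˡ-+ (seq x n) (seq y n) (seq z n))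
                , (λ x y z → ∀≡⇒≈ {(y +ᴿ z) *ᴿ x} {y *ᴿ x +ᴿ z *ᴿ x} λ n → ℚ.*-distribʳ-+ (seq x n) (seq y n) (seq z n)) }
    ; *-comm = *-comm }

  fromℚ-+ : ∀ p q → fromℚ (p ℚ.+ q) ≈ʳ fromℚ p +ᴿ fromℚ q
  fromℚ-+ p q = ∀≡⇒≈ {fromℚ (p ℚ.+ q)} {fromℚ p +ᴿ fromℚ q} λ _ → refl

  fromℚ-* : ∀ p q → fromℚ (p ℚ.* q) ≈ʳ fromℚ p *ᴿ fromℚ q
  fromℚ-* p q = ∀≡⇒≈ {fromℚ (p ℚ.* q)} {fromℚ p *ᴿ fromℚ q} λ _ → refl

  fromℚ-neg : ∀ p → fromℚ (ℚ.- p) ≈ʳ -ᴿ fromℚ p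
  fromℚ-neg p = ∀≡⇒≈ {fromℚ (ℚ.- p)} { -ᴿ fromℚ p} λ _ → refl

ℝ-commutativeRing : CommutativeRing 0ℓ 0ℓ
ℝ-commutativeRing = record
  { Carrier = ℝ ; _≈_ = _≈ʳ_ ; _+_ = _+ᴿ_ ; _*_ = _*ᴿ_ ; -_ = -ᴿ_ ; 0# = 0ℝ ; 1# = 1ℝ
  ; isCommutativeRing = ℝ-isCommutativeRing }

-- The Cauchy reals as an archimedean field

<⇒≤ : ∀ {x y} → x <ʳ y → x ≤ʳ y
<⇒≤ {x} {y} (wrap (ε , 0<ε , N , h)) = wrap λ {η} 0<η → N , λ {n} p →
  ℚ.<-trans (p<p+ε (seq x n) 0<ε) (ℚ.<-trans (h p) (p<p+ε (seq y n) 0<η))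

fromℚ-cancel-≤ : ∀ {p q} → fromℚ p ≤ʳ fromℚ q → p ℚ.≤ q
fromℚ-cancel-≤ {p} {q} (wrap h) = ℚ.≮⇒≥ λ q<p →
  let 0<p-q = subst (ℚ._< p ℚ.- q) (ℚ.+-inverseʳ q) (ℚ.+-monoˡ-< (ℚ.- q) q<p)
      N , k = h 0<p-q
  in ℚ.<-irrefl refl (subst (p ℚ.<_) (solve 2 (λ p q → q :+ (p :- q) := p) refl p q) (k {N} ℕ.≤-refl))

fromℚ-archimedean : ∀ {x} → 0ℝ <ʳ x → ∃[ j ] fromℚ (2^- j) ≤ʳ x
fromℚ-archimedean {x} (wrap (ε , 0<ε , N , h)) = let j , 2^-j<ε = 2^-archimedean 0<ε in
  j , wrap λ {η} 0<η → N , λ {n} p → ℚ.<-trans {2^- j} {ε} 2^-j<ε (ℚ.<-trans {ε} {seq x n} (subst (ℚ._< seq x n) (ℚ.+-identityˡ ε) (h p)) (p<p+ε (seq x n) 0<η))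

fromℚ-near : ∀ x h → 0ℚ ℚ.< h → ∃[ q ] x ≤ʳ fromℚ q + fromℚ h × fromℚ q ≤ʳ x + fromℚ h
fromℚ-near x h 0<h = seq x N , wrap above , wrap below
  where
  N : ℕ
  N = proj₁ (cauchy x 0<h)
  close : ∀ {m n} → N ℕ.≤ m → N ℕ.≤ n → ∣ seq x m ℚ.- seq x n ∣ ℚ.< h
  close = proj₂ (cauchy x 0<h)
  above : x ≤ fromℚ (seq x N) + fromℚ h
  above {η} 0<η = N , λ {n} p → ℚ.<-trans {seq x n} {seq x N ℚ.+ h} {seq x N ℚ.+ h ℚ.+ η}
    (∣p-q∣<ε⇒p<q+ε {seq x n} {seq x N} {h} (close p ℕ.≤-refl)) (p<p+ε (seq x N ℚ.+ h) 0<η)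
  below : fromℚ (seq x N) ≤ x + fromℚ h
  below {η} 0<η = N , λ {n} p → ℚ.<-trans {seq x N} {seq x n ℚ.+ h} {seq x n ℚ.+ h ℚ.+ η}
    (∣p-q∣<ε⇒p<q+ε {seq x N} {seq x n} {h} (close ℕ.≤-refl p)) (p<p+ε (seq x n ℚ.+ h) 0<η)

fromℚ-dense : ∀ x j → ∃[ q ] x ≤ʳ fromℚ q + fromℚ (2^- j) × fromℚ q ≤ʳ x + fromℚ (2^- j)
fromℚ-dense x j = fromℚ-near x (2^- j) (2^-pos j)

module _ (em : ExcludedMiddle 0ℓ) where
  open Classical em

  ≤-total : ∀ x y → x ≤ʳ y ⊎ y ≤ʳ x
  ≤-total x y with em {x ≤ʳ y}
  ... | yes x≤y = inj₁ x≤y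
  ... | no x≰y  = inj₂ (<⇒≤ {y} {x} (≰⇒> {x} {y} x≰y))

  -- Terms of nonnegative reals may be slightly negative, so the factors are classified first: a
  -- factor that is also at most 0 is null, and two positive factors have a positive product.
  *-nonNeg : ∀ {x y} → 0ℝ ≤ʳ x → 0ℝ ≤ʳ y → 0ℝ ≤ʳ x * y
  *-nonNeg {x} {y} 0≤x 0≤y = cases (em {x ≤ʳ 0ℝ}) (em {y ≤ʳ 0ℝ})
    where
    x*y≈0 : y ≈ʳ 0ℝ → x * y ≈ʳ 0ℝ
    x*y≈0 = *-zeroʳ′ {y} x
    y*x≈0 : x ≈ʳ 0ℝ → y * x ≈ʳ 0ℝ
    y*x≈0 = *-zeroʳ′ {x} y
    cases : Dec (x ≤ʳ 0ℝ) → Dec (y ≤ʳ 0ℝ) → 0ℝ ≤ʳ x * y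
    cases (yes x≤0) _ = ≤-trans {0ℝ} {y * x} {x * y} (≈⇒≥ {y * x} {0ℝ} (y*x≈0 (≤-antisym {x} {0ℝ} x≤0 0≤x)))
      (≈⇒≤ {y * x} {x * y} (*-comm y x))
    cases (no _) (yes y≤0) = ≈⇒≥ {x * y} {0ℝ} (x*y≈0 (≤-antisym {y} {0ℝ} y≤0 0≤y))
    cases (no x≰0) (no y≰0) = <⇒≤ {0ℝ} {x * y} (*-pos-< {x} {y} (≰⇒> {x} {0ℝ} x≰0) (≰⇒> {y} {0ℝ} y≰0))

  abstract
    +ᴿ-monoˡ-≤ : ∀ {x y} z → x ≤ʳ y → x +ᴿ z ≤ʳ y +ᴿ z
    +ᴿ-monoˡ-≤ {x} {y} z h = +-mono-≤ {x} {y} {z} {z} h (≤-refl {z})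

    *ᴿ-nonNeg : ∀ {x y} → 0ℝ ≤ʳ x → 0ℝ ≤ʳ y → 0ℝ ≤ʳ x *ᴿ y
    *ᴿ-nonNeg {x} {y} = *-nonNeg {x} {y}

    *ᴿ-reciprocal : ∀ {x} → ¬ x ≤ʳ 0ℝ → ∃[ y ] x *ᴿ y ≈ʳ 1ℝ
    *ᴿ-reciprocal {x} 0≺x = reciprocal {x} (≰⇒> {x} {0ℝ} 0≺x)

    fromℚ-denseᴿ : ∀ x j → ∃[ q ] x ≤ʳ fromℚ q +ᴿ fromℚ (2^- j) × fromℚ q ≤ʳ x +ᴿ fromℚ (2^- j)
    fromℚ-denseᴿ x j = fromℚ-dense x j

  ℝ-archimedeanField : ArchimedeanField
  ℝ-archimedeanField = record
    { commutativeRing = ℝ-commutativeRing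
    ; _≼_         = _≤ʳ_
    ; ≼-reflexive = ≈⇒≤
    ; ≼-antisym   = ≤-antisym
    ; ≼-trans     = ≤-trans
    ; ≼-total     = ≤-total
    ; ⊕-monoˡ-≼   = +ᴿ-monoˡ-≤
    ; ⌜_⌝         = fromℚ
    ; ⌜⌝-+        = fromℚ-+
    ; ⌜⌝-*        = fromℚ-*
    ; ⌜⌝-neg      = fromℚ-neg
    ; ⌜0⌝         = ≈-refl {0ℝ}
    ; ⌜1⌝         = ≈-refl {1ℝ}
    ; ⌜⌝-mono     = fromℚ-mono-≤
    ; ⌜⌝-cancel   = fromℚ-cancel-≤
    ; ⊗-nonNeg    = *ᴿ-nonNeg
    ; reciprocalᶠ = *ᴿ-reciprocal
    ; archimedean = λ {x} 0≺x → fromℚ-archimedean {x} (≰⇒> {x} {0ℝ} 0≺x)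
    ; dense       = fromℚ-denseᴿ
    }

-- Enumerated balls and points of the plane

triple : ℕ → ℚ → ℚ → ℕ
triple n p q = ⟨ n , ⟨ encode p , encode q ⟩ ⟩

-- Stated for an arbitrary relation, so that the decoding equations rewrite a small goal and not the
-- unfolded membership in a ball.
triple-decoded : (P : ℕ → ℚ → ℚ → Set) → ∀ n p q → P n p q → let i = triple n p q in
  P (π₁ i) (decode (π₁ (π₂ i))) (decode (π₂ (π₂ i)))
triple-decoded P n p q Pnpq
  rewrite π₁-⟨,⟩ n ⟨ encode p , encode q ⟩ | π₂-⟨,⟩ n ⟨ encode p , encode q ⟩
        | π₁-⟨,⟩ (encode p) (encode q) | π₂-⟨,⟩ (encode p) (encode q)
        | decode-encode p | decode-encode q = Pnpq

nested-decoded : (P : ℕ → ℕ → ℕ → Set) → ∀ N k l → P N k l → let i = ⟨ ⟨ N , k ⟩ , l ⟩ in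
  P (π₁ (π₁ i)) (π₂ (π₁ i)) (π₂ i)
nested-decoded P N k l PNkl
  rewrite π₁-⟨,⟩ ⟨ N , k ⟩ l | π₂-⟨,⟩ ⟨ N , k ⟩ l | π₁-⟨,⟩ N k | π₂-⟨,⟩ N k = PNkl

module Plane (em : ExcludedMiddle 0ℓ) where
  open Classical em using (≰⇒>)
  open ArchimedeanField (ℝ-archimedeanField em)
    using (⌜_⌝; _≃_; _⊕_; _⊗_; _⊝_; _≼_; _≺_; ≼-reflexive; ≃-refl)
  open Theory (ℝ-archimedeanField em) em

  ⊝-def : ∀ x a → x ⊝ a ≡ x - a
  ⊝-def x a = trans {i = x ⊝ a} {x + (-ᴿ a)} {x - a} (+ᴿ-def x (-ᴿ a)) (cong (λ t → x + t) { -ᴿ a} { - a} (-ᴿ-def a))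

  norm²-def : ∀ x y a b → norm² (x ⊝ a) (y ⊝ b) ≡ (x - a) * (x - a) + (y - b) * (y - b)
  norm²-def x y a b = sum-of-squares _+ᴿ_ _*ᴿ_ _+_ _*_ +ᴿ-def *ᴿ-def (x ⊝ a) (y ⊝ b) (x - a) (y - b) (⊝-def x a) (⊝-def y b)
    where
    -- Both pairs of operations are variables here, so matching on the equations never unfolds a sum
    -- of reals.
    sum-of-squares : (_+₁_ _*₁_ _+₂_ _*₂_ : ℝ → ℝ → ℝ) →
      (∀ u v → u +₁ v ≡ u +₂ v) → (∀ u v → u *₁ v ≡ u *₂ v) →
      ∀ u v u′ v′ → u ≡ u′ → v ≡ v′ → (u *₁ u) +₁ (v *₁ v) ≡ (u′ *₂ u′) +₂ (v′ *₂ v′)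
    sum-of-squares _+₁_ _*₁_ _+₂_ _*₂_ +-def *-def u v .u .v refl refl =
      trans (+-def (u *₁ u) (v *₁ v)) (cong₂ _+₂_ (*-def u u) (*-def v v))

  ball⇒norm² : ∀ {p q : ℝ²} {ρ} → q ∈ Ball p ρ →
    norm² (proj₁ q ⊝ proj₁ p) (proj₂ q ⊝ proj₂ p) ≼ ρ ⊗ ρ
  ball⇒norm² {a , b} {x , y} {ρ} (_ , inside) = subst₂ _≤ʳ_ (sym (norm²-def x y a b)) (sym (*ᴿ-def ρ ρ))
    (<⇒≤ {(x - a) * (x - a) + (y - b) * (y - b)} {ρ * ρ} (wrap inside))

  ball⇒0≺ : ∀ {p q : ℝ²} {ρ} → q ∈ Ball p ρ → ⌜ 0ℚ ⌝ ≺ ρ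
  ball⇒0≺ {ρ = ρ} (0<ρ , _) = <⇒≱ {0ℝ} {ρ} (wrap 0<ρ)

  norm²⇒ball : ∀ {p q : ℝ²} {ρ} → ⌜ 0ℚ ⌝ ≺ ρ →
    norm² (proj₁ q ⊝ proj₁ p) (proj₂ q ⊝ proj₂ p) ≺ ρ ⊗ ρ → q ∈ Ball p ρ
  norm²⇒ball {a , b} {x , y} {ρ} 0≺ρ inside = unwrap< (≰⇒> {ρ} {0ℝ} 0≺ρ) , unwrap< norm²<ρ²
    where
    norm²<ρ² : (x - a) * (x - a) + (y - b) * (y - b) <ʳ ρ * ρ
    norm²<ρ² = subst₂ _<ʳ_ (norm²-def x y a b) (*ᴿ-def ρ ρ) (≰⇒> {ρ ⊗ ρ} {norm² (x ⊝ a) (y ⊝ b)} inside)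

  -- Computability of a product of two attractors

  module ProductOfAttractors
    {r d₁ d₂ s e₁ e₂ : ℝ} (stripsX : Strips r d₁ d₂) (stripsY : Strips s e₁ e₂)
    (r-approx : Approximable r) (d₁-approx : Approximable d₁) (d₂-approx : Approximable d₂)
    (s-approx : Approximable s) (e₁-approx : Approximable e₁) (e₂-approx : Approximable e₂) where

    open Approximable
    module X = StripsIFS stripsX
    module Y = StripsIFS stripsY
    module X̃ = X.Approximation (approximation r-approx) (approximation d₁-approx) (approximation d₂-approx)
      (near r-approx) (near d₁-approx) (near d₂-approx)
    module Ỹ = Y.Approximation (approximation s-approx) (approximation e₁-approx) (approximation e₂-approx)
      (near s-approx) (near e₁-approx) (near e₂-approx)
    module XC = X̃.Computability (fractional r-approx) (fractional d₁-approx) (fractional d₂-approx)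
    module YC = Ỹ.Computability (fractional s-approx) (fractional e₁-approx) (fractional e₂-approx)

    X-bound : DistanceBound X.Attractor
    X-bound = record
      { bound = X̃.distance ; sound = λ n q {x} {ρ} → X̃.distance-sound {x} n q {ρ}
      ; complete = X̃.distance-complete ; separated = X.attractor-closed }

    Y-bound : DistanceBound Y.Attractor
    Y-bound = record
      { bound = Ỹ.distance ; sound = λ n q {x} {ρ} → Ỹ.distance-sound {x} n q {ρ}
      ; complete = Ỹ.distance-complete ; separated = Y.attractor-closed }

    open Product X-bound Y-bound

    module _ (A : Pred ℝ² 0ℓ)
      (to : ∀ {x y} → (x , y) ∈ A → X.Attractor x × Y.Attractor y)
      (from : ∀ {x y} → X.Attractor x × Y.Attractor y → (x , y) ∈ A) where

      product-closed : Closed A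
      product-closed {x , y} p∉A =
        let ε , 0≺ε , far = product-separated x y (λ h → p∉A (from h))
        in ε , unwrap< (≰⇒> {ε} {0ℝ} 0≺ε) , λ {q} near q∈A →
          far (proj₁ q) (proj₂ q) (ball⇒norm² {x , y} {q} {ε} near) (to q∈A)

      InBall : ℝ² → ℕ → ℚ → ℚ → Set
      InBall z n p q = z ∈ Ball (fromℚ² (p , q)) (fromℚ (radius n p q))

      product-coREClosed : CoREClosed A
      -- An index codes a precision and a rational centre. Where the computed radius is not positive
      -- the ball is empty, so no index has to be filtered out.
      product-coREClosed = (λ i → p i , q i) , (λ i → radius (π₁ i) (p i) (q i))
        , (fractional⇒computableℚ p-fractional , fractional⇒computableℚ q-fractional)
        , fractional⇒computableℚ
            ((XC.distance-fractional n-computable p-computable ⊔ᶠ YC.distance-fractional n-computable q-computable)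
             -ᶠ (h +ᶠ h +ᶠ h))
        , (λ {z} → covered {z}) , λ {z} → disjoint {z}
        where
        p q : ℕ → ℚ
        p i = decode (π₁ (π₂ i))
        q i = decode (π₂ (π₂ i))
        n-computable : Computable {1} (π₁ ∘ head)
        n-computable = computable-π₁ computable-head
        p-computable : Computable {1} (π₁ ∘ π₂ ∘ head)
        p-computable = computable-π₁ (computable-π₂ computable-head)
        q-computable : Computable {1} (π₂ ∘ π₂ ∘ head)
        q-computable = computable-π₂ (computable-π₂ computable-head)
        p-fractional : Fractional {1} (p ∘ head)
        p-fractional = fractional-decode p-computable
        q-fractional : Fractional {1} (q ∘ head)
        q-fractional = fractional-decode q-computable
        h : Fractional {1} (λ xs → 2^- π₁ (head xs))
        h = fractional-2^- n-computable
        covered : ∁ A ⊆ (λ z → ∃[ i ] InBall z (π₁ i) (p i) (q i))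
        covered {x , y} z∉A =
          let n , a , b , 0≺R , inside = ball-cover x y (λ k → z∉A (from k))
          in triple n a b , triple-decoded (InBall (x , y)) n a b
               (norm²⇒ball {fromℚ² (a , b)} {x , y} {fromℚ (radius n a b)} 0≺R inside)
        disjoint : (λ z → ∃[ i ] InBall z (π₁ i) (p i) (q i)) ⊆ ∁ A
        disjoint {x , y} (i , inside) z∈A =
          let R = fromℚ (radius (π₁ i) (p i) (q i))
              x∈X , y∈Y = to z∈A
          in ball-disjoint (π₁ i) (p i) (q i) x∈X y∈Y (≺⇒≼ (ball⇒0≺ {fromℚ² (p i , q i)} {x , y} {R} inside))
               (ball⇒norm² {fromℚ² (p i , q i)} {x , y} {R} inside)

      -- An index codes one word length, shared by both coordinates, and a word index for each
      -- coordinate.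
      N k l : ℕ → ℕ
      N = π₁ ∘ π₁
      k = π₂ ∘ π₁
      l = π₂

      N-computable : ∀ {n} {f : Vec ℕ n → ℕ} → Computable f → Computable (N ∘ f)
      N-computable cf = computable-π₁ (computable-π₁ cf)
      k-computable : ∀ {n} {f : Vec ℕ n → ℕ} → Computable f → Computable (k ∘ f)
      k-computable cf = computable-π₂ (computable-π₁ cf)

      approximates : ∀ j q x → ∣ ⌜ q ⌝ ⊝ x ∣≼ ⌜ 2^- j ⌝ → Approximates j q x
      approximates j q x h = unwrap≤ (proj₁ bounds) , unwrap≤ (proj₂ bounds)
        where
        bounds : ⌜ q ℚ.- 2^- j ⌝ ≼ x × x ≼ ⌜ q ℚ.+ 2^- j ⌝
        bounds = ∣∣⇒interval {x} q (2^- j) h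

      -- The error bound 0 expresses equality of reals, so that one argument serves the points
      -- themselves and their exact rational copies.
      dense-points : (P Q : ℕ → ℕ → ℝ) →
        (∀ N k → ∣ X.point N k ⊝ P N k ∣≼ ⌜ 0ℚ ⌝) → (∀ N l → ∣ Y.point N l ⊝ Q N l ∣≼ ⌜ 0ℚ ⌝) →
        ∀ {p} → p ∈ A → ∀ {ε} → 0ℝ < ε → ∃[ i ] (P (N i) (k i) , Q (N i) (l i)) ∈ Ball p ε
      dense-points P Q P≃ Q≃ {x , y} p∈A {ε} 0<ε =
        let n , near-enough = norm²-net {ε} 0≺ε
            x∈X , y∈Y = to p∈A
            a , _ , x~ = X.attractor-net x∈X n
            b , _ , y~ = Y.attractor-net y∈Y n
        in ⟨ ⟨ n , a ⟩ , b ⟩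
         , nested-decoded (λ N k l → (P N k , Q N l) ∈ Ball (x , y) ε) n a b
             (norm²⇒ball {x , y} {P n a , Q n b} {ε} 0≺ε (near-enough {x} {y} {P n a} {Q n b}
               (shifted x (X.point n a) (P n a) n x~ (P≃ n a)) (shifted y (Y.point n b) (Q n b) n y~ (Q≃ n b))))
        where
        0≺ε : ⌜ 0ℚ ⌝ ≺ ε
        0≺ε = <⇒≱ {0ℝ} {ε} (wrap 0<ε)
        +-0 : ∀ x → x ⊕ ⌜ 0ℚ ⌝ ≃ x
        +-0 = CommutativeRing.+-identityʳ ℝ-commutativeRing
        shifted : ∀ x u v n → ∣ x ⊝ u ∣≼ ⌜ 2^- n ⌝ → ∣ u ⊝ v ∣≼ ⌜ 0ℚ ⌝ → ∣ x ⊝ v ∣≼ ⌜ 2^- n ⌝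
        shifted x u v n h k = ∣∣-mono {⌜ 2^- n ⌝ ⊕ ⌜ 0ℚ ⌝} {⌜ 2^- n ⌝} {x ⊝ v}
          (≼-reflexive {⌜ 2^- n ⌝ ⊕ ⌜ 0ℚ ⌝} {⌜ 2^- n ⌝} (+-0 ⌜ 2^- n ⌝))
          (∣∣-triangle {x} {u} {⌜ 2^- n ⌝} {v} {⌜ 0ℚ ⌝} h k)

      product-REClosed : REClosed A
      product-REClosed = (λ i → X.point (N i) (k i) , Y.point (N i) (l i))
        , ( ( (λ i j → X̃.pointʲ (4 ℕ.+ j) (N i) (k i))
            , fractional⇒computableℚ (fractional-cong (λ { (_ ∷ _ ∷ []) → refl })
                (XC.pointʲ-fractional 4+j (N-computable i) (k-computable i)))
            , λ i j → approximates j (X̃.pointʲ (4 ℕ.+ j) (N i) (k i)) (X.point (N i) (k i)) (X̃.pointʲ-error j (N i) (k i)) )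
          , ( (λ i j → Ỹ.pointʲ (4 ℕ.+ j) (N i) (l i))
            , fractional⇒computableℚ (fractional-cong (λ { (_ ∷ _ ∷ []) → refl })
                (YC.pointʲ-fractional 4+j (N-computable i) (computable-π₂ i)))
            , λ i j → approximates j (Ỹ.pointʲ (4 ℕ.+ j) (N i) (l i)) (Y.point (N i) (l i)) (Ỹ.pointʲ-error j (N i) (l i)) ) )
        , (λ i → from (X.point-attractor (N i) (k i) , Y.point-attractor (N i) (l i)))
        , λ {p} → dense-points X.point Y.point
            (λ N k → ≃⇒∣∣ {X.point N k} {X.point N k} {0ℝ} ≃-refl ≼-refl)
            (λ N l → ≃⇒∣∣ {Y.point N l} {Y.point N l} {0ℝ} ≃-refl ≼-refl) {p}
        where
        i : Computable {2} (λ xs → lookup xs #0)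
        i = computable-lookup #0
        4+j : Computable {2} (λ xs → 4 ℕ.+ lookup xs #1)
        4+j = computable-const 4 +ᶜ computable-lookup #1

      product-REClosedℚ :
        ⌜ approximation r-approx 0 ⌝ ≃ r → ⌜ approximation d₁-approx 0 ⌝ ≃ d₁ → ⌜ approximation d₂-approx 0 ⌝ ≃ d₂ →
        ⌜ approximation s-approx 0 ⌝ ≃ s → ⌜ approximation e₁-approx 0 ⌝ ≃ e₁ → ⌜ approximation e₂-approx 0 ⌝ ≃ e₂ →
        REClosedℚ A
      product-REClosedℚ hr hd₁ hd₂ hs he₁ he₂ = (λ i → P (N i) (k i) , Q (N i) (l i))
        , ( fractional⇒computableℚ (XC.fold-fractional (λ _ → proj₁ x-start) (fractional-const (proj₁ x-start))
              (computable-const 0) (N-computable computable-head) (k-computable computable-head))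
          , fractional⇒computableℚ (YC.fold-fractional (λ _ → proj₁ y-start) (fractional-const (proj₁ y-start))
              (computable-const 0) (N-computable computable-head) (computable-π₂ computable-head)) )
        , (λ i → from ( X.attractor-cong {X.point (N i) (k i)} {fromℚ (P (N i) (k i))}
                          (≈-sym {fromℚ (P (N i) (k i))} {X.point (N i) (k i)} (P≃ (N i) (k i))) (X.point-attractor (N i) (k i))
                      , Y.attractor-cong {Y.point (N i) (l i)} {fromℚ (Q (N i) (l i))}
                          (≈-sym {fromℚ (Q (N i) (l i))} {Y.point (N i) (l i)} (Q≃ (N i) (l i))) (Y.point-attractor (N i) (l i))))
        , λ {p} → dense-points (λ N k → fromℚ (P N k)) (λ N l → fromℚ (Q N l))
            (λ N k → ≃⇒∣∣ {X.point N k} {fromℚ (P N k)} {0ℝ} (≈-sym {fromℚ (P N k)} {X.point N k} (P≃ N k)) ≼-refl)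
            (λ N l → ≃⇒∣∣ {Y.point N l} {fromℚ (Q N l)} {0ℝ} (≈-sym {fromℚ (Q N l)} {Y.point N l} (Q≃ N l)) ≼-refl) {p}
        where
        x-start : ∃[ a ] ⌜ a ⌝ ≃ X.z₀
        x-start = X̃.exact-start hr hd₁
        y-start : ∃[ a ] ⌜ a ⌝ ≃ Y.z₀
        y-start = Ỹ.exact-start hs he₁
        P Q : ℕ → ℕ → ℚ
        P = X̃.fold (λ _ → proj₁ x-start) 0
        Q = Ỹ.fold (λ _ → proj₁ y-start) 0
        P≃ : ∀ N k → ⌜ P N k ⌝ ≃ X.point N k
        P≃ = X̃.fold-exact hr hd₁ hd₂ (λ _ → proj₁ x-start) (proj₂ x-start)
        Q≃ : ∀ N l → ⌜ Q N l ⌝ ≃ Y.point N l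
        Q≃ = Ỹ.fold-exact hs he₁ he₂ (λ _ → proj₁ y-start) (proj₂ y-start)

-- Orbits of the horseshoe map and their addresses

module Dynamics (em : ExcludedMiddle 0ℓ) (S : Horseshoe) where
  open Horseshoe S
  open ArchimedeanField (ℝ-archimedeanField em)
    using (⌜_⌝; _≃_; _⊕_; _⊗_; _⊝_; _≺_)
  open Theory (ℝ-archimedeanField em) em
  open Plane em

  affine-def : ∀ d r x → d ⊕ r ⊗ x ≡ d + r * x
  affine-def d r x = trans {i = d ⊕ r ⊗ x} {d + r ⊗ x} {d + r * x} (+ᴿ-def d (r ⊗ x))
    (cong (λ t → d + t) {r ⊗ x} {r * x} (*ᴿ-def r x))

  affine-flip-def : ∀ d r x → d ⊕ r ⊗ (1ℝ ⊝ x) ≡ d + r * (1ℝ - x)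
  affine-flip-def d r x = trans {i = d ⊕ r ⊗ (1ℝ ⊝ x)} {d + r * (1ℝ ⊝ x)} {d + r * (1ℝ - x)}
    (affine-def d r (1ℝ ⊝ x)) (cong (λ t → d + r * t) {1ℝ ⊝ x} {1ℝ - x} (⊝-def 1ℝ x))

  expand-def : ∀ m y c → m ⊗ (y ⊝ c) ≡ m * (y - c)
  expand-def m y c = trans {i = m ⊗ (y ⊝ c)} {m * (y ⊝ c)} {m * (y - c)} (*ᴿ-def m (y ⊝ c))
    (cong (λ t → m * t) {y ⊝ c} {y - c} (⊝-def y c))

  expand-flip-def : ∀ m y c → 1ℝ ⊝ m ⊗ (y ⊝ c) ≡ 1ℝ - m * (y - c)
  expand-flip-def m y c = trans {i = 1ℝ ⊝ m ⊗ (y ⊝ c)} {1ℝ - m ⊗ (y ⊝ c)} {1ℝ - m * (y - c)}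
    (⊝-def 1ℝ (m ⊗ (y ⊝ c))) (cong (λ t → 1ℝ - t) {m ⊗ (y ⊝ c)} {m * (y - c)} (expand-def m y c))

  unit⇒interval : ∀ {x} → InUnit x → x ∈ Interval 0ℝ 1ℝ
  unit⇒interval (l , u) = unwrap≤ l , unwrap≤ u

  interval⇒unit : ∀ {x} → x ∈ Interval 0ℝ 1ℝ → InUnit x
  interval⇒unit (l , u) = wrap l , wrap u

  inUnit-resp : ∀ {x y} → x ≈ʳ y → InUnit y → InUnit x
  inUnit-resp {x} {y} e (l , u) = ≤-trans {0ℝ} {y} {x} l (≈⇒≥ {x} {y} e) , ≤-trans {x} {y} {1ℝ} (≈⇒≤ {x} {y} e) u

  0∈unit : 0ℝ ∈ Interval 0ℝ 1ℝ
  0∈unit = unit⇒interval {0ℝ} (≤-refl {0ℝ} , 0≼1)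

  strip : ∀ {d r x} → d ≤ʳ x → x ≤ʳ d ⊕ r → x ∈ Interval d (d + r)
  strip {d} {r} {x} l u = unwrap≤ l , unwrap≤ (subst (x ≤ʳ_) (+ᴿ-def d r) u)

  μ⊗μ⁻¹≃1 : μ ⊗ μ⁻¹ ≃ ⌜ 1ℚ ⌝
  μ⊗μ⁻¹≃1 = subst (_≈ʳ 1ℝ) (sym (*ᴿ-def μ μ⁻¹)) (wrap μ*μ⁻¹≈1)

  0≺μ : ⌜ 0ℚ ⌝ ≺ μ
  0≺μ μ≤0 = <⇒≱ {1ℝ} {μ} (wrap 1<μ) (≤-trans {μ} {0ℝ} {1ℝ} μ≤0 0≼1)

  stripsX : Strips ƛ d₁ d₂
  stripsX = record
    { 0≺r = <⇒≱ {0ℝ} {ƛ} (wrap 0<ƛ)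
    -- The strips are given as subsets of the plane; the point with other coordinate 0 tests a
    -- single coordinate.
    ; inUnit₁ = λ {x} l u → interval⇒unit {x} (proj₁ (V₁⊆I {x , 0ℝ} (strip {d₁} {ƛ} {x} l u , 0∈unit)))
    ; inUnit₂ = λ {x} l u → interval⇒unit {x} (proj₁ (V₂⊆I {x , 0ℝ} (strip {d₂} {ƛ} {x} l u , 0∈unit)))
    ; disjoint = λ {x} l₁ u₁ l₂ u₂ → V₁⊥V₂ {x , 0ℝ}
        ((strip {d₁} {ƛ} {x} l₁ u₁ , 0∈unit) , (strip {d₂} {ƛ} {x} l₂ u₂ , 0∈unit)) }

  stripsY : Strips μ⁻¹ c₁ c₂
  stripsY = record
    { 0≺r = 0≺reciprocal {μ} {μ⁻¹} 0≺μ μ⊗μ⁻¹≃1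
    ; inUnit₁ = λ {y} l u → interval⇒unit {y} (proj₂ (H₁⊆I {0ℝ , y} (0∈unit , strip {c₁} {μ⁻¹} {y} l u)))
    ; inUnit₂ = λ {y} l u → interval⇒unit {y} (proj₂ (H₂⊆I {0ℝ , y} (0∈unit , strip {c₂} {μ⁻¹} {y} l u)))
    ; disjoint = λ {y} l₁ u₁ l₂ u₂ → H₁⊥H₂ {0ℝ , y}
        ((0∈unit , strip {c₁} {μ⁻¹} {y} l₁ u₁) , (0∈unit , strip {c₂} {μ⁻¹} {y} l₂ u₂)) }

  module X = StripsIFS stripsX
  module Y = StripsIFS stripsY
  open Reciprocal {μ} {μ⁻¹} μ⊗μ⁻¹≃1

  -- As `f p` lies in the square, p lies in one of the horizontal strips. The vertical formula is
  -- solved for the old ordinate: abscissas contract forwards in time, ordinates backwards, and both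
  -- use the same digit.
  step⇒ : ∀ (p q : ∃ I) → f p ≈₂ proj₁ q →
    ∃[ b ] proj₁ (proj₁ q) ≈ʳ X.φ b (proj₁ (proj₁ p)) × proj₂ (proj₁ p) ≈ʳ Y.φ b (proj₂ (proj₁ q))
  step⇒ p@((x , y) , p∈I) ((x′ , y′) , (x′∈ , y′∈)) (e₁ , e₂) = branch (proj₁ f⁻¹[I] {x , y} (p∈I , fp∈I))
    where
    u v : ℝ
    u = proj₁ (f p)
    v = proj₂ (f p)
    fp∈I : f p ∈ I
    fp∈I = unit⇒interval {u} (inUnit-resp {u} {x′} (wrap e₁) (interval⇒unit {x′} x′∈))
         , unit⇒interval {v} (inUnit-resp {v} {y′} (wrap e₂) (interval⇒unit {y′} y′∈))
    -- `f` also receives the membership proof; `f-cong` makes its value independent of which proof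
    -- it is.
    same : ∀ (m : (x , y) ∈ I) → f p ≈₂ f ((x , y) , m)
    same m = f-cong {p} {(x , y) , m} (unwrap≈ (≈-refl {x}) , unwrap≈ (≈-refl {y}))
    chain : ∀ {t t′ t″ t‴} → t ≈ t′ → t ≈ t″ → t″ ≈ t‴ → t′ ≈ʳ t‴
    chain {t} {t′} {t″} {t‴} h k l =
      ≈-trans {t′} {t} {t‴} (≈-sym {t} {t′} (wrap h)) (≈-trans {t} {t″} {t‴} (wrap k) (wrap l))
    branch : (x , y) ∈ H₁ ⊎ (x , y) ∈ H₂ → ∃[ b ] x′ ≈ʳ X.φ b x × y ≈ʳ Y.φ b y′
    branch (inj₁ h) = false
      , subst (x′ ≈ʳ_) (sym (affine-def d₁ ƛ x)) (chain {u} {x′} {proj₁ f′} {d₁ + ƛ * x} e₁ (proj₁ s) (proj₁ on))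
      , expand⇒contract c₁ y y′ (subst (y′ ≈ʳ_) (sym (expand-def μ y c₁))
          (chain {v} {y′} {proj₂ f′} {μ * (y - c₁)} e₂ (proj₂ s) (proj₂ on)))
      where
      f′ : ℝ²
      f′ = f ((x , y) , H₁⊆I {x , y} h)
      s : f p ≈₂ f′
      s = same (H₁⊆I {x , y} h)
      on : f′ ≈₂ (d₁ + ƛ * x , μ * (y - c₁))
      on = f-on-H₁ {x} {y} h
    branch (inj₂ h) = true
      , subst (x′ ≈ʳ_) (sym (affine-flip-def d₂ ƛ x))
          (chain {u} {x′} {proj₁ f′} {d₂ + ƛ * (1ℝ - x)} e₁ (proj₁ s) (proj₁ on))
      , expand⇒contract-flip c₂ y y′ (subst (y′ ≈ʳ_) (sym (expand-flip-def μ y c₂))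
          (chain {v} {y′} {proj₂ f′} {1ℝ - μ * (y - c₂)} e₂ (proj₂ s) (proj₂ on)))
      where
      f′ : ℝ²
      f′ = f ((x , y) , H₂⊆I {x , y} h)
      s : f p ≈₂ f′
      s = same (H₂⊆I {x , y} h)
      on : f′ ≈₂ (d₂ + ƛ * (1ℝ - x) , 1ℝ - μ * (y - c₂))
      on = f-on-H₂ {x} {y} h

  -- An ordinate of the form `Y.φ b y` puts the point into the horizontal strip belonging to `b`,
  -- where the vertical formula undoes `Y.φ b`.
  step⇐ : ∀ b x y → InUnit x → InUnit y →
    Σ ((x , Y.φ b y) ∈ I) λ m → f ((x , Y.φ b y) , m) ≈₂ (X.φ b x , y)
  step⇐ false x y x∈ y∈ = H₁⊆I {x , t} h
    , unwrap≈ (subst (proj₁ f′ ≈ʳ_) (sym (affine-def d₁ ƛ x)) (wrap (proj₁ on)))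
    , unwrap≈ (≈-trans {proj₂ f′} {μ * (t - c₁)} {y} (wrap (proj₂ on))
        (subst (_≈ʳ y) (expand-def μ t c₁) (contract⇒expand c₁ y)))
    where
    t : ℝ
    t = Y.φ false y
    h : (x , t) ∈ H₁
    h = unit⇒interval {x} x∈ , strip {c₁} {μ⁻¹} {t} (proj₁ (Y.affine∈strip c₁ y∈)) (proj₂ (Y.affine∈strip c₁ y∈))
    f′ : ℝ²
    f′ = f ((x , t) , H₁⊆I {x , t} h)
    on : f′ ≈₂ (d₁ + ƛ * x , μ * (t - c₁))
    on = f-on-H₁ {x} {t} h
  step⇐ true x y x∈ y∈ = H₂⊆I {x , t} h
    , unwrap≈ (subst (proj₁ f′ ≈ʳ_) (sym (affine-flip-def d₂ ƛ x)) (wrap (proj₁ on)))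
    , unwrap≈ (≈-trans {proj₂ f′} {1ℝ - μ * (t - c₂)} {y} (wrap (proj₂ on))
        (subst (_≈ʳ y) (expand-flip-def μ t c₂) (contract⇒expand-flip c₂ y)))
    where
    t : ℝ
    t = Y.φ true y
    1-y∈ : InUnit (1ℝ ⊝ y)
    1-y∈ = Y.inUnit-flip y∈
    h : (x , t) ∈ H₂
    h = unit⇒interval {x} x∈ , strip {c₂} {μ⁻¹} {t} (proj₁ (Y.affine∈strip c₂ 1-y∈)) (proj₂ (Y.affine∈strip c₂ 1-y∈))
    f′ : ℝ²
    f′ = f ((x , t) , H₂⊆I {x , t} h)
    on : f′ ≈₂ (d₂ + ƛ * (1ℝ - x) , 1ℝ - μ * (t - c₂))
    on = f-on-H₂ {x} {t} h

  -- The set of abscissas of the orbit is covered by its two images by passing to predecessors, the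
  -- set of ordinates by passing to successors.
  Λ⇒attractors : ∀ {x y} → (x , y) ∈ Λ → X.Attractor x × Y.Attractor y
  Λ⇒attractors {x} {y} (_ , p , p₀≈ , orbit) =
      X.attractor-coinduction PX (λ {x} (j , e) → inUnit-resp {x} {px j} e (interval⇒unit {px j} (proj₁ (proj₂ (p j)))))
        nextX {x} (0ℤ , ≈-sym {px 0ℤ} {x} (wrap (proj₁ p₀≈)))
    , Y.attractor-coinduction PY (λ {y} (j , e) → inUnit-resp {y} {py j} e (interval⇒unit {py j} (proj₂ (proj₂ (p j)))))
        nextY {y} (0ℤ , ≈-sym {py 0ℤ} {y} (wrap (proj₂ p₀≈)))
    where
    px py : ℤ → ℝ
    px j = proj₁ (proj₁ (p j))
    py j = proj₂ (proj₁ (p j))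
    PX PY : ℝ → Set
    PX x = ∃[ j ] x ≈ʳ px j
    PY y = ∃[ j ] y ≈ʳ py j
    nextX : ∀ {x} → PX x → ∃[ b ] ∃[ x′ ] x ≃ X.φ b x′ × PX x′
    nextX {x} (j , e) =
      let i = ℤ.pred j
          b , h , _ = step⇒ (p i) (p j) (subst (λ k → f (p i) ≈₂ proj₁ (p k)) (ℤ.suc-pred j) (orbit i))
      in b , px i , ≈-trans {x} {px j} {X.φ b (px i)} e h , i , ≈-refl {px i}
    nextY : ∀ {y} → PY y → ∃[ b ] ∃[ y′ ] y ≃ Y.φ b y′ × PY y′
    nextY {y} (j , e) =
      let b , _ , h = step⇒ (p j) (p (ℤ.suc j)) (orbit j)
      in b , py (ℤ.suc j) , ≈-trans {y} {py j} {Y.φ b (py (ℤ.suc j))} e h , ℤ.suc j , ≈-refl {py (ℤ.suc j)}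

  -- The digits of y drive the future of the orbit and those of x its past.
  attractors⇒Λ : ∀ {x y} → X.Attractor x × Y.Attractor y → (x , y) ∈ Λ
  attractors⇒Λ {x} {y} (A , B) =
      (unit⇒interval {x} (X.attractor-inUnit A) , unit⇒interval {y} (Y.attractor-inUnit B))
    , p , (unwrap≈ (X.start A) , unwrap≈ (Y.start B)) , orbit
    where
    forward backward : ℕ → ℝ
    forward zero     = X.tails A 0
    forward (suc n)  = X.φ (Y.digits B n) (forward n)
    backward zero    = Y.tails B 0
    backward (suc n) = Y.φ (X.digits A n) (backward n)
    forward-inUnit : ∀ n → InUnit (forward n)
    forward-inUnit zero    = X.inUnit A 0
    forward-inUnit (suc n) = X.φ-inUnit (Y.digits B n) (forward-inUnit n)
    backward-inUnit : ∀ n → InUnit (backward n)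
    backward-inUnit zero    = Y.inUnit B 0
    backward-inUnit (suc n) = Y.φ-inUnit (X.digits A n) (backward-inUnit n)
    p : ℤ → ∃ I
    p (+ n) = (forward n , Y.tails B n)
      , unit⇒interval {forward n} (forward-inUnit n) , unit⇒interval {Y.tails B n} (Y.inUnit B n)
    -- This constructor stands for time -(n + 1), hence tail number n + 1.
    p -[1+ n ] = (X.tails A (suc n) , backward (suc n))
      , unit⇒interval {X.tails A (suc n)} (X.inUnit A (suc n))
      , unit⇒interval {backward (suc n)} (backward-inUnit (suc n))
    transition : ∀ (q : ∃ I) b y x′ → InUnit y → proj₂ (proj₁ q) ≈ʳ Y.φ b y → X.φ b (proj₁ (proj₁ q)) ≈ʳ x′ →
      f q ≈₂ (x′ , y)
    transition q@((x , t) , x∈ , t∈) b y x′ y∈ e e′ =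
        unwrap≈ (≈-trans {proj₁ (f q)} {proj₁ f′} {x′} (wrap (proj₁ same))
          (≈-trans {proj₁ f′} {X.φ b x} {x′} (wrap (proj₁ (proj₂ image))) e′))
      , unwrap≈ (≈-trans {proj₂ (f q)} {proj₂ f′} {y} (wrap (proj₂ same)) (wrap (proj₂ (proj₂ image))))
      where
      image : Σ ((x , Y.φ b y) ∈ I) λ m → f ((x , Y.φ b y) , m) ≈₂ (X.φ b x , y)
      image = step⇐ b x y (interval⇒unit {x} x∈) y∈
      f′ : ℝ²
      f′ = f ((x , Y.φ b y) , proj₁ image)
      same : f q ≈₂ f′
      same = f-cong {q} {(x , Y.φ b y) , proj₁ image} (unwrap≈ (≈-refl {x}) , unwrap≈ e)
    orbit : ∀ j → f (p j) ≈₂ proj₁ (p (ℤ.suc j))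
    orbit (+ n) = transition (p (+ n)) (Y.digits B n) (Y.tails B (suc n)) (forward (suc n))
      (Y.inUnit B (suc n)) (Y.step B n) (≈-refl {forward (suc n)})
    -- The step from time -1 to time 0 crosses between the two clauses of `p`: its digit is the
    -- first one of x, and applying it to tail 1 gives back tail 0.
    orbit -[1+ zero ] = transition (p -[1+ zero ]) (X.digits A 0) (backward 0) (X.tails A 0)
      (backward-inUnit 0) (≈-refl {backward 1})
      (≈-sym {X.tails A 0} {X.φ (X.digits A 0) (X.tails A 1)} (X.step A 0))
    orbit -[1+ suc n ] = transition (p -[1+ suc n ]) (X.digits A (suc n)) (backward (suc n)) (X.tails A (suc n))
      (backward-inUnit (suc n)) (≈-refl {backward (suc (suc n))})
      (≈-sym {X.tails A (suc n)} {X.φ (X.digits A (suc n)) (X.tails A (suc (suc n)))} (X.step A (suc n)))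

  open Approximable

  computable⇒approximable : ∀ {x} → ComputableReal x → Approximable x
  computable⇒approximable {x} (q , q-computable , q-near) = record
    { approximation = q
    ; fractional    = computableℚ⇒fractional q-computable
    ; near          = λ j → interval⇒∣∣ {x} (q j) (2^- j) (wrap (proj₁ (q-near j))) (wrap (proj₂ (q-near j))) }

  -- The sequence is exact already at index 0, which is where the rational dense sequence reads its
  -- parameters.
  rational⇒approximable : ∀ {x} → Rational x → Approximable x
  rational⇒approximable {x} (q , x≈q) = record
    { approximation = λ _ → q
    ; fractional    = fractional-const q
    ; near          = λ j → ≃⇒∣∣ {fromℚ q} {x} {⌜ 2^- j ⌝} (≈-sym {x} {fromℚ q} (wrap x≈q)) (0≼⌜2^-⌝ j) }

  module ReciprocalApproximation (μ-approx : Approximable μ) where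
    private
      q : ℕ → ℚ
      q = approximation μ-approx
      0≺ν = Strips.0≺r stripsY
      ν≼½ = Strips.r≼½ stripsY
      1≤q : ∀ j → 1ℚ ℚ.≤ q j
      1≤q j = 1≼approximation 0≺ν ν≼½ 0≺μ {q j} {⌜ 2^- j ⌝} (near μ-approx j) (⌜2^-⌝≼1 j)
      0<q : ∀ j → 0ℚ ℚ.< q j
      0<q j = ℚ.<-≤-trans 0<1 (1≤q j)
      p : ℕ → ℚ
      p j = proj₁ (inverse (q j) (0<q j))
      0<p : ∀ j → 0ℚ ℚ.< p j
      0<p j = proj₁ (proj₂ (inverse (q j) (0<q j)))
      qp≡1 : ∀ j → q j ℚ.* p j ≡ 1ℚ
      qp≡1 j = proj₂ (proj₂ (inverse (q j) (0<q j)))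

    reciprocal-approximable : Approximable μ⁻¹
    reciprocal-approximable = record
      { approximation = p
      ; fractional    = fractional-inverse {p = p ∘ head} {q = q ∘ head}
          (λ xs → trans (ℚ.*-comm (p (head xs)) (q (head xs))) (qp≡1 (head xs))) (λ xs → 0<q (head xs)) (fractional μ-approx)
      ; near          = λ j → reciprocal-near 0≺ν ν≼½ {p j} {q j} {⌜ 2^- j ⌝} (near μ-approx j) (1≤q j) (qp≡1 j) (0<p j) }

    reciprocal-approximable-exact : ⌜ q 0 ⌝ ≃ μ → ⌜ approximation reciprocal-approximable 0 ⌝ ≃ μ⁻¹
    reciprocal-approximable-exact h = reciprocal-exact {p 0} {q 0} h (qp≡1 0)

  module Computed (μ-approx : Approximable μ) (ƛ-approx : Approximable ƛ)
    (c₁-approx : Approximable c₁) (c₂-approx : Approximable c₂)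
    (d₁-approx : Approximable d₁) (d₂-approx : Approximable d₂) where
    open ReciprocalApproximation μ-approx public
    open ProductOfAttractors stripsX stripsY ƛ-approx d₁-approx d₂-approx reciprocal-approximable c₁-approx c₂-approx
      public using (product-closed; product-REClosed; product-coREClosed; product-REClosedℚ)

  computable : ComputableParameters parameters → ComputableClosed Λ
  computable C = record
    { closed     = λ {p} → product-closed Λ Λ⇒attractors attractors⇒Λ {p}
    ; reClosed   = product-REClosed Λ Λ⇒attractors attractors⇒Λ
    ; coREClosed = product-coREClosed Λ Λ⇒attractors attractors⇒Λ }
    where
    open ComputableParameters C
    open Computed (computable⇒approximable {μ} μ-computable) (computable⇒approximable {ƛ} ƛ-computable)
      (computable⇒approximable {c₁} c₁-computable) (computable⇒approximable {c₂} c₂-computable)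
      (computable⇒approximable {d₁} d₁-computable) (computable⇒approximable {d₂} d₂-computable)

  rational-exact : ∀ {x} (R : Rational x) → fromℚ (proj₁ R) ≈ʳ x
  rational-exact {x} (q , x≈q) = ≈-sym {x} {fromℚ q} (wrap x≈q)

  rational : RationalParameters parameters → ComputableClosedℚ Λ
  rational R = record
    { closed     = λ {p} → product-closed Λ Λ⇒attractors attractors⇒Λ {p}
    ; reClosed   = product-REClosedℚ Λ Λ⇒attractors attractors⇒Λ
        (rational-exact {ƛ} ƛ-rational) (rational-exact {d₁} d₁-rational) (rational-exact {d₂} d₂-rational)
        (reciprocal-approximable-exact (rational-exact {μ} μ-rational))
        (rational-exact {c₁} c₁-rational) (rational-exact {c₂} c₂-rational)
    ; coREClosed = product-coREClosed Λ Λ⇒attractors attractors⇒Λ }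
    where
    open RationalParameters R
    open Computed (rational⇒approximable {μ} μ-rational) (rational⇒approximable {ƛ} ƛ-rational)
      (rational⇒approximable {c₁} c₁-rational) (rational⇒approximable {c₂} c₂-rational)
      (rational⇒approximable {d₁} d₁-rational) (rational⇒approximable {d₂} d₂-rational)

theorem14 : ExcludedMiddle 0ℓ → (S : Horseshoe) → let open Horseshoe S in
    Λ ⊆ I ×
    (ComputableParameters parameters → ComputableClosed Λ) ×
    (RationalParameters parameters → ComputableClosedℚ Λ)
theorem14 em S = proj₁ , Dynamics.computable em S , Dynamics.rational em S
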